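{- Let $q$ be a prime power, $n\ge2$, $s\ge2$, $1\le k\le n-1$ integers, $\sigma$ a generator of $\mathrm{Gal}(\mathbb F_{q^n}/\mathbb F_q)$, and $F\in\mathbb F_q[Y]$ a monic irreducible polynomial of degree $s$. If $(n,s,F)\ne(2,2,Y^2-\nu)$ for every $\nu\in\mathbb F_q^\times$, then $$|\mathrm{Aut}_{\mathbb E_F}(\mathcal S_k(F))|=n\,\frac{(q^s-1)(q^n-1)^2}{q-1}.$$
   Context: $R=\mathbb F_{q^n}[X;\sigma]$ is the skew polynomial ring with $X\alpha=\sigma(\alpha)X$; its center is $\mathbb F_q[X^n]$. $RF(X^n)$ is a two-sided ideal, $R_F:=R/RF(X^n)$, and $\mathbb E_F:=Z(R_F)\cong\mathbb F_q[Y]/(F)\cong\mathbb F_{q^s}$; $R_F\cong M_n(\mathbb E_F)$ as $\mathbb E_F$-algebras. The code is $$\mathcal S_k(F):=\Big\{\sum_{i=0}^{sk-1}\alpha_iX^i+RF(X^n):\alpha_i\in\mathbb F_{q^n}\Big\}\subseteq R_F ,$$ and, under $R_F\cong M_n(\mathbb E_F)$, its linear automorphism group is $$\mathrm{Aut}_{\mathbb E_F}(\mathcal S_k(F)):=\{(\bar g,\bar h)\in R_F^\times\times R_F^\times:\ \bar g\,\mathcal S_k(F)\,\bar h=\mathcal S_k(F)\}.$$ -}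

module Defs where

open import Level using (Level; _⊔_) renaming (suc to lsuc)
open import Algebra.Bundles using (CommutativeRing; RawRing)
open import Algebra.Definitions using (Invertible)
import Algebra.Definitions.RawMagma as RawMagmaDefs
import Algebra.Definitions.RawSemiring as RawSemiringDefs
open import Algebra.Morphism.Structures using (module RingMorphisms)
open import Data.Fin.Base using (Fin)
open import Data.List.Base using (List; []; _∷_; map)
open import Data.Nat.Base as ℕ using (ℕ; zero; suc; NonZero)
import Data.Nat.Properties as ℕₚ
open import Data.Nat.GeneralisedArithmetic using (iterate)
open import Data.Nat.Primality using (Prime; prime⇒nonTrivial)
open import Data.Product.Base using (Σ-syntax; ∃-syntax; _×_; _,_)
open import Data.Vec.Base using (Vec; toList)
open import Function.Base using (id)
open import Function.Definitions using (Bijective)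
open import Relation.Binary.Core using (Rel)
open import Relation.Binary.PropositionalEquality.Core using (_≡_; refl)
open import Relation.Nullary.Negation.Core using (¬_)
open import Relation.Unary using (Pred; _≐_)

private
  variable
    a b c₁ c₂ ℓ ℓ₁ ℓ₂ : Level

-- A has exactly m elements up to _≈_.
HasCardinality : (A : Set a) → Rel A ℓ → ℕ → Set (a ⊔ ℓ)
HasCardinality A _≈_ m = Σ[ f ∈ (Fin m → A) ] Bijective _≡_ _≈_ f

record IsPrimePower (q : ℕ) : Set where
  field
    p e   : ℕ
    prime : Prime p
    1≤e   : 1 ℕ.≤ e
    q≡p^e : q ≡ p ℕ.^ e

-- For dividing by q - 1, which is exact on q^s - 1, so that the truncating
-- _/_ on ℕ gives the true quotient.
instance
  q∸1-nonZero : ∀ {q} ⦃ _ : IsPrimePower q ⦄ → NonZero (q ℕ.∸ 1)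
  q∸1-nonZero ⦃ record { p = p ; e = suc e ; prime = pr ; q≡p^e = refl } ⦄ =
    ℕ.>-nonZero (ℕₚ.m<n⇒0<n∸m 1<p^e)
    where
    1<p : 1 ℕ.< p
    1<p = ℕ.nonTrivial⇒n>1 p ⦃ prime⇒nonTrivial pr ⦄
    1<p^e : 1 ℕ.< p ℕ.^ suc e
    1<p^e = ℕₚ.<-≤-trans 1<p
      (ℕₚ.m≤m*n p (p ℕ.^ e)
        ⦃ ℕₚ.m^n≢0 p e ⦃ ℕ.>-nonZero (ℕₚ.<-trans (ℕ.s≤s ℕ.z≤n) 1<p) ⦄ ⦄)

record FiniteField c ℓ (m : ℕ) : Set (lsuc (c ⊔ ℓ)) where
  field
    commutativeRing : CommutativeRing c ℓ
  open CommutativeRing commutativeRing public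
  field
    0≉1         : ¬ (0# ≈ 1#)
    inverse     : ∀ x → ¬ (x ≈ 0#) → Invertible _≈_ 1# _*_ x
    cardinality : HasCardinality Carrier _≈_ m

module _ {q m} (k : FiniteField c₁ ℓ₁ q) (K : FiniteField c₂ ℓ₂ m) where
  private
    module k = FiniteField k
    module K = FiniteField K

  -- A ring homomorphism between fields is injective, so this is a field
  -- extension K / ι(k).
  IsExtension : (k.Carrier → K.Carrier) → Set _
  IsExtension = RingMorphisms.IsRingHomomorphism k.rawRing K.rawRing

  module _ (ι : k.Carrier → K.Carrier) where

    record IsGaloisAutomorphism (τ : K.Carrier → K.Carrier)
           : Set (c₁ ⊔ c₂ ⊔ ℓ₂) where
      field
        isRingIsomorphism :
          RingMorphisms.IsRingIsomorphism K.rawRing K.rawRing τ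
        fixes             : ∀ x → τ (ι x) K.≈ ι x

    -- The Galois group is finite, so the powers with natural exponent are
    -- all the powers of σ.
    GeneratesGaloisGroup : (K.Carrier → K.Carrier) → Set _
    GeneratesGaloisGroup σ =
      IsGaloisAutomorphism σ ×
      (∀ τ → IsGaloisAutomorphism τ → ∃[ i ] ∀ x → τ x K.≈ iterate σ x i)

-- A[X;σ] with X α = σ(α) X.  A polynomial is the list of its left
-- coefficients, constant term first; trailing zeros are ignored by _≈ₚ_.
module SkewPolynomial (A : RawRing a ℓ) (σ : RawRing.Carrier A → RawRing.Carrier A)
  where
  open RawRing A

  Poly : Set a
  Poly = List Carrier

  coeff : Poly → ℕ → Carrier
  coeff []      _       = 0#
  coeff (x ∷ f) zero    = x
  coeff (x ∷ f) (suc i) = coeff f i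

  infix 4 _≈ₚ_
  _≈ₚ_ : Rel Poly ℓ
  f ≈ₚ g = ∀ i → coeff f i ≈ coeff g i

  infixl 6 _+ₚ_
  _+ₚ_ : Poly → Poly → Poly
  []      +ₚ g       = g
  (x ∷ f) +ₚ []      = x ∷ f
  (x ∷ f) +ₚ (y ∷ g) = (x + y) ∷ (f +ₚ g)

  -- (x + f X) g = x g + (f gˢ) X, where X g = gˢ X and gˢ is g with σ
  -- applied to every coefficient.
  infixl 7 _*ₚ_
  _*ₚ_ : Poly → Poly → Poly
  []      *ₚ g = []
  (x ∷ f) *ₚ g = map (x *_) g +ₚ (0# ∷ (f *ₚ map σ g))

  rawRingₚ : RawRing a ℓ
  rawRingₚ = record
    { Carrier = Poly
    ; _≈_     = _≈ₚ_
    ; _+_     = _+ₚ_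
    ; _*_     = _*ₚ_
    ; -_      = map (-_)
    ; 0#      = []
    ; 1#      = 1# ∷ []
    }

  const : Carrier → Poly
  const x = x ∷ []

  X : Poly
  X = 0# ∷ 1# ∷ []

module Polynomial (A : RawRing a ℓ) where
  open SkewPolynomial A id public
  open RawRing A

  IsMonicOfDegree : ℕ → Poly → Set ℓ
  IsMonicOfDegree s f = coeff f s ≈ 1# × (∀ i → s ℕ.< i → coeff f i ≈ 0#)

  -- Nonunit, and in every factorization some factor is a unit; over a
  -- nontrivial ring this excludes 0 = 0 · 0.
  Irreducible : Pred Poly (a ⊔ ℓ)
  Irreducible = RawSemiringDefs.Irreducible (RawRing.rawSemiring rawRingₚ)

  Y²-_ : Carrier → Poly
  Y²- ν = (- ν) ∷ 0# ∷ 1# ∷ []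

module Code {q m} (k : FiniteField c₁ ℓ₁ q) (K : FiniteField c₂ ℓ₂ m)
  (ι : FiniteField.Carrier k → FiniteField.Carrier K)
  (σ : FiniteField.Carrier K → FiniteField.Carrier K)
  (n : ℕ) (F : Polynomial.Poly (FiniteField.rawRing k))
  where
  private
    module k = FiniteField k
    module K = FiniteField K

  open SkewPolynomial K.rawRing σ using (Poly; rawRingₚ; const; X)
  private
    module R = RawRing rawRingₚ
  open RawSemiringDefs R.rawSemiring using (_^_)
  open RawMagmaDefs R.*-rawMagma using (_∣ʳ_)

  evalXⁿ : Polynomial.Poly k.rawRing → Poly
  evalXⁿ []      = R.0#
  evalXⁿ (x ∷ f) = const (ι x) R.+ evalXⁿ f R.* (X ^ n)

  -- R_F is carried by the representatives in R = K[X;σ]: f and g are equal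
  -- when f - g = h F(Xⁿ) for some h ∈ R.
  infix 4 _≈F_
  _≈F_ : Rel Poly (c₂ ⊔ ℓ₂)
  f ≈F g = evalXⁿ F ∣ʳ (f R.+ (R.- g))

  IsUnit : Pred Poly (c₂ ⊔ ℓ₂)
  IsUnit = Invertible _≈F_ R.1# R._*_

  𝒮 : (d : ℕ) → Pred Poly (c₂ ⊔ ℓ₂)
  𝒮 d f = Σ[ α ∈ Vec K.Carrier d ] f ≈F toList α

  _·[_]·_ : Poly → Pred Poly b → Poly → Pred Poly (b ⊔ c₂ ⊔ ℓ₂)
  (g ·[ C ]· h) f = ∃[ c ] C c × f ≈F (g R.* c R.* h)

  Aut : Pred Poly b → Set (b ⊔ c₂ ⊔ ℓ₂)
  Aut C = Σ[ (g , h) ∈ Poly × Poly ] IsUnit g × IsUnit h × (g ·[ C ]· h) ≐ C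

  _≈Aut_ : {C : Pred Poly b} → Rel (Aut C) (c₂ ⊔ ℓ₂)
  ((g , h) , _) ≈Aut ((g′ , h′) , _) = g ≈F g′ × h ≈F h′

{-# OPTIONS --safe #-}

-- Put M = sk and N = sn, so that the Xⁱ with i < N form a left basis of R_F over
-- K = 𝔽_{qⁿ} and S = 𝒮_k(F) is spanned by those with i < M.  Let g S h = S.  The
-- left and right idealizers of S are K, because f X^(M−d) ∉ S if f has degree
-- d ≥ 1; hence g and h normalize K and act on it as σ^i and σ^j.  So for m < M the
-- exponents of w_m = g X^m h ∈ S lie in the class of m + i + j modulo n.  As Xⁿ is
-- central, shifting w_m by powers of Xⁿ out of S bounds its degree from above.
-- If n ∤ i + j, the bounds are contradictory unless n ∣ M, when w_m is a monomial
-- for all m < n; comparing the values of g X g⁻¹ = w_{m+1} w_m⁻¹ then shows that Xⁿ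
-- is constant (X⁴ if n = 2), which happens only for the excluded F.
-- If n ∣ i + j, two consecutive w_T are monomials of degree T, so g X = κ X g and
-- the coefficients of g X^{−i} have ratios fixed by σ.  Thus g = a z(Xⁿ) X^i with z
-- monic over 𝔽_q of degree < s, and h⁻¹ = b z(Xⁿ) X^i.  Conversely every i < n,
-- every such z and all a, b ≠ 0 give an automorphism, and z(Xⁿ), a, b, i are
-- determined by (g, h).

module Submission where

open import Defs
open import Level using (Level; _⊔_)
open import Algebra.Bundles using (CommutativeRing; RawRing; Ring; CommutativeMonoid)
import Algebra.Definitions.RawMagma as RawMagmaDefs
import Algebra.Definitions.RawSemiring as RawSemiringDefs
open import Algebra.Morphism.Structures using (module RingMorphisms)
import Algebra.Properties.CommutativeMonoid.Sum as MonoidSum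
import Algebra.Properties.Semiring.Exp as Exp
import Algebra.Properties.CommutativeSemigroup as CommutativeSemigroupProperties
import Algebra.Properties.Ring as RingProperties
open import Data.Empty using (⊥; ⊥-elim)
open import Data.Fin.Base as Fin using (Fin; zero; suc; toℕ; fromℕ<; punchIn; punchOut; combine; remQuot)
import Data.Fin.Permutation as Perm
import Data.Fin.Properties as Finₚ
open import Data.List.Base using (List; []; _∷_; map; length; applyUpTo)
import Data.List.Properties as Listₚ
open import Data.Nat.Base as ℕ using (ℕ; zero; suc; NonZero; _≤_; _<_; z≤n; s≤s)
import Data.Nat.Properties as ℕₚ
open import Data.Nat.DivMod as DivMod using (_%_)
open import Data.Nat.Divisibility as Div using (_∣_)
open import Data.Nat.GeneralisedArithmetic using (iterate)
open import Data.Product.Base using (Σ-syntax; ∃; _×_; _,_; proj₁; proj₂)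
open import Data.Sum.Base using (_⊎_; inj₁; inj₂)
open import Data.Vec.Base as Vec using (Vec; []; _∷_; toList)
open import Data.Vec.Relation.Binary.Pointwise.Inductive as VecPointwise using ([]; _∷_)
open import Function.Base using (id; _∘_)
open import Function.Definitions using (Injective)
open import Relation.Binary.Core using (Rel)
open import Relation.Binary.PropositionalEquality as ≡ using (_≡_; _≢_)
import Relation.Binary.Reasoning.Setoid as SetoidReasoning
open import Tactic.MonoidSolver using (solve)
import Relation.Binary.Definitions as Tri
import Relation.Binary.Construct.On as On
open import Data.Product.Relation.Binary.Pointwise.NonDependent using (×-isEquivalence)
open import Relation.Binary.Structures using (IsEquivalence)
open import Relation.Nullary using (¬_; Dec; yes; no)
open import Relation.Nullary.Decidable as Dec using ()

-- Coordinates in the basis Xⁱ, i < N, replace the matrix algebra. Their limitation shapes the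
-- proof: multiplication by X is a shift only while the degree stays below N, and an arbitrary unit
-- g mixes all coordinates. So every comparison goes through the elements w_m, of low degree for m <
-- M, and through powers of the central Xⁿ, which can be moved past g. From s ≥ 2 and k ≤ n - 1 one
-- gets M + 2 ≤ N, room for two exponents beyond S. If n ∤ i + j, conjugation of X by g permutes
-- exponents cyclically, and the return to exponent 0 makes a power of X constant. Below degree N
-- this is absurd; only n = s = 2 reaches X⁴ = X^N, and F = Y² - ν makes exactly that power
-- constant. The factor (q^s - 1)/(q - 1) counts z: the monic polynomials of degree < s represent
-- the group of nonzero elements of 𝔼_F modulo that of 𝔽_q, and the scalars from 𝔽_q are absorbed in
-- a. The two factors qⁿ - 1 count a and b, and n counts i. The order and the fixed field of σ come
-- from the Frobenius: it lies in the group that σ generates, and σ in turn is one of its powers.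

-- Finite sets up to an equivalence: decidability, pigeonhole, cardinalities.

module Finite {a ℓ} {A : Set a} {_≈_ : Rel A ℓ} (isEq : IsEquivalence _≈_)
  {m} (card : HasCardinality A _≈_ m) where
  open IsEquivalence isEq

  enum : Fin m → A
  enum = proj₁ card

  enum-injective : ∀ {i j} → enum i ≈ enum j → i ≡ j
  enum-injective = proj₁ (proj₂ card)

  index : A → Fin m
  index y = proj₁ (proj₂ (proj₂ card) y)

  enum-index : ∀ y → enum (index y) ≈ y
  enum-index y = proj₂ (proj₂ (proj₂ card) y) ≡.refl

  index-cong : ∀ {x y} → x ≈ y → index x ≡ index y
  index-cong {x} {y} p =
    enum-injective (trans (enum-index x) (trans p (sym (enum-index y))))

  index-injective : ∀ {x y} → index x ≡ index y → x ≈ y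
  index-injective {x} {y} p =
    trans (sym (enum-index x)) (trans (reflexive (≡.cong enum p)) (enum-index y))

  index-enum : ∀ i → index (enum i) ≡ i
  index-enum i = enum-injective (enum-index (enum i))

  infix 4 _≟_
  _≟_ : ∀ x y → Dec (x ≈ y)
  x ≟ y = Dec.map′ index-injective index-cong (index x Finₚ.≟ index y)

  -- Excluded middle for a decidable property, with a counterexample in the negative case. It serves
  -- to find an element of K at which a given polynomial does not vanish.
  search : ∀ {p} (P : A → Set p) → (∀ {x y} → x ≈ y → P x → P y) →
           (∀ x → Dec (P x)) → (∃ λ x → ¬ P x) ⊎ (∀ x → P x)
  search P resp P? with Finₚ.all? (λ i → P? (enum i))
  ... | yes all = inj₂ (λ x → resp (enum-index x) (all (index x)))
  ... | no ¬all with Finₚ.¬∀⟶∃¬ m (P ∘ enum) (λ i → P? (enum i)) ¬all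
  ...   | i , ¬p = inj₁ (enum i , ¬p)

-- If y were missed, deleting y from the codomain would inject m + 1 elements into m.
Fin-injective⇒surjective : ∀ {m} (f : Fin m → Fin m) → Injective _≡_ _≡_ f →
                           ∀ y → ∃ λ x → f x ≡ y
Fin-injective⇒surjective {m} f inj y with Finₚ.any? (λ x → f x Finₚ.≟ y)
... | yes p = p
Fin-injective⇒surjective {suc m} f inj y | no ¬p =
  ⊥-elim (ℕₚ.1+n≰n (Finₚ.injective⇒≤ {f = g} g-injective))
  where
  y≢ : ∀ x → y ≢ f x
  y≢ x y≡fx = ¬p (x , ≡.sym y≡fx)
  g : Fin (suc m) → Fin m
  g x = punchOut (y≢ x)
  g-injective : Injective _≡_ _≡_ g
  g-injective {x} {x′} e = inj (Finₚ.punchOut-injective (y≢ x) (y≢ x′) e)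

module _ {a b ℓa ℓb} {A : Set a} {B : Set b} {_≈A_ : Rel A ℓa} {_≈B_ : Rel B ℓb}
  (eqA : IsEquivalence _≈A_) (eqB : IsEquivalence _≈B_) where
  private
    module A = IsEquivalence eqA
    module B = IsEquivalence eqB

  transfer-cardinality : ∀ {m} → HasCardinality A _≈A_ m → (φ : A → B) →
    (∀ {x y} → x ≈A y → φ x ≈B φ y) → (∀ {x y} → φ x ≈B φ y → x ≈A y) →
    (∀ y → ∃ λ x → φ x ≈B y) → HasCardinality B _≈B_ m
  transfer-cardinality card φ cong inj surj =
    φ ∘ F.enum , F.enum-injective ∘ inj ,
    λ y → F.index (proj₁ (surj y)) ,
      λ { ≡.refl → B.trans (cong (F.enum-index _)) (proj₂ (surj y)) }
    where module F = Finite eqA card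

  ×-cardinality : ∀ {m n} → HasCardinality A _≈A_ m → HasCardinality B _≈B_ n →
    HasCardinality (A × B) (λ (x , y) (x′ , y′) → x ≈A x′ × y ≈B y′) (m ℕ.* n)
  ×-cardinality {m} {n} cardA cardB = f , f-injective , f-surjective
    where
    module FA = Finite eqA cardA
    module FB = Finite eqB cardB
    f : Fin (m ℕ.* n) → A × B
    f i = FA.enum (proj₁ (remQuot {m} n i)) , FB.enum (proj₂ (remQuot {m} n i))
    f-injective : ∀ {i j} →
      FA.enum (proj₁ (remQuot {m} n i)) ≈A FA.enum (proj₁ (remQuot {m} n j)) ×
      FB.enum (proj₂ (remQuot {m} n i)) ≈B FB.enum (proj₂ (remQuot {m} n j)) → i ≡ j
    f-injective {i} {j} (p , q) =
      ≡.trans (≡.sym (Finₚ.combine-remQuot {m} n i))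
        (≡.trans (≡.cong₂ combine (FA.enum-injective p) (FB.enum-injective q))
          (Finₚ.combine-remQuot {m} n j))
    f-surjective : ∀ ((x , y) : A × B) → ∃ λ i → ∀ {j} → j ≡ i →
                   proj₁ (f j) ≈A x × proj₂ (f j) ≈B y
    f-surjective (x , y) = combine (FA.index x) (FB.index y) , λ { ≡.refl →
      A.trans (A.reflexive (≡.cong (FA.enum ∘ proj₁) rq)) (FA.enum-index x) ,
      B.trans (B.reflexive (≡.cong (FB.enum ∘ proj₂) rq)) (FB.enum-index y) }
      where rq = Finₚ.remQuot-combine (FA.index x) (FB.index y)

  ⊎-cardinality : ∀ {m n c ℓc} {C : Set c} {_≈C_ : Rel C ℓc} → IsEquivalence _≈C_ →
    HasCardinality A _≈A_ m → HasCardinality B _≈B_ n →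
    (φ : A → C) (ψ : B → C) →
    (∀ {x y} → x ≈A y → φ x ≈C φ y) → (∀ {x y} → φ x ≈C φ y → x ≈A y) →
    (∀ {x y} → x ≈B y → ψ x ≈C ψ y) → (∀ {x y} → ψ x ≈C ψ y → x ≈B y) →
    (∀ {x y} → ¬ (φ x ≈C ψ y)) → (∀ z → (∃ λ x → φ x ≈C z) ⊎ (∃ λ y → ψ y ≈C z)) →
    HasCardinality C _≈C_ (m ℕ.+ n)
  ⊎-cardinality {m} {n} {C = C} {_≈C_} eqC cardA cardB φ ψ φ-cong φ-inj ψ-cong ψ-inj disj cover =
    f , f-injective , f-surjective
    where
    module C = IsEquivalence eqC
    module FA = Finite eqA cardA
    module FB = Finite eqB cardB
    h : Fin m ⊎ Fin n → C
    h (inj₁ i) = φ (FA.enum i)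
    h (inj₂ j) = ψ (FB.enum j)
    h-injective : ∀ x y → h x ≈C h y → x ≡ y
    h-injective (inj₁ x) (inj₁ y) p = ≡.cong inj₁ (FA.enum-injective (φ-inj p))
    h-injective (inj₁ x) (inj₂ y) p = ⊥-elim (disj p)
    h-injective (inj₂ x) (inj₁ y) p = ⊥-elim (disj (C.sym p))
    h-injective (inj₂ x) (inj₂ y) p = ≡.cong inj₂ (FB.enum-injective (ψ-inj p))
    f : Fin (m ℕ.+ n) → C
    f i = h (Fin.splitAt m i)
    f-injective : ∀ {i j} → f i ≈C f j → i ≡ j
    f-injective {i} {j} p =
      ≡.trans (≡.sym (Finₚ.join-splitAt m n i))
        (≡.trans (≡.cong (Fin.join m n) (h-injective (Fin.splitAt m i) (Fin.splitAt m j) p))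
          (Finₚ.join-splitAt m n j))
    f-surjective : ∀ z → ∃ λ i → ∀ {j} → j ≡ i → f j ≈C z
    f-surjective z with cover z
    ... | inj₁ (x , p) = Fin.join m n (inj₁ (FA.index x)) , λ { ≡.refl →
      C.trans (C.reflexive (≡.cong h (Finₚ.splitAt-join m n (inj₁ (FA.index x)))))
        (C.trans (φ-cong (FA.enum-index x)) p) }
    ... | inj₂ (x , p) = Fin.join m n (inj₂ (FB.index x)) , λ { ≡.refl →
      C.trans (C.reflexive (≡.cong h (Finₚ.splitAt-join m n (inj₂ (FB.index x)))))
        (C.trans (ψ-cong (FB.enum-index x)) p) }

  -- This replaces the construction of inverses: surjectivity of σ^i, of Galois automorphisms and of
  -- v ↦ v(θ) all follow from equal cardinalities.
  injection⇒surjection : ∀ {m} → HasCardinality A _≈A_ m → HasCardinality B _≈B_ m →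
    (φ : A → B) → (∀ {x y} → φ x ≈B φ y → x ≈A y) →
    ∀ y → ∃ λ x → φ x ≈B y
  injection⇒surjection cardA cardB φ inj y
    with Fin-injective⇒surjective (FB.index ∘ φ ∘ FA.enum)
           (FA.enum-injective ∘ inj ∘ FB.index-injective) (FB.index y)
    where
    module FA = Finite eqA cardA
    module FB = Finite eqB cardB
  ... | i , e = Finite.enum eqA cardA i , Finite.index-injective eqB cardB e

module _ {a ℓ} {A : Set a} {_≈_ : Rel A ℓ} (isEq : IsEquivalence _≈_) where
  open IsEquivalence isEq

  -- Produces a linear relation between 1, θ, ..., θⁿ over 𝔽_q by counting.
  collision : ∀ {b ℓb m n} {B : Set b} {_≈B_ : Rel B ℓb} → IsEquivalence _≈B_ →
    HasCardinality A _≈_ m → HasCardinality B _≈B_ n → n < m → (φ : A → B) →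
    ∃ λ x → ∃ λ y → ¬ (x ≈ y) × φ x ≈B φ y
  collision eqB cardA cardB n<m φ
    with Finₚ.pigeonhole n<m (Finite.index eqB cardB ∘ φ ∘ Finite.enum isEq cardA)
  ... | i , j , i<j , e =
    FA.enum i , FA.enum j ,
    (λ p → Finₚ.<⇒≢ i<j (FA.enum-injective p)) ,
    Finite.index-injective eqB cardB e
    where module FA = Finite isEq cardA

  without-cardinality : ∀ {m} → HasCardinality A _≈_ m → (z : A) →
    HasCardinality (Σ[ x ∈ A ] ¬ (x ≈ z)) (λ x y → proj₁ x ≈ proj₁ y) (m ℕ.∸ 1)
  without-cardinality {zero} card z with () ← Finite.index isEq card z
  without-cardinality {suc m} card z = f , f-injective , f-surjective
    where
    open Finite isEq card
    f : Fin m → Σ[ x ∈ A ] ¬ (x ≈ z)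
    f i = enum (punchIn (index z) i) , λ p →
      Finₚ.punchInᵢ≢i (index z) i (≡.trans (≡.sym (index-enum _)) (index-cong p))
    f-injective : ∀ {i j} → proj₁ (f i) ≈ proj₁ (f j) → i ≡ j
    f-injective p = Finₚ.punchIn-injective (index z) _ _ (enum-injective p)
    f-surjective : ∀ (y : Σ[ x ∈ A ] ¬ (x ≈ z)) →
                   ∃ λ i → ∀ {j} → j ≡ i → proj₁ (f j) ≈ proj₁ y
    f-surjective (y , y≉z) = punchOut z≢y , λ { ≡.refl →
      trans (reflexive (≡.cong enum (Finₚ.punchIn-punchOut z≢y))) (enum-index y) }
      where
      z≢y : index z ≢ index y
      z≢y e = y≉z (sym (index-injective e))

  Vec-cardinality : ∀ {m} → HasCardinality A _≈_ m → ∀ d →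
    HasCardinality (Vec A d) (VecPointwise.Pointwise _≈_) (m ℕ.^ d)
  Vec-cardinality card zero =
    (λ _ → []) , (λ { {zero} {zero} _ → ≡.refl }) , (λ { [] → zero , λ _ → [] })
  Vec-cardinality card (suc d) =
    transfer-cardinality ×-isEq (VecPointwise.isEquivalence isEq (suc d))
      (×-cardinality isEq (VecPointwise.isEquivalence isEq d) card (Vec-cardinality card d))
      (λ (x , v) → x ∷ v) (λ (p , q) → p ∷ q) (λ { (p ∷ q) → p , q })
      (λ { (x ∷ v) → (x , v) , VecPointwise.refl refl })
    where
    module V = IsEquivalence (VecPointwise.isEquivalence isEq d)
    ×-isEq : IsEquivalence (λ (x : A × Vec A d) y →
               proj₁ x ≈ proj₁ y × VecPointwise.Pointwise _≈_ (proj₂ x) (proj₂ y))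
    ×-isEq = record
      { refl  = refl , V.refl
      ; sym   = λ (p , q) → sym p , V.sym q
      ; trans = λ (p , q) (p′ , q′) → trans p p′ , V.trans q q′
      }

-- Iterates, and identities in an arbitrary ring.

iterate-+ : ∀ {a} {A : Set a} (f : A → A) x m n →
            iterate f x (m ℕ.+ n) ≡ iterate f (iterate f x m) n
iterate-+ f x zero    n = ≡.refl
iterate-+ f x (suc m) n = iterate-+ f (f x) m n

module _ {c ℓ} (Q : Ring c ℓ) where
  open Ring Q
  open SetoidReasoning setoid
  open RingProperties Q using (-‿distribˡ-*)

  add-cancel : ∀ y z → y + (z - y) ≈ z
  add-cancel y z = begin
    y + (z - y) ≈⟨ +-congˡ (+-comm z (- y)) ⟩
    y + (- y + z) ≈⟨ +-assoc y (- y) z ⟨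
    (y - y) + z ≈⟨ +-congʳ (-‿inverseʳ y) ⟩
    0# + z ≈⟨ +-identityˡ z ⟩
    z ∎

  -- One Horner step of the division by P: the quotient becomes q x + a, where a is meant to cancel
  -- the top of c + r x. Commutation of P with x turns q P x into q x P.
  division-step : ∀ f P x q r c a → f ≈ q * P + r → P * x ≈ x * P →
                  c + f * x ≈ (q * x + a) * P + ((c + r * x) - a * P)
  division-step f P x q r c a e Px = begin
    c + f * x ≈⟨ +-congˡ (*-congʳ e) ⟩
    c + (q * P + r) * x ≈⟨ +-congˡ (distribʳ x (q * P) r) ⟩
    c + (q * P * x + r * x) ≈⟨ +-congˡ (+-congʳ (trans (*-assoc q P x) (trans (*-congˡ Px) (sym (*-assoc q x P))))) ⟩
    c + (q * x * P + r * x) ≈⟨ trans (sym (+-assoc _ _ _)) (trans (+-congʳ (+-comm _ _)) (+-assoc _ _ _)) ⟩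
    q * x * P + (c + r * x) ≈⟨ +-congˡ (add-cancel (a * P) _) ⟨
    q * x * P + (a * P + ((c + r * x) - a * P)) ≈⟨ +-assoc _ _ _ ⟨
    (q * x * P + a * P) + ((c + r * x) - a * P) ≈⟨ +-congʳ (distribʳ P _ _) ⟨
    (q * x + a) * P + ((c + r * x) - a * P) ∎

  commutes-cons : ∀ z f c x → z * f ≈ f * z → z * c ≈ c * z → z * x ≈ x * z →
                  z * (c + f * x) ≈ (c + f * x) * z
  commutes-cons z f c x zf zc zx = begin
    z * (c + f * x) ≈⟨ distribˡ z c _ ⟩
    z * c + z * (f * x) ≈⟨ +-cong zc (sym (*-assoc z f x)) ⟩
    c * z + z * f * x ≈⟨ +-congˡ (trans (*-congʳ zf) (trans (*-assoc f z x) (*-congˡ zx))) ⟩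
    c * z + f * (x * z) ≈⟨ +-congˡ (*-assoc f x z) ⟨
    c * z + f * x * z ≈⟨ distribʳ z c _ ⟨
    (c + f * x) * z ∎

-- The skew polynomial ring: product, degree, division with remainder.

module SkewRing {c ℓ} (R : CommutativeRing c ℓ) (σ : CommutativeRing.Carrier R → CommutativeRing.Carrier R)
  (σ-hom : RingMorphisms.IsRingHomomorphism (CommutativeRing.rawRing R) (CommutativeRing.rawRing R) σ)
  where
  open CommutativeRing R hiding (zero)
  open RingMorphisms.IsRingHomomorphism σ-hom public
    using () renaming (⟦⟧-cong to σ-cong; +-homo to σ-+; *-homo to σ-*; 0#-homo to σ-0; 1#-homo to σ-1)
  open SkewPolynomial rawRing σ public
  open SetoidReasoning setoid
  open RingProperties ring using (-0#≈0#)
  open CommutativeSemigroupProperties +-commutativeSemigroup using (interchange)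

  private
    V = ℕ → Carrier

  σ^ : ℕ → Carrier → Carrier
  σ^ i x = iterate σ x i

  σ^-cong : ∀ i {x y} → x ≈ y → σ^ i x ≈ σ^ i y
  σ^-cong zero    p = p
  σ^-cong (suc i) p = σ^-cong i (σ-cong p)

  σ^-0 : ∀ i → σ^ i 0# ≈ 0#
  σ^-0 zero    = refl
  σ^-0 (suc i) = trans (σ^-cong i σ-0) (σ^-0 i)

  σ^-1 : ∀ i → σ^ i 1# ≈ 1#
  σ^-1 zero    = refl
  σ^-1 (suc i) = trans (σ^-cong i σ-1) (σ^-1 i)

  coeff-+ : ∀ f g i → coeff (f +ₚ g) i ≈ coeff f i + coeff g i
  coeff-+ []      g       i       = sym (+-identityˡ _)
  coeff-+ (x ∷ f) []      i       = sym (+-identityʳ _)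
  coeff-+ (x ∷ f) (y ∷ g) zero    = refl
  coeff-+ (x ∷ f) (y ∷ g) (suc i) = coeff-+ f g i

  coeff-map : ∀ (h : Carrier → Carrier) → h 0# ≈ 0# → ∀ f i → coeff (map h f) i ≈ h (coeff f i)
  coeff-map h h0 []      i       = sym h0
  coeff-map h h0 (x ∷ f) zero    = refl
  coeff-map h h0 (x ∷ f) (suc i) = coeff-map h h0 f i

  coeff-scale : ∀ a f i → coeff (map (a *_) f) i ≈ a * coeff f i
  coeff-scale a = coeff-map (a *_) (zeroʳ a)

  coeff-neg : ∀ f i → coeff (map (-_) f) i ≈ - coeff f i
  coeff-neg = coeff-map (-_) -0#≈0#

  coeff-- : ∀ f g i → coeff (f +ₚ map (-_) g) i ≈ coeff f i - coeff g i
  coeff-- f g i = trans (coeff-+ f _ i) (+-congˡ (coeff-neg g i))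

  -- The product depends on its right factor only through the coefficients.
  conv : Poly → V → V
  conv []      g i       = 0#
  conv (x ∷ f) g zero    = x * g zero
  conv (x ∷ f) g (suc i) = x * g (suc i) + conv f (σ ∘ g) i

  conv-cong : ∀ f {g h : V} → (∀ i → g i ≈ h i) → ∀ i → conv f g i ≈ conv f h i
  conv-cong []      e i       = refl
  conv-cong (x ∷ f) e zero    = *-congˡ (e 0)
  conv-cong (x ∷ f) e (suc i) = +-cong (*-congˡ (e (suc i))) (conv-cong f (σ-cong ∘ e) i)

  coeff-* : ∀ f g i → coeff (f *ₚ g) i ≈ conv f (coeff g) i
  coeff-* []      g i       = refl
  coeff-* (x ∷ f) g zero    = begin
    coeff (map (x *_) g +ₚ (0# ∷ (f *ₚ map σ g))) 0 ≈⟨ coeff-+ (map (x *_) g) _ 0 ⟩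
    coeff (map (x *_) g) 0 + 0# ≈⟨ +-identityʳ _ ⟩
    coeff (map (x *_) g) 0 ≈⟨ coeff-scale x g 0 ⟩
    x * coeff g 0 ∎
  coeff-* (x ∷ f) g (suc i) = begin
    coeff (map (x *_) g +ₚ (0# ∷ (f *ₚ map σ g))) (suc i) ≈⟨ coeff-+ (map (x *_) g) _ (suc i) ⟩
    coeff (map (x *_) g) (suc i) + coeff (f *ₚ map σ g) i ≈⟨ +-cong (coeff-scale x g (suc i)) (coeff-* f (map σ g) i) ⟩
    x * coeff g (suc i) + conv f (coeff (map σ g)) i ≈⟨ +-congˡ (conv-cong f (coeff-map σ σ-0 g) i) ⟩
    x * coeff g (suc i) + conv f (σ ∘ coeff g) i ∎

  conv-+ʳ : ∀ f (g h : V) i → conv f (λ j → g j + h j) i ≈ conv f g i + conv f h i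
  conv-+ʳ []      g h i       = sym (+-identityˡ _)
  conv-+ʳ (x ∷ f) g h zero    = distribˡ x _ _
  conv-+ʳ (x ∷ f) g h (suc i) = begin
    x * (g (suc i) + h (suc i)) + conv f (λ j → σ (g j + h j)) i
      ≈⟨ +-cong (distribˡ x _ _) (trans (conv-cong f (λ j → σ-+ (g j) (h j)) i) (conv-+ʳ f (σ ∘ g) (σ ∘ h) i)) ⟩
    (x * g (suc i) + x * h (suc i)) + (conv f (σ ∘ g) i + conv f (σ ∘ h) i)
      ≈⟨ interchange _ _ _ _ ⟩
    (x * g (suc i) + conv f (σ ∘ g) i) + (x * h (suc i) + conv f (σ ∘ h) i) ∎

  conv-+ˡ : ∀ f f′ (g : V) i → conv (f +ₚ f′) g i ≈ conv f g i + conv f′ g i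
  conv-+ˡ []      f′       g i       = sym (+-identityˡ _)
  conv-+ˡ (x ∷ f) []       g i       = sym (+-identityʳ _)
  conv-+ˡ (x ∷ f) (y ∷ f′) g zero    = distribʳ _ x y
  conv-+ˡ (x ∷ f) (y ∷ f′) g (suc i) =
    trans (+-cong (distribʳ _ x y) (conv-+ˡ f f′ (σ ∘ g) i)) (interchange _ _ _ _)

  conv-scale : ∀ a f (g : V) i → conv (map (a *_) f) g i ≈ a * conv f g i
  conv-scale a []      g i       = sym (zeroʳ a)
  conv-scale a (x ∷ f) g zero    = *-assoc a x _
  conv-scale a (x ∷ f) g (suc i) =
    trans (+-cong (*-assoc a x _) (conv-scale a f (σ ∘ g) i)) (sym (distribˡ a _ _))

  -- Applying σ to all coefficients is conjugation by X, hence multiplicative; the inductive step of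
  -- associativity rests on this.
  conv-σ : ∀ f (g : V) i → conv (map σ f) (σ ∘ g) i ≈ σ (conv f g i)
  conv-σ []      g i       = sym σ-0
  conv-σ (x ∷ f) g zero    = sym (σ-* x _)
  conv-σ (x ∷ f) g (suc i) =
    trans (+-cong (sym (σ-* x _)) (conv-σ f (σ ∘ g) i)) (sym (σ-+ _ _))

  conv-assoc : ∀ f g (h : V) i → conv (f *ₚ g) h i ≈ conv f (conv g h) i
  conv-assoc []      g h i       = refl
  conv-assoc (x ∷ f) g h zero    = begin
    conv (map (x *_) g +ₚ (0# ∷ (f *ₚ map σ g))) h 0 ≈⟨ conv-+ˡ (map (x *_) g) _ h 0 ⟩
    conv (map (x *_) g) h 0 + 0# * h 0 ≈⟨ +-cong (conv-scale x g h 0) (zeroˡ _) ⟩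
    x * conv g h 0 + 0# ≈⟨ +-identityʳ _ ⟩
    x * conv g h 0 ∎
  conv-assoc (x ∷ f) g h (suc i) = begin
    conv (map (x *_) g +ₚ (0# ∷ (f *ₚ map σ g))) h (suc i)
      ≈⟨ conv-+ˡ (map (x *_) g) _ h (suc i) ⟩
    conv (map (x *_) g) h (suc i) + (0# * h (suc i) + conv (f *ₚ map σ g) (σ ∘ h) i)
      ≈⟨ +-cong (conv-scale x g h (suc i)) (trans (+-congʳ (zeroˡ _)) (+-identityˡ _)) ⟩
    x * conv g h (suc i) + conv (f *ₚ map σ g) (σ ∘ h) i
      ≈⟨ +-congˡ (trans (conv-assoc f (map σ g) (σ ∘ h) i) (conv-cong f (conv-σ g h) i)) ⟩
    x * conv g h (suc i) + conv f (σ ∘ conv g h) i ∎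

  -- Equal polynomials may be lists of different lengths, so the cases in which one list has run out
  -- must show that trailing zeros contribute nothing.
  conv-congˡ : ∀ f f′ → f ≈ₚ f′ → ∀ (g : V) i → conv f g i ≈ conv f′ g i
  conv-congˡ []      []       e g i       = refl
  conv-congˡ []      (y ∷ f′) e g zero    = sym (trans (*-congʳ (sym (e 0))) (zeroˡ _))
  conv-congˡ []      (y ∷ f′) e g (suc i) = sym (trans (+-cong (trans (*-congʳ (sym (e 0))) (zeroˡ _)) (sym (conv-congˡ [] f′ (e ∘ suc) (σ ∘ g) i))) (+-identityˡ _))
  conv-congˡ (x ∷ f) []       e g zero    = trans (*-congʳ (e 0)) (zeroˡ _)
  conv-congˡ (x ∷ f) []       e g (suc i) = trans (+-cong (trans (*-congʳ (e 0)) (zeroˡ _)) (conv-congˡ f [] (e ∘ suc) (σ ∘ g) i)) (+-identityˡ _)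
  conv-congˡ (x ∷ f) (y ∷ f′) e g zero    = *-congʳ (e 0)
  conv-congˡ (x ∷ f) (y ∷ f′) e g (suc i) = +-cong (*-congʳ (e 0)) (conv-congˡ f f′ (e ∘ suc) (σ ∘ g) i)

  conv-const : ∀ a (g : V) i → conv (const a) g i ≈ a * g i
  conv-const a g zero    = refl
  conv-const a g (suc i) = +-identityʳ _

  -- A constant that moves to the left past X^i becomes its image under σ^i.
  conv-δ : ∀ f (g : V) → (∀ i → g (suc i) ≈ 0#) → ∀ i → conv f g i ≈ coeff f i * σ^ i (g 0)
  conv-δ []      g g0 i       = sym (zeroˡ _)
  conv-δ (x ∷ f) g g0 zero    = refl
  conv-δ (x ∷ f) g g0 (suc i) = begin
    x * g (suc i) + conv f (σ ∘ g) i ≈⟨ +-cong (trans (*-congˡ (g0 i)) (zeroʳ x)) (conv-δ f (σ ∘ g) (λ j → trans (σ-cong (g0 j)) σ-0) i) ⟩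
    0# + coeff f i * σ^ i (σ (g 0)) ≈⟨ +-identityˡ _ ⟩
    coeff f i * σ^ i (σ (g 0)) ∎

  coeff-const* : ∀ a f i → coeff (const a *ₚ f) i ≈ a * coeff f i
  coeff-const* a f i = trans (coeff-* (const a) f i) (conv-const a (coeff f) i)

  coeff-*const : ∀ f a i → coeff (f *ₚ const a) i ≈ coeff f i * σ^ i a
  coeff-*const f a i = trans (coeff-* f (const a) i) (conv-δ f (coeff (const a)) (λ _ → refl) i)

  coeff-X*-zero : ∀ f → coeff (X *ₚ f) 0 ≈ 0#
  coeff-X*-zero f = trans (coeff-* X f 0) (zeroˡ _)

  coeff-X*-suc : ∀ f i → coeff (X *ₚ f) (suc i) ≈ σ (coeff f i)
  coeff-X*-suc f i = begin
    coeff (X *ₚ f) (suc i) ≈⟨ coeff-* X f (suc i) ⟩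
    0# * coeff f (suc i) + conv (const 1#) (σ ∘ coeff f) i ≈⟨ +-cong (zeroˡ _) (conv-const 1# _ i) ⟩
    0# + 1# * σ (coeff f i) ≈⟨ trans (+-identityˡ _) (*-identityˡ _) ⟩
    σ (coeff f i) ∎

  coeff-X : ∀ i → σ (coeff X i) ≈ coeff X i
  coeff-X zero          = σ-0
  coeff-X (suc zero)    = σ-1
  coeff-X (suc (suc i)) = σ-0

  coeff-*X-zero : ∀ f → coeff (f *ₚ X) 0 ≈ 0#
  coeff-*X-zero []      = refl
  coeff-*X-zero (x ∷ f) = trans (coeff-* (x ∷ f) X 0) (zeroʳ x)

  conv-X-suc : ∀ f i → conv f (coeff X) (suc i) ≈ coeff f i
  conv-X-suc []      i       = refl
  conv-X-suc (x ∷ f) zero    = begin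
    x * 1# + conv f (σ ∘ coeff X) 0 ≈⟨ +-cong (*-identityʳ x) (conv-cong f coeff-X 0) ⟩
    x + conv f (coeff X) 0 ≈⟨ +-congˡ (trans (sym (coeff-* f X 0)) (coeff-*X-zero f)) ⟩
    x + 0# ≈⟨ +-identityʳ x ⟩
    x ∎
  conv-X-suc (x ∷ f) (suc i) = begin
    x * 0# + conv f (σ ∘ coeff X) (suc i) ≈⟨ +-cong (zeroʳ x) (conv-cong f coeff-X (suc i)) ⟩
    0# + conv f (coeff X) (suc i) ≈⟨ trans (+-identityˡ _) (conv-X-suc f i) ⟩
    coeff f i ∎

  coeff-*X-suc : ∀ f i → coeff (f *ₚ X) (suc i) ≈ coeff f i
  coeff-*X-suc f i = trans (coeff-* f X (suc i)) (conv-X-suc f i)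

  cons-shift : ∀ x f → x ∷ f ≈ₚ const x +ₚ f *ₚ X
  cons-shift x f i = sym (trans (coeff-+ (const x) (f *ₚ X) i) (go i))
    where
    go : ∀ i → coeff (const x) i + coeff (f *ₚ X) i ≈ coeff (x ∷ f) i
    go zero    = trans (+-congˡ (coeff-*X-zero f)) (+-identityʳ x)
    go (suc i) = trans (+-identityˡ _) (coeff-*X-suc f i)

  ≈ₚ-isEquivalence : IsEquivalence _≈ₚ_
  ≈ₚ-isEquivalence = record
    { refl  = λ _ → refl
    ; sym   = λ e i → sym (e i)
    ; trans = λ e e′ i → trans (e i) (e′ i)
    }

  private
    *ₚ-identityˡ : ∀ f → const 1# *ₚ f ≈ₚ f
    *ₚ-identityˡ f i = trans (coeff-const* 1# f i) (*-identityˡ _)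

    *ₚ-identityʳ : ∀ f → f *ₚ const 1# ≈ₚ f
    *ₚ-identityʳ f i = trans (coeff-*const f 1# i) (trans (*-congˡ (σ^-1 i)) (*-identityʳ _))

    *ₚ-assoc : ∀ f g h → (f *ₚ g) *ₚ h ≈ₚ f *ₚ (g *ₚ h)
    *ₚ-assoc f g h i = begin
      coeff ((f *ₚ g) *ₚ h) i ≈⟨ coeff-* (f *ₚ g) h i ⟩
      conv (f *ₚ g) (coeff h) i ≈⟨ conv-assoc f g (coeff h) i ⟩
      conv f (conv g (coeff h)) i ≈⟨ conv-cong f (coeff-* g h) i ⟨
      conv f (coeff (g *ₚ h)) i ≈⟨ coeff-* f (g *ₚ h) i ⟨
      coeff (f *ₚ (g *ₚ h)) i ∎

    *ₚ-cong : ∀ {f f′ g g′} → f ≈ₚ f′ → g ≈ₚ g′ → f *ₚ g ≈ₚ f′ *ₚ g′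
    *ₚ-cong {f} {f′} {g} {g′} p q i = begin
      coeff (f *ₚ g) i ≈⟨ coeff-* f g i ⟩
      conv f (coeff g) i ≈⟨ conv-cong f q i ⟩
      conv f (coeff g′) i ≈⟨ conv-congˡ f f′ p (coeff g′) i ⟩
      conv f′ (coeff g′) i ≈⟨ coeff-* f′ g′ i ⟨
      coeff (f′ *ₚ g′) i ∎

    +ₚ-cong : ∀ {f f′ g g′} → f ≈ₚ f′ → g ≈ₚ g′ → f +ₚ g ≈ₚ f′ +ₚ g′
    +ₚ-cong {f} {f′} {g} {g′} p q i =
      trans (coeff-+ f g i) (trans (+-cong (p i) (q i)) (sym (coeff-+ f′ g′ i)))

    *ₚ-distribˡ : ∀ f g h → f *ₚ (g +ₚ h) ≈ₚ f *ₚ g +ₚ f *ₚ h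
    *ₚ-distribˡ f g h i = begin
      coeff (f *ₚ (g +ₚ h)) i ≈⟨ coeff-* f (g +ₚ h) i ⟩
      conv f (coeff (g +ₚ h)) i ≈⟨ conv-cong f (coeff-+ g h) i ⟩
      conv f (λ j → coeff g j + coeff h j) i ≈⟨ conv-+ʳ f (coeff g) (coeff h) i ⟩
      conv f (coeff g) i + conv f (coeff h) i ≈⟨ +-cong (coeff-* f g i) (coeff-* f h i) ⟨
      coeff (f *ₚ g) i + coeff (f *ₚ h) i ≈⟨ coeff-+ (f *ₚ g) (f *ₚ h) i ⟨
      coeff (f *ₚ g +ₚ f *ₚ h) i ∎

    *ₚ-distribʳ : ∀ f g h → (g +ₚ h) *ₚ f ≈ₚ g *ₚ f +ₚ h *ₚ f
    *ₚ-distribʳ f g h i = begin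
      coeff ((g +ₚ h) *ₚ f) i ≈⟨ coeff-* (g +ₚ h) f i ⟩
      conv (g +ₚ h) (coeff f) i ≈⟨ conv-+ˡ g h (coeff f) i ⟩
      conv g (coeff f) i + conv h (coeff f) i ≈⟨ +-cong (coeff-* g f i) (coeff-* h f i) ⟨
      coeff (g *ₚ f) i + coeff (h *ₚ f) i ≈⟨ coeff-+ (g *ₚ f) (h *ₚ f) i ⟨
      coeff (g *ₚ f +ₚ h *ₚ f) i ∎

    +ₚ-assoc : ∀ f g h → (f +ₚ g) +ₚ h ≈ₚ f +ₚ (g +ₚ h)
    +ₚ-assoc f g h i = begin
      coeff ((f +ₚ g) +ₚ h) i ≈⟨ trans (coeff-+ (f +ₚ g) h i) (+-congʳ (coeff-+ f g i)) ⟩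
      (coeff f i + coeff g i) + coeff h i ≈⟨ +-assoc _ _ _ ⟩
      coeff f i + (coeff g i + coeff h i) ≈⟨ trans (coeff-+ f (g +ₚ h) i) (+-congˡ (coeff-+ g h i)) ⟨
      coeff (f +ₚ (g +ₚ h)) i ∎

    +ₚ-comm : ∀ f g → f +ₚ g ≈ₚ g +ₚ f
    +ₚ-comm f g i = trans (coeff-+ f g i) (trans (+-comm _ _) (sym (coeff-+ g f i)))

    +ₚ-identityʳ : ∀ f → f +ₚ [] ≈ₚ f
    +ₚ-identityʳ f i = trans (coeff-+ f [] i) (+-identityʳ _)

    +ₚ-inverseˡ : ∀ f → map (-_) f +ₚ f ≈ₚ []
    +ₚ-inverseˡ f i = trans (coeff-+ (map (-_) f) f i) (trans (+-congʳ (coeff-neg f i)) (-‿inverseˡ _))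

    +ₚ-inverseʳ : ∀ f → f +ₚ map (-_) f ≈ₚ []
    +ₚ-inverseʳ f i = trans (coeff-- f f i) (-‿inverseʳ _)

    neg-cong : ∀ {f g} → f ≈ₚ g → map (-_) f ≈ₚ map (-_) g
    neg-cong {f} {g} e i = trans (coeff-neg f i) (trans (-‿cong (e i)) (sym (coeff-neg g i)))

  polyRing : Ring c ℓ
  polyRing = record
    { Carrier = Poly ; _≈_ = _≈ₚ_ ; _+_ = _+ₚ_ ; _*_ = _*ₚ_ ; -_ = map (-_) ; 0# = [] ; 1# = const 1#
    ; isRing = record
      { +-isAbelianGroup = record
        { isGroup = record
          { isMonoid = record
            { isSemigroup = record
              { isMagma = record { isEquivalence = ≈ₚ-isEquivalence ; ∙-cong = λ {f f′ g g′} → +ₚ-cong {f} {f′} {g} {g′} }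
              ; assoc = +ₚ-assoc }
            ; identity = (λ f i → refl) , +ₚ-identityʳ }
          ; inverse = +ₚ-inverseˡ , +ₚ-inverseʳ
          ; ⁻¹-cong = λ {f g} → neg-cong {f} {g} }
        ; comm = +ₚ-comm }
      ; *-cong = λ {f f′ g g′} → *ₚ-cong {f} {f′} {g} {g′}
      ; *-assoc = *ₚ-assoc
      ; *-identity = *ₚ-identityˡ , *ₚ-identityʳ
      ; distrib = *ₚ-distribˡ , *ₚ-distribʳ
      }
    }

  -- The constants and X generate the ring; f is built up by Horner's scheme.
  central : ∀ z → (∀ a → z *ₚ const a ≈ₚ const a *ₚ z) → z *ₚ X ≈ₚ X *ₚ z →
            ∀ f → z *ₚ f ≈ₚ f *ₚ z
  central z zc zX []      = Ring.zeroʳ polyRing z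
  central z zc zX (x ∷ f) = ≈ₚ.begin
    z *ₚ (x ∷ f) ≈ₚ.≈⟨ Ring.*-congˡ polyRing {z} {x ∷ f} {const x +ₚ f *ₚ X} (cons-shift x f) ⟩
    z *ₚ (const x +ₚ f *ₚ X) ≈ₚ.≈⟨ commutes-cons polyRing z f (const x) X (central z zc zX f) (zc x) zX ⟩
    (const x +ₚ f *ₚ X) *ₚ z ≈ₚ.≈⟨ Ring.*-congʳ polyRing {z} {const x +ₚ f *ₚ X} {x ∷ f} (λ i → sym (cons-shift x f i)) ⟩
    (x ∷ f) *ₚ z ≈ₚ.∎
    where module ≈ₚ = SetoidReasoning (Ring.setoid polyRing)

  -- A bound rather than a degree: zero satisfies every bound, and sums need no case distinction.
  Deg< : ℕ → Poly → Set ℓ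
  Deg< d f = ∀ i → d ≤ i → coeff f i ≈ 0#

  Monic : ℕ → Poly → Set ℓ
  Monic d f = coeff f d ≈ 1# × Deg< (suc d) f

  Deg<-length : ∀ f → Deg< (length f) f
  Deg<-length []      i       _       = refl
  Deg<-length (x ∷ f) (suc i) (s≤s p) = Deg<-length f i p

  conv-0ˡ : ∀ f (g : V) → Deg< 0 f → ∀ i → conv f g i ≈ 0#
  conv-0ˡ f g f0 i = conv-congˡ f [] (λ j → f0 j z≤n) g i

  conv-top : ∀ a b f (g : V) → Deg< (suc a) f → (∀ i → suc b ≤ i → g i ≈ 0#) →
             conv f g (a ℕ.+ b) ≈ coeff f a * σ^ a (g b)
  conv-top a b [] g _ _ = sym (zeroˡ _)
  conv-top zero zero (x ∷ f) g df dg = refl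
  conv-top zero (suc b) (x ∷ f) g df dg =
    trans (+-congˡ (conv-0ˡ f (σ ∘ g) (λ i _ → df (suc i) (s≤s z≤n)) b)) (+-identityʳ _)
  conv-top (suc a) b (x ∷ f) g df dg =
    trans (+-cong (trans (*-congˡ (dg (suc (a ℕ.+ b)) (s≤s (ℕₚ.m≤n+m b a)))) (zeroʳ x))
                  (conv-top a b f (σ ∘ g) (λ i p → df (suc i) (s≤s p)) (λ i p → trans (σ-cong (dg i p)) σ-0)))
          (+-identityˡ _)

  conv-above : ∀ a b f (g : V) → Deg< (suc a) f → (∀ i → suc b ≤ i → g i ≈ 0#) →
               ∀ i → suc (a ℕ.+ b) ≤ i → conv f g i ≈ 0#
  conv-above a b [] g _ _ i _ = refl
  conv-above zero b (x ∷ f) g df dg (suc i) p =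
    trans (+-cong (trans (*-congˡ (dg (suc i) p)) (zeroʳ x))
                  (conv-0ˡ f (σ ∘ g) (λ j _ → df (suc j) (s≤s z≤n)) i)) (+-identityˡ _)
  conv-above (suc a) b (x ∷ f) g df dg (suc i) (s≤s p) =
    trans (+-cong (trans (*-congˡ (dg (suc i) (ℕₚ.≤-trans (s≤s (ℕₚ.m≤n+m b (suc a))) (s≤s p)))) (zeroʳ x))
                  (conv-above a b f (σ ∘ g) (λ j q → df (suc j) (s≤s q)) (λ j q → trans (σ-cong (dg j q)) σ-0) i p))
          (+-identityˡ _)

  coeff-*-top : ∀ a b f g → Deg< (suc a) f → Deg< (suc b) g →
                coeff (f *ₚ g) (a ℕ.+ b) ≈ coeff f a * σ^ a (coeff g b)
  coeff-*-top a b f g df dg = trans (coeff-* f g _) (conv-top a b f (coeff g) df dg)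

  Deg<-* : ∀ a b f g → Deg< (suc a) f → Deg< (suc b) g → Deg< (suc (a ℕ.+ b)) (f *ₚ g)
  Deg<-* a b f g df dg i p = trans (coeff-* f g i) (conv-above a b f (coeff g) df dg i p)

  Monic-* : ∀ a b f g → Monic a f → Monic b g → Monic (a ℕ.+ b) (f *ₚ g)
  Monic-* a b f g (lf , df) (lg , dg) =
    (begin
      coeff (f *ₚ g) (a ℕ.+ b) ≈⟨ coeff-*-top a b f g df dg ⟩
      coeff f a * σ^ a (coeff g b) ≈⟨ *-cong lf (trans (σ^-cong a lg) (σ^-1 a)) ⟩
      1# * 1# ≈⟨ *-identityˡ 1# ⟩
      1# ∎) ,
    Deg<-* a b f g df dg

  Monic-1 : Monic 0 (const 1#)
  Monic-1 = refl , λ { (suc i) _ → refl }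

  Monic-X : Monic 1 X
  Monic-X = refl , λ { (suc (suc i)) _ → refl ; (suc zero) (s≤s ()) }

  Deg<-mono : ∀ {d e} f → d ≤ e → Deg< d f → Deg< e f
  Deg<-mono f d≤e df i e≤i = df i (ℕₚ.≤-trans d≤e e≤i)

  Deg<-cong : ∀ {d} f g → f ≈ₚ g → Deg< d f → Deg< d g
  Deg<-cong f g e df i p = trans (sym (e i)) (df i p)

  Deg<-+ : ∀ {d} f g → Deg< d f → Deg< d g → Deg< d (f +ₚ g)
  Deg<-+ f g df dg i p = trans (coeff-+ f g i) (trans (+-cong (df i p) (dg i p)) (+-identityˡ _))

  Deg<-neg : ∀ {d} f → Deg< d f → Deg< d (map (-_) f)
  Deg<-neg f df i p = trans (coeff-neg f i) (trans (-‿cong (df i p)) -0#≈0#)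

  Deg<-const* : ∀ {d} a f → Deg< d f → Deg< d (const a *ₚ f)
  Deg<-const* a f df i p = trans (coeff-const* a f i) (trans (*-congˡ (df i p)) (zeroʳ a))

  Deg<-step : ∀ {d} f → Deg< (suc d) f → coeff f d ≈ 0# → Deg< d f
  Deg<-step {d} f df e i p with d ℕₚ.≟ i
  ... | yes ≡.refl = e
  ... | no  d≢i    = df i (ℕₚ.≤∧≢⇒< p d≢i)

  module _ {m} (P : Poly) (monic : Monic m P) where

    -- As P is monic, the top coefficient of q is also that of q P. The bound on q starts at the
    -- length of the list and is lowered one coefficient at a time. For e = 0 this says that a
    -- multiple of P of degree below m is zero.
    quotient-Deg< : ∀ e q → Deg< (e ℕ.+ m) (q *ₚ P) → Deg< e q
    quotient-Deg< e q dqP = go (length q) (Deg<-mono q (ℕₚ.m≤n+m _ e) (Deg<-length q))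
      where
      go : ∀ j → Deg< (e ℕ.+ j) q → Deg< e q
      go zero    d = ≡.subst (λ t → Deg< t q) (ℕₚ.+-identityʳ e) d
      go (suc j) d = go j (Deg<-step q d′ (begin
        coeff q (e ℕ.+ j) ≈⟨ *-identityʳ _ ⟨
        coeff q (e ℕ.+ j) * 1# ≈⟨ *-congˡ (trans (σ^-cong (e ℕ.+ j) (proj₁ monic)) (σ^-1 (e ℕ.+ j))) ⟨
        coeff q (e ℕ.+ j) * σ^ (e ℕ.+ j) (coeff P m) ≈⟨ coeff-*-top (e ℕ.+ j) m q P d′ (proj₂ monic) ⟨
        coeff (q *ₚ P) (e ℕ.+ j ℕ.+ m) ≈⟨ dqP _ (ℕₚ.+-monoˡ-≤ m (ℕₚ.m≤m+n e j)) ⟩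
        0# ∎))
        where d′ = ≡.subst (λ t → Deg< t q) (ℕₚ.+-suc e j) d

    -- Recursion along Horner's scheme: the remainder times X plus a constant has degree at most m,
    -- and subtracting a constant multiple of the monic P restores the bound.
    divMod : P *ₚ X ≈ₚ X *ₚ P → ∀ f → ∃ λ q → ∃ λ r → Deg< m r × f ≈ₚ q *ₚ P +ₚ r
    divMod PX []      = [] , [] , (λ _ _ → refl) , (λ _ → refl)
    divMod PX (x ∷ f) with divMod PX f
    ... | q , r , dr , e =
      q *ₚ X +ₚ const a , r′ , dr′ ,
      λ i → trans (cons-shift x f i) (division-step polyRing f P X q r (const x) (const a) e PX i)
      where
      r₁ = const x +ₚ r *ₚ X
      a = coeff r₁ m
      dr₁ : Deg< (suc m) r₁
      dr₁ = Deg<-cong (x ∷ r) r₁ (cons-shift x r) (λ { (suc i) (s≤s p) → dr i p })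
      r′ = r₁ +ₚ map (-_) (const a *ₚ P)
      dr′ : Deg< m r′
      dr′ = Deg<-step r′ (Deg<-+ r₁ _ dr₁ (Deg<-neg (const a *ₚ P) (Deg<-const* a P (proj₂ monic)))) (begin
        coeff r′ m ≈⟨ coeff-- r₁ (const a *ₚ P) m ⟩
        a - coeff (const a *ₚ P) m ≈⟨ +-congˡ (-‿cong (trans (coeff-const* a P m) (trans (*-congˡ (proj₁ monic)) (*-identityʳ a)))) ⟩
        a - a ≈⟨ -‿inverseʳ a ⟩
        0# ∎)

-- Finite fields: Fermat's identity, evaluation, counting roots.

module FieldProperties {c ℓ m} (K : FiniteField c ℓ m) where
  open FiniteField K hiding (zero)
  open RingProperties ring public using (-0#≈0#)
  open CommutativeSemigroupProperties +-commutativeSemigroup using (interchange)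
  open import Algebra.Properties.Semiring.Exp semiring public
  open import Algebra.Properties.CommutativeSemiring.Exp commutativeSemiring public using (^-distrib-*)
  open import Algebra.Properties.AbelianGroup +-abelianGroup public
    using () renaming (x∙y⁻¹≈ε⇒x≈y to x-y≈0⇒x≈y; x≈y⇒x∙y⁻¹≈ε to x≈y⇒x-y≈0)
  open Finite isEquivalence cardinality public
  private module ≈ = SetoidReasoning setoid

  -- with 0⁻¹ = 0
  infix 8 _⁻¹
  _⁻¹ : Carrier → Carrier
  x ⁻¹ with x ≟ 0#
  ... | yes _  = 0#
  ... | no x≉0 = proj₁ (inverse x x≉0)

  ⁻¹-inverseˡ : ∀ {x} → ¬ (x ≈ 0#) → x ⁻¹ * x ≈ 1#
  ⁻¹-inverseˡ {x} x≉0 with x ≟ 0#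
  ... | yes x≈0 = ⊥-elim (x≉0 x≈0)
  ... | no  x≉0 = proj₁ (proj₂ (inverse x x≉0))

  ⁻¹-inverseʳ : ∀ {x} → ¬ (x ≈ 0#) → x * x ⁻¹ ≈ 1#
  ⁻¹-inverseʳ x≉0 = trans (*-comm _ _) (⁻¹-inverseˡ x≉0)

  *-cancelˡ : ∀ a {x y} → ¬ (a ≈ 0#) → a * x ≈ a * y → x ≈ y
  *-cancelˡ a {x} {y} a≉0 e = ≈.begin
    x ≈.≈⟨ *-identityˡ x ⟨
    1# * x ≈.≈⟨ *-congʳ (⁻¹-inverseˡ a≉0) ⟨
    a ⁻¹ * a * x ≈.≈⟨ *-assoc _ _ _ ⟩
    a ⁻¹ * (a * x) ≈.≈⟨ *-congˡ e ⟩
    a ⁻¹ * (a * y) ≈.≈⟨ *-assoc _ _ _ ⟨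
    a ⁻¹ * a * y ≈.≈⟨ *-congʳ (⁻¹-inverseˡ a≉0) ⟩
    1# * y ≈.≈⟨ *-identityˡ y ⟩
    y ≈.∎

  *-≉0 : ∀ {x y} → ¬ (x ≈ 0#) → ¬ (y ≈ 0#) → ¬ (x * y ≈ 0#)
  *-≉0 {x} x≉0 y≉0 e = y≉0 (*-cancelˡ x x≉0 (trans e (sym (zeroʳ x))))

  ⁻¹-≉0 : ∀ {x} → ¬ (x ≈ 0#) → ¬ (x ⁻¹ ≈ 0#)
  ⁻¹-≉0 x≉0 e = 0≉1 (trans (sym (trans (*-congʳ e) (zeroˡ _))) (⁻¹-inverseˡ x≉0))

  1≉0 : ¬ (1# ≈ 0#)
  1≉0 e = 0≉1 (sym e)

  0^ : ∀ {i} → 1 ≤ i → 0# ^ i ≈ 0#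
  0^ {suc i} _ = zeroˡ _

  module ∏ = MonoidSum *-commutativeMonoid

  private
    ∏-≉0 : ∀ d (g : Fin d → Carrier) → (∀ i → ¬ (g i ≈ 0#)) → ¬ (∏.sum g ≈ 0#)
    ∏-≉0 zero    g _   = 1≉0
    ∏-≉0 (suc d) g g≉0 = *-≉0 (g≉0 zero) (∏-≉0 d (g ∘ suc) (g≉0 ∘ suc))

    ∏-single : ∀ d (g : Fin d → Carrier) i → (∀ j → j ≢ i → g j ≈ 1#) → ∏.sum g ≈ g i
    ∏-single (suc d) g i e = trans (∏.sum-remove {i = i} g)
      (trans (*-congˡ (trans (∏.sum-cong-≋ (λ j → e (punchIn i j) (Finₚ.punchInᵢ≢i i j))) (∏.sum-replicate-zero d)))
        (*-identityʳ _))

    -- With 0 replaced by 1, the product of the nonzero elements runs over the whole enumeration, on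
    -- which multiplication by a is a permutation.
    nonzeroOr1 : Carrier → Carrier
    nonzeroOr1 x with x ≟ 0#
    ... | yes _ = 1#
    ... | no  _ = x

    nonzeroOr1-≉0 : ∀ x → ¬ (nonzeroOr1 x ≈ 0#)
    nonzeroOr1-≉0 x with x ≟ 0#
    ... | yes _   = 1≉0
    ... | no  x≉0 = x≉0

    _at0_ : Carrier → Carrier → Carrier
    a at0 x with x ≟ 0#
    ... | yes _ = a
    ... | no  _ = 1#

    -- Multiplication by a is compatible with replacing 0 by 1 except at x = 0, where the replaced
    -- value stays 1. The factor `a at0 x` repairs this and contributes a single a to the whole
    -- product.
    at0-step : ∀ {a x y} → ¬ (a ≈ 0#) → y ≈ a * x → a * nonzeroOr1 x ≈ (a at0 x) * nonzeroOr1 y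
    at0-step {a} {x} {y} a≉0 e with x ≟ 0# | y ≟ 0#
    ... | yes _   | yes _   = refl
    ... | yes x≈0 | no  y≉0 = ⊥-elim (y≉0 (trans e (trans (*-congˡ x≈0) (zeroʳ a))))
    ... | no  x≉0 | yes y≈0 = ⊥-elim (*-≉0 a≉0 x≉0 (trans (sym e) y≈0))
    ... | no  _   | no  _   = trans (sym e) (sym (*-identityˡ y))

    at0-0 : ∀ a x → x ≈ 0# → a at0 x ≈ a
    at0-0 a x x≈0 with x ≟ 0#
    ... | yes _   = refl
    ... | no  x≉0 = ⊥-elim (x≉0 x≈0)

    at0-≉0 : ∀ a x → ¬ (x ≈ 0#) → a at0 x ≈ 1#
    at0-≉0 a x x≉0 with x ≟ 0#
    ... | yes x≈0 = ⊥-elim (x≉0 x≈0)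
    ... | no  _   = refl

  -- Multiplication by a ≠ 0 permutes the field, so the product of the nonzero
  -- elements is multiplied by a^m / a = 1.
  fermat : ∀ a → a ^ m ≈ a
  fermat a with a ≟ 0#
  ... | yes a≈0 = trans (^-congˡ m a≈0) (trans (0^ (0<m (index a))) (sym a≈0))
    where
    0<m : ∀ {m} → Fin m → 0 < m
    0<m {suc m} _ = s≤s z≤n
  ... | no  a≉0 = *-cancelˡ (∏.sum g) (∏-≉0 m g (λ i → nonzeroOr1-≉0 (enum i))) (≈.begin
    ∏.sum g * a ^ m ≈.≈⟨ *-comm _ _ ⟩
    a ^ m * ∏.sum g ≈.≈⟨ *-congʳ (∏.sum-replicate m) ⟨
    ∏.sum {m} (λ _ → a) * ∏.sum g ≈.≈⟨ ∏.∑-distrib-+ {m} (λ _ → a) g ⟨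
    ∏.sum (λ i → a * g i) ≈.≈⟨ ∏.sum-cong-≋ {m} {λ i → a * g i} {λ i → (a at0 enum i) * g (index (a * enum i))} (λ i → at0-step a≉0 (enum-index (a * enum i))) ⟩
    ∏.sum (λ i → (a at0 enum i) * g (index (a * enum i))) ≈.≈⟨ ∏.∑-distrib-+ (λ i → a at0 enum i) (λ i → g (index (a * enum i))) ⟩
    ∏.sum (λ i → a at0 enum i) * ∏.sum (λ i → g (index (a * enum i)))
      ≈.≈⟨ *-cong single (sym (∏.sum-permute g π)) ⟩
    a * ∏.sum g ≈.≈⟨ *-comm _ _ ⟩
    ∏.sum g * a ≈.∎)
    where
    g : Fin m → Carrier
    g i = nonzeroOr1 (enum i)
    single : ∏.sum (λ i → a at0 enum i) ≈ a
    single = trans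
      (∏-single m (λ i → a at0 enum i) (index 0#) (λ j j≢0 → at0-≉0 a (enum j)
        (λ e → j≢0 (≡.trans (≡.sym (index-enum j)) (index-cong e)))))
      (at0-0 a _ (enum-index 0#))
    mult-inv : ∀ {b c} → b * c ≈ 1# → ∀ i → index (b * enum (index (c * enum i))) ≡ i
    mult-inv {b} {c} e i = ≡.trans (index-cong (≈.begin
      b * enum (index (c * enum i)) ≈.≈⟨ *-congˡ (enum-index _) ⟩
      b * (c * enum i) ≈.≈⟨ *-assoc _ _ _ ⟨
      b * c * enum i ≈.≈⟨ *-congʳ e ⟩
      1# * enum i ≈.≈⟨ *-identityˡ _ ⟩
      enum i ≈.∎)) (index-enum i)
    π : Perm.Permutation m m
    π = Perm.permutation (λ i → index (a * enum i)) (λ i → index (a ⁻¹ * enum i))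
      (mult-inv (⁻¹-inverseʳ a≉0)) (mult-inv (⁻¹-inverseˡ a≉0))

  id-hom : RingMorphisms.IsRingHomomorphism rawRing rawRing id
  id-hom = record
    { isSemiringHomomorphism = record
      { isNearSemiringHomomorphism = record
        { +-isMonoidHomomorphism = record
          { isMagmaHomomorphism = record
            { isRelHomomorphism = record { cong = id } ; homo = λ _ _ → refl }
          ; ε-homo = refl }
        ; *-homo = λ _ _ → refl }
      ; 1#-homo = refl }
    ; -‿homo = λ _ → refl }

  -- Ordinary polynomials are the skew ones for σ = id, so ring structure, degrees and division are
  -- inherited.
  module P where
    open SkewRing commutativeRing id id-hom public
    open Ring polyRing public using () renaming (trans to ≈ₚ-trans)
  open P

  *ₚ-comm : ∀ f g → f *ₚ g ≈ₚ g *ₚ f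
  *ₚ-comm f = central f (f-const {f}) (λ i → sym (X-central f i))
    where
    id^ : ∀ i x → iterate id x i ≡ x
    id^ zero    x = ≡.refl
    id^ (suc i) x = id^ i x
    f-const : ∀ {f} a → f *ₚ const a ≈ₚ const a *ₚ f
    f-const {f} a i = trans (coeff-*const f a i)
      (trans (*-congˡ (reflexive (id^ i a))) (trans (*-comm _ _) (sym (coeff-const* a f i))))
    X-central : ∀ f → X *ₚ f ≈ₚ f *ₚ X
    X-central = central X (f-const {X}) (λ _ → refl)

  eval : Poly → Carrier → Carrier
  eval []      x = 0#
  eval (a ∷ f) x = a + x * eval f x

  eval-0 : ∀ f x → f ≈ₚ [] → eval f x ≈ 0#
  eval-0 []      x e = refl
  eval-0 (a ∷ f) x e = trans (+-cong (e 0) (trans (*-congˡ (eval-0 f x (e ∘ suc))) (zeroʳ x))) (+-identityˡ _)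

  eval-cong : ∀ f g x → f ≈ₚ g → eval f x ≈ eval g x
  eval-cong []      g       x e = sym (eval-0 g x (λ i → sym (e i)))
  eval-cong (a ∷ f) []      x e = eval-0 (a ∷ f) x e
  eval-cong (a ∷ f) (b ∷ g) x e = +-cong (e 0) (*-congˡ (eval-cong f g x (e ∘ suc)))

  eval-congʳ : ∀ f {x y} → x ≈ y → eval f x ≈ eval f y
  eval-congʳ []      e = refl
  eval-congʳ (a ∷ f) e = +-congˡ (*-cong e (eval-congʳ f e))

  eval-+ : ∀ f g x → eval (f +ₚ g) x ≈ eval f x + eval g x
  eval-+ []      g       x = sym (+-identityˡ _)
  eval-+ (a ∷ f) []      x = sym (+-identityʳ _)
  eval-+ (a ∷ f) (b ∷ g) x = trans (+-congˡ (trans (*-congˡ (eval-+ f g x)) (distribˡ x _ _)))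
                                   (interchange a b _ _)

  eval-scale : ∀ a f x → eval (map (a *_) f) x ≈ a * eval f x
  eval-scale a []      x = sym (zeroʳ a)
  eval-scale a (b ∷ f) x = trans (+-congˡ (trans (*-congˡ (eval-scale a f x))
    (trans (sym (*-assoc x a _)) (trans (*-congʳ (*-comm x a)) (*-assoc a x _))))) (sym (distribˡ a _ _))

  eval-* : ∀ f g x → eval (f *ₚ g) x ≈ eval f x * eval g x
  eval-* []      g x = sym (zeroˡ _)
  eval-* (a ∷ f) g x = ≈.begin
    eval (map (a *_) g +ₚ (0# ∷ (f *ₚ map id g))) x ≈.≈⟨ eval-+ (map (a *_) g) _ x ⟩
    eval (map (a *_) g) x + (0# + x * eval (f *ₚ map id g) x)
      ≈.≈⟨ +-cong (eval-scale a g x) (trans (+-identityˡ _) (*-congˡ (trans (reflexive (≡.cong (λ h → eval (f *ₚ h) x) (Listₚ.map-id g))) (eval-* f g x)))) ⟩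
    a * eval g x + x * (eval f x * eval g x) ≈.≈⟨ +-congˡ (*-assoc x _ _) ⟨
    a * eval g x + x * eval f x * eval g x ≈.≈⟨ distribʳ _ _ _ ⟨
    (a + x * eval f x) * eval g x ≈.∎

  eval-const : ∀ a x → eval (const a) x ≈ a
  eval-const a x = trans (+-congˡ (zeroʳ x)) (+-identityʳ a)

  eval-X : ∀ x → eval X x ≈ x
  eval-X x = trans (+-identityˡ _) (trans (*-congˡ (eval-const 1# x)) (*-identityʳ x))

  eval-neg : ∀ f x → eval (map (-_) f) x ≈ - eval f x
  eval-neg f x = -‿unique (trans (sym (eval-+ (map (-_) f) f x))
    (eval-0 (map (-_) f +ₚ f) x (Ring.-‿inverseˡ polyRing f)))
    where
    open import Algebra.Properties.Group +-group using () renaming (inverseˡ-unique to inv)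
    -‿unique : ∀ {u v} → u + v ≈ 0# → u ≈ - v
    -‿unique = inv _ _

  infixr 8 _^ₚ_
  _^ₚ_ : Poly → ℕ → Poly
  f ^ₚ zero  = const 1#
  f ^ₚ suc d = f *ₚ f ^ₚ d

  eval-^ : ∀ f d x → eval (f ^ₚ d) x ≈ eval f x ^ d
  eval-^ f zero    x = eval-const 1# x
  eval-^ f (suc d) x = trans (eval-* f (f ^ₚ d) x) (*-congˡ (eval-^ f d x))

  Monic-^ : ∀ f → Monic 1 f → ∀ d → Monic d (f ^ₚ d)
  Monic-^ f mf zero    = Monic-1
  Monic-^ f mf (suc d) = Monic-* 1 d f (f ^ₚ d) mf (Monic-^ f mf d)

  Monic-+ : ∀ {d} f g → Monic d f → Deg< d g → Monic d (f +ₚ g)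
  Monic-+ {d} f g (lf , df) dg =
    trans (coeff-+ f g d) (trans (+-cong lf (dg d ℕₚ.≤-refl)) (+-identityʳ _)) ,
    Deg<-+ f g df (Deg<-mono g (ℕₚ.n≤1+n d) dg)

  Monic-≉0 : ∀ {d} f → Monic d f → ¬ (f ≈ₚ [])
  Monic-≉0 {d} f (lf , _) e = 1≉0 (trans (sym lf) (e d))

  private
    X-_ : Carrier → Poly
    X- a = (- a) ∷ 1# ∷ []

    X-monic : ∀ a → Monic 1 (X- a)
    X-monic a = refl , λ { (suc (suc _)) _ → refl ; (suc zero) (s≤s ()) }

  -- X - x₀ divides f. At the other listed points x - x₀ is nonzero, so the quotient vanishes there,
  -- and its degree bound is one less.
  root-bound : ∀ d f (xs : Fin d → Carrier) → (∀ {i j} → xs i ≈ xs j → i ≡ j) →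
               Deg< d f → (∀ i → eval f (xs i) ≈ 0#) → f ≈ₚ []
  root-bound zero    f xs inj df roots = λ i → df i z≤n
  root-bound (suc d) f xs inj df roots with divMod (X- xs zero) (X-monic (xs zero)) (*ₚ-comm (X- xs zero) X) f
  ... | q , r , dr , e = λ i → trans (e′ i) (Ring.*-congʳ polyRing {L} {q} {[]} q≈0 i)
    where
    x₀ = xs zero
    L = X- x₀
    L-monic = X-monic x₀
    eval-L : ∀ x → eval L x ≈ x - x₀
    eval-L x = trans (+-congˡ (trans (*-congˡ (eval-const 1# x)) (*-identityʳ x))) (+-comm _ _)
    eval-f : ∀ x → eval f x ≈ eval q x * (x - x₀) + eval r x
    eval-f x = trans (eval-cong f (q *ₚ L +ₚ r) x e) (trans (eval-+ (q *ₚ L) r x)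
      (+-congʳ (trans (eval-* q L x) (*-congˡ (eval-L x)))))
    r-const : ∀ x → eval r x ≈ coeff r 0
    r-const x = trans (eval-cong r (const (coeff r 0)) x λ { zero → refl ; (suc i) → dr (suc i) (s≤s z≤n) })
                      (eval-const _ x)
    r₀ : coeff r 0 ≈ 0#
    r₀ = ≈.begin
      coeff r 0 ≈.≈⟨ r-const x₀ ⟨
      eval r x₀ ≈.≈⟨ +-identityˡ _ ⟨
      0# + eval r x₀ ≈.≈⟨ +-congʳ (trans (*-congˡ (-‿inverseʳ x₀)) (zeroʳ _)) ⟨
      eval q x₀ * (x₀ - x₀) + eval r x₀ ≈.≈⟨ eval-f x₀ ⟨
      eval f x₀ ≈.≈⟨ roots zero ⟩
      0# ≈.∎
    r≈0 : r ≈ₚ []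
    r≈0 zero    = r₀
    r≈0 (suc i) = dr (suc i) (s≤s z≤n)
    e′ : f ≈ₚ q *ₚ L
    e′ = ≈ₚ-trans {f} {q *ₚ L +ₚ r} {q *ₚ L} e
      (λ i → trans (coeff-+ (q *ₚ L) r i) (trans (+-congˡ (r≈0 i)) (+-identityʳ _)))
    dq : Deg< d q
    dq = quotient-Deg< L L-monic d q
      (≡.subst (λ t → Deg< t (q *ₚ L)) (ℕₚ.+-comm 1 d) (Deg<-cong f (q *ₚ L) e′ df))
    q≈0 : q ≈ₚ []
    q≈0 = root-bound d q (xs ∘ suc) (Finₚ.suc-injective ∘ inj) dq q-roots
      where
      q-roots : ∀ i → eval q (xs (suc i)) ≈ 0#
      q-roots i = *-cancelˡ (y - x₀) y≉x₀ (≈.begin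
        (y - x₀) * eval q y ≈.≈⟨ *-comm _ _ ⟩
        eval q y * (y - x₀) ≈.≈⟨ +-identityʳ _ ⟨
        eval q y * (y - x₀) + 0# ≈.≈⟨ +-congˡ (trans (r-const y) r₀) ⟨
        eval q y * (y - x₀) + eval r y ≈.≈⟨ eval-f y ⟨
        eval f y ≈.≈⟨ roots (suc i) ⟩
        0# ≈.≈⟨ zeroʳ _ ⟨
        (y - x₀) * 0# ≈.∎)
        where
        y = xs (suc i)
        y≉x₀ : ¬ (y - x₀ ≈ 0#)
        y≉x₀ e with () ← inj (x-y≈0⇒x≈y _ _ e)

  -- Otherwise x would be one root too many for the degree.
  root-among : ∀ d f (xs : Fin d → Carrier) → (∀ {i j} → xs i ≈ xs j → i ≡ j) →
               Deg< (suc d) f → ¬ (f ≈ₚ []) → (∀ i → eval f (xs i) ≈ 0#) →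
               ∀ x → eval f x ≈ 0# → ∃ λ i → xs i ≈ x
  root-among d f xs inj df f≉0 roots x root with Finₚ.any? (λ i → xs i ≟ x)
  ... | yes p = p
  ... | no ¬p = ⊥-elim (f≉0 (root-bound (suc d) f ys ys-inj df ys-roots))
    where
    ys : Fin (suc d) → Carrier
    ys zero    = x
    ys (suc i) = xs i
    ys-inj : ∀ {i j} → ys i ≈ ys j → i ≡ j
    ys-inj {zero}  {zero}  e = ≡.refl
    ys-inj {zero}  {suc j} e = ⊥-elim (¬p (j , sym e))
    ys-inj {suc i} {zero}  e = ⊥-elim (¬p (i , e))
    ys-inj {suc i} {suc j} e = ≡.cong suc (inj e)
    ys-roots : ∀ i → eval f (ys i) ≈ 0#
    ys-roots zero    = root
    ys-roots (suc i) = roots i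

-- The Galois group of K over 𝔽_q: the order and the fixed field of σ.

module Galois {c₁ ℓ₁ c₂ ℓ₂} {q n : ℕ} (2≤q : 2 ≤ q) .{{nz : NonZero n}}
  (k : FiniteField c₁ ℓ₁ q) (K : FiniteField c₂ ℓ₂ (q ℕ.^ n))
  (ι : FiniteField.Carrier k → FiniteField.Carrier K) (ι-hom : IsExtension k K ι)
  (σ : FiniteField.Carrier K → FiniteField.Carrier K) (gen : GeneratesGaloisGroup k K ι σ)
  where
  private
    module k where
      open FiniteField k public
      open FieldProperties k public
    module K where
      open FiniteField K hiding (zero) public
      open FieldProperties K public
    open K using (_≈_; _+_; _*_; -_; 0#; 1#; _^_; eval; refl; sym; trans; reflexive)
    open SetoidReasoning K.setoid
    open K.P using (Poly; coeff; const; X; _≈ₚ_; _+ₚ_; _*ₚ_; Deg<; Monic; coeff-+; coeff--;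
      Deg<-mono; Deg<-step; Deg<-+; Deg<-neg; Deg<-cong; Monic-X; Monic-1; Monic-*)
    module ι = RingMorphisms.IsRingHomomorphism ι-hom

  ι-injective : ∀ {a b} → ι a ≈ ι b → a k.≈ b
  ι-injective {a} {b} e with a k.≟ b
  ... | yes p = p
  ... | no a≉b = ⊥-elim (K.0≉1 (begin
    0# ≈⟨ K.zeroʳ _ ⟨
    ι (d k.⁻¹) * 0# ≈⟨ K.*-congˡ ιd≈0 ⟨
    ι (d k.⁻¹) * ι d ≈⟨ ι.*-homo _ _ ⟨
    ι (d k.⁻¹ k.* d) ≈⟨ ι.⟦⟧-cong (k.⁻¹-inverseˡ (λ d≈0 → a≉b (k.x-y≈0⇒x≈y _ _ d≈0))) ⟩
    ι k.1# ≈⟨ ι.1#-homo ⟩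
    1# ∎))
    where
    d = a k.- b
    ιd≈0 : ι d ≈ 0#
    ιd≈0 = trans (ι.+-homo _ _) (trans (K.+-congˡ (ι.-‿homo b)) (K.x≈y⇒x-y≈0 e))

  ι-^ : ∀ a i → ι (a k.^ i) ≈ ι a ^ i
  ι-^ a zero    = ι.1#-homo
  ι-^ a (suc i) = trans (ι.*-homo _ _) (K.*-congˡ (ι-^ a i))

  ι-fermat : ∀ a → ι a ^ q ≈ ι a
  ι-fermat a = trans (sym (ι-^ a q)) (ι.⟦⟧-cong (k.fermat a))

  private
    1≤q : 1 ≤ q
    1≤q = ℕₚ.≤-trans (s≤s z≤n) 2≤q

    0<qⁿ : 0 < q ℕ.^ n
    0<qⁿ = ℕₚ.m^n>0 q {{ℕ.>-nonZero 1≤q}} n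

    X+1 : Poly
    X+1 = X +ₚ const 1#

    X+1-monic : Monic 1 X+1
    X+1-monic = K.Monic-+ X (const 1#) Monic-X (λ { (suc i) _ → refl })

    -- The difference of (X + 1)^q and X^q + 1. Additivity of the Frobenius comes from counting its
    -- roots instead of from binomial coefficients in characteristic p.
    freshman : Poly
    freshman = X+1 K.^ₚ q +ₚ map (-_) (X K.^ₚ q +ₚ const 1#)

    eval-freshman : ∀ x → eval freshman x ≈ (x + 1#) ^ q K.- (x ^ q + 1#)
    eval-freshman x = trans (K.eval-+ (X+1 K.^ₚ q) _ x) (K.+-cong
      (trans (K.eval-^ X+1 q x) (K.^-congˡ q
        (trans (K.eval-+ X (const 1#) x) (K.+-cong (K.eval-X x) (K.eval-const 1# x)))))
      (trans (K.eval-neg (X K.^ₚ q +ₚ const 1#) x) (K.-‿cong (trans (K.eval-+ (X K.^ₚ q) (const 1#) x)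
        (K.+-cong (trans (K.eval-^ X q x) (K.^-congˡ q (K.eval-X x))) (K.eval-const 1# x))))))

    freshman-Deg< : Deg< q freshman
    freshman-Deg< = Deg<-step freshman
      (Deg<-+ (X+1 K.^ₚ q) _ (proj₂ m₁) (Deg<-neg (X K.^ₚ q +ₚ const 1#) (proj₂ m₂)))
      (trans (coeff-- (X+1 K.^ₚ q) (X K.^ₚ q +ₚ const 1#) q)
        (K.x≈y⇒x-y≈0 (trans (proj₁ m₁) (sym (proj₁ m₂)))))
      where
      m₁ = K.Monic-^ X+1 X+1-monic q
      m₂ = K.Monic-+ (X K.^ₚ q) (const 1#) (K.Monic-^ X Monic-X q)
             (Deg<-mono (const 1#) 1≤q (λ { (suc i) _ → refl }))

    -- (X + 1)^q − X^q − 1 has degree < q and vanishes on 𝔽_q.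
    freshman≈0 : freshman ≈ₚ []
    freshman≈0 = K.root-bound q freshman (ι ∘ k.enum) (k.enum-injective ∘ ι-injective) freshman-Deg<
      (λ i → trans (eval-freshman _) (K.x≈y⇒x-y≈0 (begin
        (ι (k.enum i) + 1#) ^ q ≈⟨ K.^-congˡ q (ι-suc (k.enum i)) ⟨
        ι (k.enum i k.+ k.1#) ^ q ≈⟨ ι-fermat _ ⟩
        ι (k.enum i k.+ k.1#) ≈⟨ ι-suc (k.enum i) ⟩
        ι (k.enum i) + 1# ≈⟨ K.+-congʳ (ι-fermat _) ⟨
        ι (k.enum i) ^ q + 1# ∎)))
      where
      ι-suc : ∀ a → ι (a k.+ k.1#) ≈ ι a + 1#
      ι-suc a = trans (ι.+-homo _ _) (K.+-congˡ ι.1#-homo)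

  abstract
    φ : K.Carrier → K.Carrier
    φ x = x ^ q

    φ-power : ∀ x → φ x ≈ x ^ q
    φ-power x = refl

  φ-cong : ∀ {x y} → x ≈ y → φ x ≈ φ y
  φ-cong {x} {y} e = trans (φ-power x) (trans (K.^-congˡ q e) (sym (φ-power y)))

  φ-0 : φ 0# ≈ 0#
  φ-0 = trans (φ-power 0#) (K.0^ 1≤q)

  φ-1 : φ 1# ≈ 1#
  φ-1 = trans (φ-power 1#) (go q) where
    go : ∀ i → 1# ^ i ≈ 1#
    go zero    = refl
    go (suc i) = trans (K.*-identityˡ _) (go i)

  φ-* : ∀ x y → φ (x * y) ≈ φ x * φ y
  φ-* x y = trans (φ-power _) (trans (K.^-distrib-* x y q) (sym (K.*-cong (φ-power x) (φ-power y))))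

  φ-ι : ∀ a → φ (ι a) ≈ ι a
  φ-ι a = trans (φ-power _) (ι-fermat a)

  -- The identity (z + 1)^q = z^q + 1 at z = x / y, multiplied by y^q.
  φ-+ : ∀ x y → φ (x + y) ≈ φ x + φ y
  φ-+ x y with y K.≟ 0#
  ... | yes y≈0 = begin
    φ (x + y) ≈⟨ φ-cong (trans (K.+-congˡ y≈0) (K.+-identityʳ x)) ⟩
    φ x ≈⟨ K.+-identityʳ _ ⟨
    φ x + 0# ≈⟨ K.+-congˡ (trans (φ-cong y≈0) φ-0) ⟨
    φ x + φ y ∎
  ... | no y≉0 = begin
    φ (x + y) ≈⟨ φ-cong x+y ⟩
    φ (y * (z + 1#)) ≈⟨ φ-* y _ ⟩
    φ y * φ (z + 1#) ≈⟨ K.*-congˡ (φ-power _) ⟩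
    φ y * (z + 1#) ^ q ≈⟨ K.*-congˡ (K.x-y≈0⇒x≈y _ _ (trans (sym (eval-freshman z)) (K.eval-0 freshman z freshman≈0))) ⟩
    φ y * (z ^ q + 1#) ≈⟨ K.*-congˡ (K.+-congʳ (φ-power z)) ⟨
    φ y * (φ z + 1#) ≈⟨ K.distribˡ _ _ _ ⟩
    φ y * φ z + φ y * 1# ≈⟨ K.+-cong (sym (φ-* y z)) (K.*-identityʳ _) ⟩
    φ (y * z) + φ y ≈⟨ K.+-congʳ (φ-cong yz) ⟩
    φ x + φ y ∎
    where
    z = y K.⁻¹ * x
    yz : y * z ≈ x
    yz = trans (sym (K.*-assoc _ _ _)) (trans (K.*-congʳ (K.⁻¹-inverseʳ y≉0)) (K.*-identityˡ x))
    x+y : x + y ≈ y * (z + 1#)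
    x+y = sym (trans (K.distribˡ _ _ _) (K.+-cong yz (K.*-identityʳ y)))

  private
    hom-neg : ∀ {τ : K.Carrier → K.Carrier} → (∀ {x y} → x ≈ y → τ x ≈ τ y) →
              (∀ x y → τ (x + y) ≈ τ x + τ y) → τ 0# ≈ 0# → ∀ x → τ (- x) ≈ - τ x
    hom-neg {τ} τ-cong τ-+ τ-0 x = inverseˡ-unique _ _
      (trans (sym (τ-+ (- x) x)) (trans (τ-cong (K.-‿inverseˡ x)) τ-0))
      where open import Algebra.Properties.Group K.+-group using (inverseˡ-unique)

  -- Injective since K is a field, hence surjective since K is finite.
  galois-automorphism : (τ : K.Carrier → K.Carrier) → (∀ {x y} → x ≈ y → τ x ≈ τ y) →
    (∀ x y → τ (x + y) ≈ τ x + τ y) → (∀ x y → τ (x * y) ≈ τ x * τ y) →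
    τ 0# ≈ 0# → τ 1# ≈ 1# → (∀ a → τ (ι a) ≈ ι a) → IsGaloisAutomorphism k K ι τ
  galois-automorphism τ τ-cong τ-+ τ-* τ-0 τ-1 fixes = record
    { isRingIsomorphism = record
      { isRingMonomorphism = record
        { isRingHomomorphism = record
          { isSemiringHomomorphism = record
            { isNearSemiringHomomorphism = record
              { +-isMonoidHomomorphism = record
                { isMagmaHomomorphism = record
                  { isRelHomomorphism = record { cong = τ-cong } ; homo = τ-+ }
                ; ε-homo = τ-0 }
              ; *-homo = τ-* }
            ; 1#-homo = τ-1 }
          ; -‿homo = hom-neg τ-cong τ-+ τ-0 }
        ; injective = inj }
      ; surjective = λ y →
          let x , τx≈y = injection⇒surjection K.isEquivalence K.isEquivalence K.cardinality K.cardinality τ inj y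
          in x , λ z≈x → trans (τ-cong z≈x) τx≈y }
    ; fixes = fixes }
    where
    inj : ∀ {x y} → τ x ≈ τ y → x ≈ y
    inj {x} {y} e with x K.≟ y
    ... | yes p = p
    ... | no x≉y = ⊥-elim (K.0≉1 (begin
      0# ≈⟨ K.zeroʳ _ ⟨
      τ (d K.⁻¹) * 0# ≈⟨ K.*-congˡ (trans (τ-+ x (- y)) (trans (K.+-congˡ (hom-neg τ-cong τ-+ τ-0 y)) (K.x≈y⇒x-y≈0 e))) ⟨
      τ (d K.⁻¹) * τ d ≈⟨ τ-* _ _ ⟨
      τ (d K.⁻¹ * d) ≈⟨ τ-cong (K.⁻¹-inverseˡ (λ d≈0 → x≉y (K.x-y≈0⇒x≈y _ _ d≈0))) ⟩
      τ 1# ≈⟨ τ-1 ⟩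
      1# ∎))
      where d = x K.- y

  private
    abstract
      -- This makes the hypothesis on σ usable: the Frobenius is a power of σ.
      φ-galois : IsGaloisAutomorphism k K ι φ
      φ-galois = galois-automorphism φ φ-cong φ-+ φ-* φ-0 φ-1 φ-ι

    module σ where
      open IsGaloisAutomorphism (proj₁ gen) public
      open RingMorphisms.IsRingIsomorphism isRingIsomorphism public

  σ-hom : RingMorphisms.IsRingHomomorphism K.rawRing K.rawRing σ
  σ-hom = σ.isRingHomomorphism

  σ-injective : ∀ {x y} → σ x ≈ σ y → x ≈ y
  σ-injective = σ.injective

  σ-ι : ∀ a → σ (ι a) ≈ ι a
  σ-ι = σ.fixes

  iterate-cong : ∀ (f : K.Carrier → K.Carrier) → (∀ {x y} → x ≈ y → f x ≈ f y) →
                 ∀ i {x y} → x ≈ y → iterate f x i ≈ iterate f y i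
  iterate-cong f c zero    e = e
  iterate-cong f c (suc i) e = iterate-cong f c i (c e)

  iterate-injective : ∀ (f : K.Carrier → K.Carrier) → (∀ {x y} → f x ≈ f y → x ≈ y) →
                      ∀ i {x y} → iterate f x i ≈ iterate f y i → x ≈ y
  iterate-injective f c zero    e = e
  iterate-injective f c (suc i) e = c (iterate-injective f c i e)

  private
    iterate-* : ∀ (f g : K.Carrier → K.Carrier) → (∀ {x y} → x ≈ y → g x ≈ g y) → ∀ j →
                (∀ x → f x ≈ iterate g x j) → ∀ m x → iterate f x m ≈ iterate g x (m ℕ.* j)
    iterate-* f g g-cong j e zero    x = refl
    iterate-* f g g-cong j e (suc m) x = begin
      iterate f (f x) m ≈⟨ iterate-* f g g-cong j e m (f x) ⟩
      iterate g (f x) (m ℕ.* j) ≈⟨ iterate-cong g g-cong (m ℕ.* j) (e x) ⟩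
      iterate g (iterate g x j) (m ℕ.* j) ≡⟨ iterate-+ g x j (m ℕ.* j) ⟨
      iterate g x (j ℕ.+ m ℕ.* j) ∎

    iterate-period : ∀ (f : K.Carrier → K.Carrier) → (∀ {x y} → x ≈ y → f x ≈ f y) → ∀ d →
                     (∀ x → iterate f x d ≈ x) → ∀ m x → iterate f x (m ℕ.* d) ≈ x
    iterate-period f c d e zero    x = refl
    iterate-period f c d e (suc m) x = begin
      iterate f x (d ℕ.+ m ℕ.* d) ≡⟨ iterate-+ f x d (m ℕ.* d) ⟩
      iterate f (iterate f x d) (m ℕ.* d) ≈⟨ iterate-cong f c (m ℕ.* d) (e x) ⟩
      iterate f x (m ℕ.* d) ≈⟨ iterate-period f c d e m x ⟩
      x ∎

    φ-iterate : ∀ m x → iterate φ x m ≈ x ^ (q ℕ.^ m)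
    φ-iterate zero    x = sym (K.*-identityʳ x)
    φ-iterate (suc m) x = trans (φ-iterate m (φ x)) (trans (K.^-congˡ (q ℕ.^ m) (φ-power x)) (K.^-assocʳ x q (q ℕ.^ m)))

    φ-period : ∀ x → iterate φ x n ≈ x
    φ-period x = trans (φ-iterate n x) (K.fermat x)

    φ-injective : ∀ {x y} → φ x ≈ φ y → x ≈ y
    φ-injective = RingMorphisms.IsRingIsomorphism.injective (IsGaloisAutomorphism.isRingIsomorphism φ-galois)

    Monic-X^-X : ∀ d → 2 ≤ d → Monic d (X K.^ₚ d +ₚ map (-_) X)
    Monic-X^-X d 2≤d = K.Monic-+ (X K.^ₚ d) (map (-_) X) (K.Monic-^ X Monic-X d)
      (Deg<-mono (map (-_) X) 2≤d (Deg<-neg X (proj₂ Monic-X)))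

    eval-X^-X : ∀ d x → eval (X K.^ₚ d +ₚ map (-_) X) x ≈ x ^ d K.- x
    eval-X^-X d x = trans (K.eval-+ (X K.^ₚ d) _ x) (K.+-cong
      (trans (K.eval-^ X d x) (K.^-congˡ d (K.eval-X x)))
      (trans (K.eval-neg X x) (K.-‿cong (K.eval-X x))))

  -- The q elements of ι(𝔽_q) already exhaust the roots of X^q - X.
  φ-fixed : ∀ x → φ x ≈ x → ∃ λ a → x ≈ ι a
  φ-fixed x e with K.root-among q (X K.^ₚ q +ₚ map (-_) X) (ι ∘ k.enum) (k.enum-injective ∘ ι-injective)
    (proj₂ (Monic-X^-X q 2≤q)) (K.Monic-≉0 (X K.^ₚ q +ₚ map (-_) X) (Monic-X^-X q 2≤q))
    (λ i → trans (eval-X^-X q _) (K.x≈y⇒x-y≈0 (ι-fermat _)))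
    x (trans (eval-X^-X q x) (K.x≈y⇒x-y≈0 (trans (sym (φ-power x)) e)))
  ... | i , p = k.enum i , sym p

  -- The Frobenius is a power of σ, so it fixes whatever σ fixes.
  σ-fixed : ∀ x → σ x ≈ x → ∃ λ a → x ≈ ι a
  σ-fixed x e with proj₂ gen φ φ-galois
  ... | i , φ≈ = φ-fixed x (trans (φ≈ x) (go i))
    where
    go : ∀ i → iterate σ x i ≈ x
    go zero    = refl
    go (suc i) = trans (iterate-cong σ σ.⟦⟧-cong i e) (go i)

  private
    D : ℕ → ℕ
    D zero    = 0
    D (suc j) = q ℕ.^ suc j ℕ.+ D j

    -- The product of X^(q^m) - X over 1 ≤ m ≤ j. It vanishes at every element fixed by φ^m for one
    -- of these m, and its degree is `D j` = q + ... + q^j.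
    G : ℕ → Poly
    G zero    = const 1#
    G (suc j) = (X K.^ₚ (q ℕ.^ suc j) +ₚ map (-_) X) *ₚ G j

    2≤q^suc : ∀ j → 2 ≤ q ℕ.^ suc j
    2≤q^suc j = ℕₚ.≤-trans 2≤q (ℕₚ.m≤m*n q (q ℕ.^ j) {{ℕₚ.m^n≢0 q j {{ℕ.>-nonZero 1≤q}}}})

    -- Since q ≥ 2. For j = n - 1 it follows that `G j` has too small a degree to vanish on all of
    -- K.
    D<q^suc : ∀ j → D j < q ℕ.^ suc j
    D<q^suc zero    = ℕₚ.≤-trans (s≤s z≤n) (2≤q^suc 0)
    D<q^suc (suc j) = ℕₚ.<-≤-trans (ℕₚ.+-monoʳ-< (q ℕ.^ suc j) (D<q^suc j))
      (ℕₚ.≤-trans (ℕₚ.≤-reflexive (≡.cong (q ℕ.^ suc j ℕ.+_) (≡.sym (ℕₚ.+-identityʳ _))))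
        (ℕₚ.*-monoˡ-≤ (q ℕ.^ suc j) 2≤q))

    G-monic : ∀ j → Monic (D j) (G j)
    G-monic zero    = Monic-1
    G-monic (suc j) = Monic-* (q ℕ.^ suc j) (D j) (X K.^ₚ (q ℕ.^ suc j) +ₚ map (-_) X) (G j) (Monic-X^-X _ (2≤q^suc j)) (G-monic j)

    G-root : ∀ j m x → 1 ≤ m → m ≤ j → iterate φ x m ≈ x → eval (G j) x ≈ 0#
    G-root zero    (suc m) x 1≤m () e
    G-root (suc j) m x 1≤m m≤j e = trans (K.eval-* (X K.^ₚ (q ℕ.^ suc j) +ₚ map (-_) X) (G j) x) (go (m ℕₚ.≟ suc j))
      where
      go : Dec (m ≡ suc j) → eval (X K.^ₚ (q ℕ.^ suc j) +ₚ map (-_) X) x * eval (G j) x ≈ 0#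
      go (yes ≡.refl) = trans (K.*-congʳ (trans (eval-X^-X (q ℕ.^ suc j) x) (K.x≈y⇒x-y≈0 (trans (sym (φ-iterate m x)) e)))) (K.zeroˡ _)
      go (no m≢)      = trans (K.*-congˡ (G-root j m x 1≤m (ℕₚ.≤-pred (ℕₚ.≤∧≢⇒< m≤j m≢)) e)) (K.zeroʳ _)

    n-1<n : suc (n ℕ.∸ 1) ≡ n
    n-1<n = ℕₚ.suc-pred n

    abstract
      -- An element outside all proper subfields, by counting roots of G.
      generator : ∃ λ θ → ∀ m → 1 ≤ m → m < n → ¬ (iterate φ θ m ≈ θ)
      generator with K.search (λ x → eval (G (n ℕ.∸ 1)) x ≈ 0#)
                       (λ {x} {y} x≈y e → trans (K.eval-congʳ (G (n ℕ.∸ 1)) (sym x≈y)) e) (λ x → eval (G (n ℕ.∸ 1)) x K.≟ 0#)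
      ... | inj₁ (θ , nonroot) = θ , λ m 1≤m m<n e → nonroot
        (G-root (n ℕ.∸ 1) m θ 1≤m (ℕₚ.≤-pred (≡.subst (m <_) (≡.sym n-1<n) m<n)) e)
      ... | inj₂ roots = ⊥-elim (K.Monic-≉0 (G (n ℕ.∸ 1)) (G-monic (n ℕ.∸ 1))
        (K.root-bound (q ℕ.^ n) (G (n ℕ.∸ 1)) K.enum K.enum-injective
          (Deg<-mono (G (n ℕ.∸ 1)) (≡.subst (λ t → D (n ℕ.∸ 1) < q ℕ.^ t) n-1<n (D<q^suc (n ℕ.∸ 1))) (proj₂ (G-monic (n ℕ.∸ 1))))
          (λ i → roots (K.enum i))))

    θ = proj₁ generator

    conj : Fin n → K.Carrier
    conj i = iterate φ θ (toℕ i)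

    conj-≢ : ∀ a b → a < b → b < n → ¬ (iterate φ θ a ≈ iterate φ θ b)
    conj-≢ a b a<b b<n e = proj₂ generator (b ℕ.∸ a) (ℕₚ.m<n⇒0<n∸m a<b) (ℕₚ.≤-<-trans (ℕₚ.m∸n≤m b a) b<n)
      (iterate-injective φ φ-injective a (begin
        iterate φ (iterate φ θ (b ℕ.∸ a)) a ≡⟨ iterate-+ φ θ (b ℕ.∸ a) a ⟨
        iterate φ θ (b ℕ.∸ a ℕ.+ a) ≡⟨ ≡.cong (iterate φ θ) (ℕₚ.m∸n+n≡m (ℕₚ.<⇒≤ a<b)) ⟩
        iterate φ θ b ≈⟨ e ⟨
        iterate φ θ a ∎))

    conj-injective : ∀ {i j} → conj i ≈ conj j → i ≡ j
    conj-injective {i} {j} e with ℕₚ.<-cmp (toℕ i) (toℕ j)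
    ... | Tri.tri< i<j _ _ = ⊥-elim (conj-≢ _ _ i<j (Finₚ.toℕ<n j) e)
    ... | Tri.tri≈ _ i≡j _ = Finₚ.toℕ-injective i≡j
    ... | Tri.tri> _ _ j<i = ⊥-elim (conj-≢ _ _ j<i (Finₚ.toℕ<n i) (sym e))

    lift : ∀ {d} → Vec k.Carrier d → Poly
    lift v = map ι (toList v)

    lift-Deg< : ∀ {d} (v : Vec k.Carrier d) → Deg< d (lift v)
    lift-Deg< []      i       _       = refl
    lift-Deg< (a ∷ v) (suc i) (s≤s p) = lift-Deg< v i p

    lift-injective : ∀ {d} (v w : Vec k.Carrier d) → lift v ≈ₚ lift w → VecPointwise.Pointwise k._≈_ v w
    lift-injective []      []      e = []
    lift-injective (a ∷ v) (b ∷ w) e = ι-injective (e 0) ∷ lift-injective v w (e ∘ suc)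

    -- Galois automorphisms fix the coefficients, so conjugates of roots are roots.
    eval-τ : ∀ τ → IsGaloisAutomorphism k K ι τ → ∀ {d} (v : Vec k.Carrier d) x →
             eval (lift v) (τ x) ≈ τ (eval (lift v) x)
    eval-τ τ gal []      x = sym (IsGaloisAutomorphism.isRingIsomorphism gal .RingMorphisms.IsRingIsomorphism.0#-homo)
    eval-τ τ gal (a ∷ v) x = begin
      ι a + τ x * eval (lift v) (τ x) ≈⟨ K.+-cong (sym (gal.fixes a)) (K.*-congˡ (eval-τ τ gal v x)) ⟩
      τ (ι a) + τ x * τ (eval (lift v) x) ≈⟨ K.+-congˡ (gal.*-homo _ _) ⟨
      τ (ι a) + τ (x * eval (lift v) x) ≈⟨ gal.+-homo _ _ ⟨
      τ (ι a + x * eval (lift v) x) ∎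
      where
      module gal where
        open IsGaloisAutomorphism gal public
        open RingMorphisms.IsRingIsomorphism isRingIsomorphism public

    -- Two vectors with the same value at θ give a polynomial over 𝔽_q that vanishes at θ and hence
    -- at all conjugates of θ.
    module Relation {d} (v w : Vec k.Carrier d) where
      diff : Poly
      diff = lift v +ₚ map (-_) (lift w)

      eval-diff : ∀ x → eval diff x ≈ eval (lift v) x K.- eval (lift w) x
      eval-diff x = trans (K.eval-+ (lift v) _ x) (K.+-congˡ (K.eval-neg (lift w) x))

      diff-Deg< : Deg< d diff
      diff-Deg< = Deg<-+ (lift v) _ (lift-Deg< v) (Deg<-neg (lift w) (lift-Deg< w))

      diff≈0 : diff ≈ₚ [] → VecPointwise.Pointwise k._≈_ v w
      diff≈0 e = lift-injective v w λ i → K.x-y≈0⇒x≈y _ _ (trans (sym (coeff-- (lift v) (lift w) i)) (e i))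

      τ-root : ∀ τ → IsGaloisAutomorphism k K ι τ → ∀ x → eval (lift v) x ≈ eval (lift w) x →
               eval (lift v) (τ x) ≈ eval (lift w) (τ x)
      τ-root τ gal x e = trans (eval-τ τ gal v x) (trans (gal.⟦⟧-cong e) (sym (eval-τ τ gal w x)))
        where
        module gal where
          open IsGaloisAutomorphism gal public
          open RingMorphisms.IsRingIsomorphism isRingIsomorphism public

      φ-roots : ∀ m {x} → eval (lift v) x ≈ eval (lift w) x → eval (lift v) (iterate φ x m) ≈ eval (lift w) (iterate φ x m)
      φ-roots zero    e = e
      φ-roots (suc m) e = φ-roots m (τ-root φ φ-galois _ e)

      conj-roots : eval (lift v) θ ≈ eval (lift w) θ → ∀ i → eval diff (conj i) ≈ 0#
      conj-roots e i = trans (eval-diff _) (K.x≈y⇒x-y≈0 (φ-roots (toℕ i) e))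

    abstract
      -- The map v ↦ v(θ) is injective, since a nonzero polynomial of degree below n cannot vanish
      -- at the n distinct conjugates of θ. Both sides have qⁿ elements, so K = 𝔽_q[θ].
      spanning : ∀ x → ∃ λ (v : Vec k.Carrier n) → eval (lift v) θ ≈ x
      spanning = injection⇒surjection (VecPointwise.isEquivalence k.isEquivalence n) K.isEquivalence
        (Vec-cardinality k.isEquivalence k.cardinality n) K.cardinality (λ v → eval (lift v) θ)
        (λ {v} {w} e → let open Relation v w in
          diff≈0 (K.root-bound n diff conj conj-injective diff-Deg< (conj-roots e)))

      -- A linear relation between 1, θ, …, θⁿ has only the n conjugates φⁱ(θ)
      -- as roots, and σ(θ) is one.
      σθ : ∃ λ i → conj i ≈ σ θ
      -- There are q^(n+1) vectors of coefficients but only qⁿ values.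
      σθ with collision (VecPointwise.isEquivalence k.isEquivalence (suc n)) K.isEquivalence
                (Vec-cardinality k.isEquivalence k.cardinality (suc n)) K.cardinality
                (ℕₚ.m<m*n (q ℕ.^ n) q {{ℕ.>-nonZero 0<qⁿ}} 2≤q ∙ ℕₚ.*-comm (q ℕ.^ n) q) (λ v → eval (lift v) θ)
        where
        _∙_ : ∀ {a b c} → a < b → b ≡ c → a < c
        p ∙ ≡.refl = p
      ... | v , w , v≉w , e = K.root-among n diff conj conj-injective diff-Deg< (v≉w ∘ diff≈0) (conj-roots e)
        (σ θ) (trans (eval-diff _) (K.x≈y⇒x-y≈0 (τ-root σ (proj₁ gen) θ e)))
        where open Relation v w

    -- The two automorphisms agree at θ and on 𝔽_q, and every x is a polynomial in θ over 𝔽_q.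
    σ≈φʲ : ∀ x → σ x ≈ iterate φ x (toℕ (proj₁ σθ))
    σ≈φʲ x with spanning x
    ... | v , e = begin
      σ x ≈⟨ σ.⟦⟧-cong e ⟨
      σ (eval (lift v) θ) ≈⟨ eval-τ σ (proj₁ gen) v θ ⟨
      eval (lift v) (σ θ) ≈⟨ K.eval-congʳ (lift v) (proj₂ σθ) ⟨
      eval (lift v) (iterate φ θ j) ≈⟨ go j θ ⟩
      iterate φ (eval (lift v) θ) j ≈⟨ iterate-cong φ φ-cong j e ⟩
      iterate φ x j ∎
      where
      j = toℕ (proj₁ σθ)
      go : ∀ j y → eval (lift v) (iterate φ y j) ≈ iterate φ (eval (lift v) y) j
      go zero    y = refl
      go (suc j) y = trans (go j (φ y)) (iterate-cong φ φ-cong j (eval-τ φ φ-galois v y))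

  -- With σ = φʲ this is (φⁿ)ʲ = 1.
  σⁿ : ∀ x → iterate σ x n ≈ x
  σⁿ x = begin
    iterate σ x n ≈⟨ iterate-* σ φ φ-cong j σ≈φʲ n x ⟩
    iterate φ x (n ℕ.* j) ≡⟨ ≡.cong (iterate φ x) (ℕₚ.*-comm n j) ⟩
    iterate φ x (j ℕ.* n) ≈⟨ iterate-period φ φ-cong n φ-period j x ⟩
    x ∎
    where j = toℕ (proj₁ σθ)

  σ-% : ∀ m x → iterate σ x m ≈ iterate σ x (m % n)
  σ-% m x = begin
    iterate σ x m ≡⟨ ≡.cong (iterate σ x) (≡.trans (DivMod.m≡m%n+[m/n]*n m n) (ℕₚ.+-comm (m % n) _)) ⟩
    iterate σ x ((m ℕ./ n) ℕ.* n ℕ.+ m % n) ≡⟨ iterate-+ σ x ((m ℕ./ n) ℕ.* n) (m % n) ⟩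
    iterate σ (iterate σ x ((m ℕ./ n) ℕ.* n)) (m % n) ≈⟨ iterate-cong σ σ.⟦⟧-cong (m % n) (iterate-period σ σ.⟦⟧-cong n σⁿ (m ℕ./ n) x) ⟩
    iterate σ x (m % n) ∎

  private
    -- The Frobenius is a power of σ, so σ^m = 1 would give φ^m = 1 and contradict the choice of θ.
    σ-order : ∀ m → m < n → (∀ x → iterate σ x m ≈ x) → m ≡ 0
    σ-order zero    m<n e = ≡.refl
    σ-order (suc m) m<n e with proj₂ gen φ φ-galois
    ... | i , φ≈ = ⊥-elim (proj₂ generator (suc m) (s≤s z≤n) m<n (begin
      iterate φ θ (suc m) ≈⟨ iterate-* φ σ σ.⟦⟧-cong i φ≈ (suc m) θ ⟩
      iterate σ θ (suc m ℕ.* i) ≡⟨ ≡.cong (iterate σ θ) (ℕₚ.*-comm (suc m) i) ⟩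
      iterate σ θ (i ℕ.* suc m) ≈⟨ iterate-period σ σ.⟦⟧-cong (suc m) e i θ ⟩
      θ ∎))

    σ-order-≤ : ∀ a b → a ≤ b → b < n → (∀ x → iterate σ x a ≈ iterate σ x b) → a ≡ b
    σ-order-≤ a b a≤b b<n e = ℕₚ.≤-antisym a≤b (ℕₚ.m∸n≡0⇒m≤n (σ-order (b ℕ.∸ a) (ℕₚ.≤-<-trans (ℕₚ.m∸n≤m b a) b<n)
      (λ x → iterate-injective σ σ.injective a (begin
        iterate σ (iterate σ x (b ℕ.∸ a)) a ≡⟨ iterate-+ σ x (b ℕ.∸ a) a ⟨
        iterate σ x (b ℕ.∸ a ℕ.+ a) ≡⟨ ≡.cong (iterate σ x) (ℕₚ.m∸n+n≡m a≤b) ⟩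
        iterate σ x b ≈⟨ e x ⟨
        iterate σ x a ∎))))

  σ-power-injective : ∀ a b → (∀ x → iterate σ x a ≈ iterate σ x b) → a % n ≡ b % n
  σ-power-injective a b e with ℕₚ.≤-total (a % n) (b % n)
  ... | inj₁ p = σ-order-≤ _ _ p (DivMod.m%n<n b n) λ x → trans (sym (σ-% a x)) (trans (e x) (σ-% b x))
  ... | inj₂ p = ≡.sym (σ-order-≤ _ _ p (DivMod.m%n<n a n) λ x → trans (sym (σ-% b x)) (trans (sym (e x)) (σ-% a x)))

-- The quotient of a ring by a central element.

module QuotientByCentral {c ℓ} (Q : Ring c ℓ) (P : Ring.Carrier Q)
  (P-central : ∀ f → Ring._≈_ Q (Ring._*_ Q P f) (Ring._*_ Q f P)) where
  open Ring Q
  open RawMagmaDefs *-rawMagma using (_∣ʳ_; _,_)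
  open RingProperties Q using (-‿distribˡ-*; -‿distribʳ-*; -0#≈0#; -‿involutive; -‿+-comm)
  open CommutativeSemigroupProperties (CommutativeMonoid.commutativeSemigroup +-commutativeMonoid) using (interchange)
  open SetoidReasoning setoid

  infix 4 _~_
  _~_ : Rel Carrier _
  f ~ g = P ∣ʳ (f - g)

  private
    telescope : ∀ a b c → (a - b) + (b - c) ≈ a - c
    telescope a b c = begin
      (a - b) + (b - c) ≈⟨ +-assoc a _ _ ⟩
      a + (- b + (b - c)) ≈⟨ +-congˡ (+-assoc (- b) b _) ⟨
      a + ((- b + b) - c) ≈⟨ +-congˡ (trans (+-congʳ (-‿inverseˡ b)) (+-identityˡ _)) ⟩
      a - c ∎

  ≈⇒~ : ∀ {f g} → f ≈ g → f ~ g
  ≈⇒~ {f} {g} e = 0# , trans (zeroˡ P) (sym (trans (+-congʳ e) (-‿inverseʳ g)))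

  ~-sym : ∀ {f g} → f ~ g → g ~ f
  ~-sym {f} {g} (q , e) = - q , (begin
    - q * P ≈⟨ -‿distribˡ-* q P ⟨
    - (q * P) ≈⟨ -‿cong e ⟩
    - (f - g) ≈⟨ -‿+-comm f (- g) ⟨
    - f + - (- g) ≈⟨ +-congˡ (-‿involutive g) ⟩
    - f + g ≈⟨ +-comm _ _ ⟩
    g - f ∎)

  ~-trans : ∀ {f g h} → f ~ g → g ~ h → f ~ h
  ~-trans {f} {g} {h} (q , e) (q′ , e′) = q + q′ ,
    trans (distribʳ P q q′) (trans (+-cong e e′) (telescope f g h))

  private
    ~-+-cong : ∀ {f f′ g g′} → f ~ f′ → g ~ g′ → f + g ~ f′ + g′
    ~-+-cong {f} {f′} {g} {g′} (q , e) (q′ , e′) = q + q′ , (begin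
      (q + q′) * P ≈⟨ trans (distribʳ P q q′) (+-cong e e′) ⟩
      (f - f′) + (g - g′) ≈⟨ interchange _ _ _ _ ⟩
      (f + g) + (- f′ - g′) ≈⟨ +-congˡ (-‿+-comm f′ g′) ⟩
      (f + g) - (f′ + g′) ∎)

    ~-neg-cong : ∀ {f g} → f ~ g → - f ~ - g
    ~-neg-cong {f} {g} (q , e) = - q ,
      trans (sym (-‿distribˡ-* q P)) (trans (-‿cong e) (sym (-‿+-comm f (- g))))

    ~-*-cong : ∀ {f f′ g g′} → f ~ f′ → g ~ g′ → f * g ~ f′ * g′
    -- The witness comes from f g - f′ g′ = (f - f′) g + f′ (g - g′), where centrality carries P
    -- past g.
    ~-*-cong {f} {f′} {g} {g′} (q , e) (q′ , e′) = q * g + f′ * q′ , (begin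
      (q * g + f′ * q′) * P ≈⟨ distribʳ P _ _ ⟩
      q * g * P + f′ * q′ * P ≈⟨ +-cong swap (*-assoc f′ q′ P) ⟩
      q * P * g + f′ * (q′ * P) ≈⟨ +-cong (*-congʳ e) (*-congˡ e′) ⟩
      (f - f′) * g + f′ * (g - g′) ≈⟨ +-cong (distribʳ g f (- f′)) (distribˡ f′ g (- g′)) ⟩
      (f * g + - f′ * g) + (f′ * g + f′ * - g′)
        ≈⟨ +-cong (+-congˡ (sym (-‿distribˡ-* f′ g))) (+-congˡ (sym (-‿distribʳ-* f′ g′))) ⟩
      (f * g - f′ * g) + (f′ * g - f′ * g′) ≈⟨ telescope _ _ _ ⟩
      f * g - f′ * g′ ∎)
      where
      swap : q * g * P ≈ q * P * g
      swap = trans (*-assoc q g P) (trans (*-congˡ (sym (P-central g))) (sym (*-assoc q P g)))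

  quotientRing : Ring c (c ⊔ ℓ)
  quotientRing = record
    { Carrier = Carrier ; _≈_ = _~_ ; _+_ = _+_ ; _*_ = _*_ ; -_ = -_ ; 0# = 0# ; 1# = 1#
    ; isRing = record
      { +-isAbelianGroup = record
        { isGroup = record
          { isMonoid = record
            { isSemigroup = record
              { isMagma = record
                { isEquivalence = record { refl = ≈⇒~ refl ; sym = ~-sym ; trans = ~-trans }
                ; ∙-cong = ~-+-cong }
              ; assoc = λ f g h → ≈⇒~ (+-assoc f g h) }
            ; identity = (λ f → ≈⇒~ (+-identityˡ f)) , (λ f → ≈⇒~ (+-identityʳ f)) }
          ; inverse = (λ f → ≈⇒~ (-‿inverseˡ f)) , (λ f → ≈⇒~ (-‿inverseʳ f))
          ; ⁻¹-cong = ~-neg-cong }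
        ; comm = λ f g → ≈⇒~ (+-comm f g) }
      ; *-cong = ~-*-cong
      ; *-assoc = λ f g h → ≈⇒~ (*-assoc f g h)
      ; *-identity = (λ f → ≈⇒~ (*-identityˡ f)) , (λ f → ≈⇒~ (*-identityʳ f))
      ; distrib = (λ f g h → ≈⇒~ (distribˡ f g h)) , (λ f g h → ≈⇒~ (distribʳ f g h))
      }
    }

-- The quotient of K[X;σ] by F(Xⁿ) and its coordinates.

module SkewQuotient {c₁ ℓ₁ c₂ ℓ₂} {q n : ℕ} (2≤q : 2 ≤ q) .{{nz : NonZero n}}
  (k : FiniteField c₁ ℓ₁ q) (K : FiniteField c₂ ℓ₂ (q ℕ.^ n))
  (ι : FiniteField.Carrier k → FiniteField.Carrier K) (ι-hom : IsExtension k K ι)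
  (σ : FiniteField.Carrier K → FiniteField.Carrier K) (gen : GeneratesGaloisGroup k K ι σ)
  (s : ℕ) (F : List (FiniteField.Carrier k)) (F-monic : Polynomial.IsMonicOfDegree (FiniteField.rawRing k) s F)
  where
  private
    module k where
      open FiniteField k public
      open FieldProperties k public
    module K where
      open FiniteField K hiding (zero) public
      open FieldProperties K public
    module ι = RingMorphisms.IsRingHomomorphism ι-hom
    module G = Galois 2≤q k K ι ι-hom σ gen
  open SkewRing K.commutativeRing σ G.σ-hom
  open Code k K ι σ n F using (evalXⁿ; _≈F_; 𝒮)
  open RawSemiringDefs (RawRing.rawSemiring rawRingₚ) using () renaming (_^_ to _^ᵖ_)
  open K using (_≈_; _+_; _*_; -_; 0#; 1#)

  private
    module R = Ring polyRing
    module ≈ = SetoidReasoning K.setoid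
    module ≈ₚ = SetoidReasoning R.setoid

  N : ℕ
  N = s ℕ.* n

  coeff-*X^-+ : ∀ m f i → coeff (f *ₚ X ^ᵖ m) (m ℕ.+ i) ≈ coeff f i
  coeff-*X^-+ zero    f i = R.*-identityʳ f i
  coeff-*X^-+ (suc m) f i = ≈.begin
    coeff (f *ₚ (X *ₚ X ^ᵖ m)) (suc (m ℕ.+ i)) ≈.≈⟨ R.*-assoc f X (X ^ᵖ m) (suc (m ℕ.+ i)) ⟨
    coeff (f *ₚ X *ₚ X ^ᵖ m) (suc (m ℕ.+ i)) ≈.≡⟨ ≡.cong (coeff (f *ₚ X *ₚ X ^ᵖ m)) (ℕₚ.+-suc m i) ⟨
    coeff (f *ₚ X *ₚ X ^ᵖ m) (m ℕ.+ suc i) ≈.≈⟨ coeff-*X^-+ m (f *ₚ X) (suc i) ⟩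
    coeff (f *ₚ X) (suc i) ≈.≈⟨ coeff-*X-suc f i ⟩
    coeff f i ≈.∎

  coeff-*X^-< : ∀ m f i → i < m → coeff (f *ₚ X ^ᵖ m) i ≈ 0#
  coeff-*X^-< (suc m) f i i<m with i ℕₚ.<? m
  ... | yes p = K.trans (K.sym (R.*-assoc f X (X ^ᵖ m) i)) (coeff-*X^-< m (f *ₚ X) i p)
  ... | no ¬p with ≡.refl ← ℕₚ.≤-antisym (ℕₚ.≤-pred i<m) (ℕₚ.≮⇒≥ ¬p) = ≈.begin
    coeff (f *ₚ (X *ₚ X ^ᵖ m)) m ≈.≈⟨ R.*-assoc f X (X ^ᵖ m) m ⟨
    coeff (f *ₚ X *ₚ X ^ᵖ m) m ≈.≡⟨ ≡.cong (coeff (f *ₚ X *ₚ X ^ᵖ m)) (ℕₚ.+-identityʳ m) ⟨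
    coeff (f *ₚ X *ₚ X ^ᵖ m) (m ℕ.+ 0) ≈.≈⟨ coeff-*X^-+ m (f *ₚ X) 0 ⟩
    coeff (f *ₚ X) 0 ≈.≈⟨ coeff-*X-zero f ⟩
    0# ≈.∎

  X-const : ∀ a → X *ₚ const a ≈ₚ const (σ a) *ₚ X
  X-const a zero    = K.trans (coeff-X*-zero (const a)) (K.sym (coeff-*X-zero (const (σ a))))
  X-const a (suc i) = K.trans (coeff-X*-suc (const a) i) (K.trans (go i) (K.sym (coeff-*X-suc (const (σ a)) i)))
    where
    go : ∀ i → σ (coeff (const a) i) ≈ coeff (const (σ a)) i
    go zero    = K.refl
    go (suc i) = σ-0

  private
    X^-const : ∀ m a → X ^ᵖ m *ₚ const a ≈ₚ const (iterate σ a m) *ₚ X ^ᵖ m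
    X^-const zero    a = R.trans {X ^ᵖ 0 *ₚ const a} {const a} {const a *ₚ X ^ᵖ 0} (R.*-identityˡ (const a)) (R.sym {const a *ₚ X ^ᵖ 0} {const a} (R.*-identityʳ (const a)))
    X^-const (suc m) a = ≈ₚ.begin
      X *ₚ X ^ᵖ m *ₚ const a ≈ₚ.≈⟨ R.*-assoc X (X ^ᵖ m) (const a) ⟩
      X *ₚ (X ^ᵖ m *ₚ const a) ≈ₚ.≈⟨ R.*-congˡ {X} {X ^ᵖ m *ₚ const a} {const (iterate σ a m) *ₚ X ^ᵖ m} (X^-const m a) ⟩
      X *ₚ (const (iterate σ a m) *ₚ X ^ᵖ m) ≈ₚ.≈⟨ R.*-assoc X (const (iterate σ a m)) (X ^ᵖ m) ⟨
      X *ₚ const (iterate σ a m) *ₚ X ^ᵖ m ≈ₚ.≈⟨ R.*-congʳ {X ^ᵖ m} {X *ₚ const (iterate σ a m)} {const (σ (iterate σ a m)) *ₚ X} (X-const _) ⟩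
      const (σ (iterate σ a m)) *ₚ X *ₚ X ^ᵖ m ≈ₚ.≈⟨ R.*-assoc (const (σ (iterate σ a m))) X (X ^ᵖ m) ⟩
      const (σ (iterate σ a m)) *ₚ X ^ᵖ suc m ≈ₚ.≡⟨ ≡.cong (λ t → const t *ₚ X ^ᵖ suc m) (iterate-suc a m) ⟩
      const (iterate σ (σ a) m) *ₚ X ^ᵖ suc m ≈ₚ.∎
      where
      iterate-suc : ∀ a m → σ (iterate σ a m) ≡ iterate σ (σ a) m
      iterate-suc a zero    = ≡.refl
      iterate-suc a (suc m) = iterate-suc (σ a) m

    X^-X : ∀ m → X ^ᵖ m *ₚ X ≈ₚ X *ₚ X ^ᵖ m
    X^-X zero    = R.trans {X ^ᵖ 0 *ₚ X} {X} {X *ₚ X ^ᵖ 0} (R.*-identityˡ X) (R.sym {X *ₚ X ^ᵖ 0} {X} (R.*-identityʳ X))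
    X^-X (suc m) = R.trans {X *ₚ X ^ᵖ m *ₚ X} {X *ₚ (X ^ᵖ m *ₚ X)} {X *ₚ (X *ₚ X ^ᵖ m)} (R.*-assoc X (X ^ᵖ m) X)
      (R.*-congˡ {X} {X ^ᵖ m *ₚ X} {X *ₚ X ^ᵖ m} (X^-X m))

  -- On constants this is σⁿ = 1.
  Xⁿ-central : ∀ f → X ^ᵖ n *ₚ f ≈ₚ f *ₚ X ^ᵖ n
  Xⁿ-central = central (X ^ᵖ n)
    (λ a → R.trans {X ^ᵖ n *ₚ const a} {const (iterate σ a n) *ₚ X ^ᵖ n} {const a *ₚ X ^ᵖ n} (X^-const n a)
      (R.*-congʳ {X ^ᵖ n} {const (iterate σ a n)} {const a} (λ { zero → G.σⁿ a ; (suc i) → K.refl })))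
    (X^-X n)

  private
    iterate-ι : ∀ i a → iterate σ (ι a) i ≈ ι a
    iterate-ι zero    a = K.refl
    iterate-ι (suc i) a = K.trans (σ^-cong i (G.σ-ι a)) (iterate-ι i a)

  ι-central : ∀ a f → const (ι a) *ₚ f ≈ₚ f *ₚ const (ι a)
  ι-central a f i = K.trans (coeff-const* (ι a) f i) (K.trans (K.*-comm _ _)
    (K.sym (K.trans (coeff-*const f (ι a) i) (K.*-congˡ (iterate-ι i a)))))

  private
    central-* : ∀ u v → (∀ f → u *ₚ f ≈ₚ f *ₚ u) → (∀ f → v *ₚ f ≈ₚ f *ₚ v) → ∀ f → (u *ₚ v) *ₚ f ≈ₚ f *ₚ (u *ₚ v)
    central-* u v uc vc f = ≈ₚ.begin
      u *ₚ v *ₚ f ≈ₚ.≈⟨ R.*-assoc u v f ⟩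
      u *ₚ (v *ₚ f) ≈ₚ.≈⟨ R.*-congˡ {u} {v *ₚ f} {f *ₚ v} (vc f) ⟩
      u *ₚ (f *ₚ v) ≈ₚ.≈⟨ R.*-assoc u f v ⟨
      u *ₚ f *ₚ v ≈ₚ.≈⟨ R.*-congʳ {v} {u *ₚ f} {f *ₚ u} (uc f) ⟩
      f *ₚ u *ₚ v ≈ₚ.≈⟨ R.*-assoc f u v ⟩
      f *ₚ (u *ₚ v) ≈ₚ.∎

  evalXⁿ-central : ∀ z f → evalXⁿ z *ₚ f ≈ₚ f *ₚ evalXⁿ z
  evalXⁿ-central []      f = R.sym {f *ₚ []} {[]} (R.zeroʳ f)
  evalXⁿ-central (x ∷ z) f = ≈ₚ.begin
    (const (ι x) +ₚ evalXⁿ z *ₚ X ^ᵖ n) *ₚ f ≈ₚ.≈⟨ R.distribʳ f (const (ι x)) (evalXⁿ z *ₚ X ^ᵖ n) ⟩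
    const (ι x) *ₚ f +ₚ evalXⁿ z *ₚ X ^ᵖ n *ₚ f
      ≈ₚ.≈⟨ R.+-cong {const (ι x) *ₚ f} {f *ₚ const (ι x)} {evalXⁿ z *ₚ X ^ᵖ n *ₚ f} {f *ₚ (evalXⁿ z *ₚ X ^ᵖ n)} (ι-central x f) (central-* (evalXⁿ z) (X ^ᵖ n) (evalXⁿ-central z) Xⁿ-central f) ⟩
    f *ₚ const (ι x) +ₚ f *ₚ (evalXⁿ z *ₚ X ^ᵖ n) ≈ₚ.≈⟨ R.distribˡ f (const (ι x)) (evalXⁿ z *ₚ X ^ᵖ n) ⟨
    f *ₚ (const (ι x) +ₚ evalXⁿ z *ₚ X ^ᵖ n) ≈ₚ.∎

  coeff-evalXⁿ : ∀ z j → coeff (evalXⁿ z) (j ℕ.* n) ≈ ι (k.P.coeff z j)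
  coeff-evalXⁿ []      j       = K.sym ι.0#-homo
  coeff-evalXⁿ (x ∷ z) zero    = K.trans (coeff-+ (const (ι x)) (evalXⁿ z *ₚ X ^ᵖ n) 0)
    (K.trans (K.+-congˡ (coeff-*X^-< n (evalXⁿ z) 0 (ℕ.>-nonZero⁻¹ n))) (K.+-identityʳ _))
  coeff-evalXⁿ (x ∷ z) (suc j) = K.trans (coeff-+ (const (ι x)) (evalXⁿ z *ₚ X ^ᵖ n) (n ℕ.+ j ℕ.* n))
    (K.trans (K.+-cong (const-suc n (j ℕ.* n) (ℕ.>-nonZero⁻¹ n)) (coeff-*X^-+ n (evalXⁿ z) (j ℕ.* n)))
      (K.trans (K.+-identityˡ _) (coeff-evalXⁿ z j)))
    where
    const-suc : ∀ n i → 0 < n → coeff (const (ι x)) (n ℕ.+ i) ≈ 0#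
    const-suc (suc n) i _ = K.refl

  coeff-evalXⁿ-% : ∀ z i → i % n ≢ 0 → coeff (evalXⁿ z) i ≈ 0#
  coeff-evalXⁿ-% []      i       i%n≢0 = K.refl
  coeff-evalXⁿ-% (x ∷ z) zero    i%n≢0 = ⊥-elim (i%n≢0 (DivMod.m<n⇒m%n≡m (ℕ.>-nonZero⁻¹ n)))
  coeff-evalXⁿ-% (x ∷ z) (suc i) i%n≢0 = K.trans (coeff-+ (const (ι x)) (evalXⁿ z *ₚ X ^ᵖ n) (suc i)) (K.trans (K.+-identityˡ _) (go (suc i) i%n≢0))
    where
    go : ∀ i → i % n ≢ 0 → coeff (evalXⁿ z *ₚ X ^ᵖ n) i ≈ 0#
    go i i%n≢0 with i ℕₚ.<? n
    ... | yes i<n = coeff-*X^-< n (evalXⁿ z) i i<n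
    ... | no  i≮n = K.trans (K.reflexive (≡.cong (coeff (evalXⁿ z *ₚ X ^ᵖ n)) (≡.sym (ℕₚ.m+[n∸m]≡n n≤i))))
      (K.trans (coeff-*X^-+ n (evalXⁿ z) (i ℕ.∸ n))
        (coeff-evalXⁿ-% z (i ℕ.∸ n) (i%n≢0 ∘ ≡.trans (≡.sym (DivMod.m≤n⇒[n∸m]%m≡n%m n≤i)))))
      where n≤i = ℕₚ.≮⇒≥ i≮n

  private
    -- z(Xⁿ) is known by its coefficients at multiples of n and by zeros elsewhere, so identities
    -- about z ↦ z(Xⁿ) are checked on these two kinds of index.
    %-split : ∀ {p} (A : ℕ → Set p) → (∀ j → A (j ℕ.* n)) → (∀ i → i % n ≢ 0 → A i) → ∀ i → A i
    %-split A mult other i with i % n ℕₚ.≟ 0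
    ... | no  i%n≢0 = other i i%n≢0
    ... | yes i%n≡0 = ≡.subst A (≡.sym (≡.trans (DivMod.m≡m%n+[m/n]*n i n) (≡.cong (ℕ._+ (i ℕ./ n) ℕ.* n) i%n≡0))) (mult (i ℕ./ n))

  evalXⁿ-cong : ∀ z w → z k.P.≈ₚ w → evalXⁿ z ≈ₚ evalXⁿ w
  evalXⁿ-cong z w e = %-split _
    (λ j → K.trans (coeff-evalXⁿ z j) (K.trans (ι.⟦⟧-cong (e j)) (K.sym (coeff-evalXⁿ w j))))
    (λ i p → K.trans (coeff-evalXⁿ-% z i p) (K.sym (coeff-evalXⁿ-% w i p)))

  evalXⁿ-+ : ∀ z w → evalXⁿ (z k.P.+ₚ w) ≈ₚ evalXⁿ z +ₚ evalXⁿ w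
  evalXⁿ-+ z w i = K.trans (go i) (K.sym (coeff-+ (evalXⁿ z) (evalXⁿ w) i))
    where
    go : ∀ i → coeff (evalXⁿ (z k.P.+ₚ w)) i ≈ coeff (evalXⁿ z) i + coeff (evalXⁿ w) i
    go = %-split _
      (λ j → K.trans (coeff-evalXⁿ (z k.P.+ₚ w) j) (K.trans (ι.⟦⟧-cong (k.P.coeff-+ z w j))
        (K.trans (ι.+-homo _ _) (K.sym (K.+-cong (coeff-evalXⁿ z j) (coeff-evalXⁿ w j))))))
      (λ i p → K.trans (coeff-evalXⁿ-% (z k.P.+ₚ w) i p)
        (K.sym (K.trans (K.+-cong (coeff-evalXⁿ-% z i p) (coeff-evalXⁿ-% w i p)) (K.+-identityˡ _))))

  evalXⁿ-scale : ∀ a z → evalXⁿ (map (a k.*_) z) ≈ₚ const (ι a) *ₚ evalXⁿ z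
  evalXⁿ-scale a z i = K.trans (go i) (K.sym (coeff-const* (ι a) (evalXⁿ z) i))
    where
    go : ∀ i → coeff (evalXⁿ (map (a k.*_) z)) i ≈ ι a * coeff (evalXⁿ z) i
    go = %-split _
      (λ j → K.trans (coeff-evalXⁿ (map (a k.*_) z) j) (K.trans (ι.⟦⟧-cong (k.P.coeff-scale a z j))
        (K.trans (ι.*-homo _ _) (K.sym (K.*-congˡ (coeff-evalXⁿ z j))))))
      (λ i p → K.trans (coeff-evalXⁿ-% (map (a k.*_) z) i p)
        (K.sym (K.trans (K.*-congˡ (coeff-evalXⁿ-% z i p)) (K.zeroʳ _))))

  evalXⁿ-* : ∀ z w → evalXⁿ (z k.P.*ₚ w) ≈ₚ evalXⁿ z *ₚ evalXⁿ w
  evalXⁿ-* []      w = λ _ → K.refl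
  evalXⁿ-* (x ∷ z) w = ≈ₚ.begin
    evalXⁿ (map (x k.*_) w k.P.+ₚ (k.0# ∷ (z k.P.*ₚ map id w)))
      ≈ₚ.≈⟨ evalXⁿ-+ (map (x k.*_) w) (k.0# ∷ (z k.P.*ₚ map id w)) ⟩
    evalXⁿ (map (x k.*_) w) +ₚ (const (ι k.0#) +ₚ evalXⁿ (z k.P.*ₚ map id w) *ₚ X ^ᵖ n)
      ≈ₚ.≈⟨ R.+-cong {evalXⁿ (map (x k.*_) w)} {const (ι x) *ₚ W} {const (ι k.0#) +ₚ evalXⁿ (z k.P.*ₚ map id w) *ₚ X ^ᵖ n} {evalXⁿ z *ₚ X ^ᵖ n *ₚ W} (evalXⁿ-scale x w) tail ⟩
    const (ι x) *ₚ W +ₚ evalXⁿ z *ₚ X ^ᵖ n *ₚ W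
      ≈ₚ.≈⟨ R.distribʳ W (const (ι x)) (evalXⁿ z *ₚ X ^ᵖ n) ⟨
    (const (ι x) +ₚ evalXⁿ z *ₚ X ^ᵖ n) *ₚ W ≈ₚ.∎
    where
    W = evalXⁿ w
    tail : const (ι k.0#) +ₚ evalXⁿ (z k.P.*ₚ map id w) *ₚ X ^ᵖ n ≈ₚ evalXⁿ z *ₚ X ^ᵖ n *ₚ W
    tail = ≈ₚ.begin
      const (ι k.0#) +ₚ evalXⁿ (z k.P.*ₚ map id w) *ₚ X ^ᵖ n
        ≈ₚ.≈⟨ R.+-congʳ {evalXⁿ (z k.P.*ₚ map id w) *ₚ X ^ᵖ n} {const (ι k.0#)} {[]} (λ { zero → ι.0#-homo ; (suc i) → K.refl }) ⟩
      evalXⁿ (z k.P.*ₚ map id w) *ₚ X ^ᵖ n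
        ≈ₚ.≡⟨ ≡.cong (λ v → evalXⁿ (z k.P.*ₚ v) *ₚ X ^ᵖ n) (Listₚ.map-id w) ⟩
      evalXⁿ (z k.P.*ₚ w) *ₚ X ^ᵖ n
        ≈ₚ.≈⟨ R.*-congʳ {X ^ᵖ n} {evalXⁿ (z k.P.*ₚ w)} {evalXⁿ z *ₚ W} (evalXⁿ-* z w) ⟩
      evalXⁿ z *ₚ W *ₚ X ^ᵖ n
        ≈ₚ.≈⟨ R.*-assoc (evalXⁿ z) W (X ^ᵖ n) ⟩
      evalXⁿ z *ₚ (W *ₚ X ^ᵖ n)
        ≈ₚ.≈⟨ R.*-congˡ {evalXⁿ z} {W *ₚ X ^ᵖ n} {X ^ᵖ n *ₚ W} (R.sym {X ^ᵖ n *ₚ W} {W *ₚ X ^ᵖ n} (Xⁿ-central W)) ⟩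
      evalXⁿ z *ₚ (X ^ᵖ n *ₚ W)
        ≈ₚ.≈⟨ R.*-assoc (evalXⁿ z) (X ^ᵖ n) W ⟨
      evalXⁿ z *ₚ X ^ᵖ n *ₚ W ≈ₚ.∎

  evalXⁿ-Deg< : ∀ d z → k.P.Deg< (suc d) z → Deg< (suc (d ℕ.* n)) (evalXⁿ z)
  evalXⁿ-Deg< d z dz = %-split _
    (λ j p → K.trans (coeff-evalXⁿ z j) (K.trans (ι.⟦⟧-cong (dz j (ℕₚ.*-cancelʳ-< n d j p))) ι.0#-homo))
    (λ i p _ → coeff-evalXⁿ-% z i p)

  P : Poly
  P = evalXⁿ F

  P-monic : Monic N P
  P-monic = K.trans (coeff-evalXⁿ F s) (K.trans (ι.⟦⟧-cong (proj₁ F-monic)) ι.1#-homo) ,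
            evalXⁿ-Deg< s F (proj₂ F-monic)

  open QuotientByCentral polyRing P (evalXⁿ-central F) public using (quotientRing; ≈⇒~)
  open RawMagmaDefs R.*-rawMagma using (_,_)

  abstract
    red : Poly → Poly
    red f = proj₁ (proj₂ (divMod P P-monic (evalXⁿ-central F X) f))

    red-Deg< : ∀ f → Deg< N (red f)
    red-Deg< f = proj₁ (proj₂ (proj₂ (divMod P P-monic (evalXⁿ-central F X) f)))

    red-≈F : ∀ f → f ≈F red f
    red-≈F f = let q , r , dr , e = divMod P P-monic (evalXⁿ-central F X) f in
      q , (λ i → K.sym (K.trans (coeff-- f r i) (K.trans (K.+-congʳ (K.trans (e i) (coeff-+ (q *ₚ P) r i)))
        (K.trans (K.+-assoc _ _ _) (K.trans (K.+-congˡ (K.-‿inverseʳ _)) (K.+-identityʳ _))))))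

  -- The difference is t P of degree below N = deg P, which forces t = 0.
  reduced-unique : ∀ f g → Deg< N f → Deg< N g → f ≈F g → f ≈ₚ g
  reduced-unique f g df dg (t , e) i = K.x-y≈0⇒x≈y _ _ (K.trans (K.sym (K.trans (e i) (coeff-- f g i)))
    (R.*-congʳ {P} {t} {[]} t≈0 i))
    where
    t≈0 : t ≈ₚ []
    t≈0 i = quotient-Deg< P P-monic 0 t
      (Deg<-cong (f +ₚ map (-_) g) (t *ₚ P) (λ j → K.sym (e j)) (Deg<-+ f _ df (Deg<-neg g dg))) i z≤n

  -- The coordinates in the basis Xⁱ, i < N.
  co : Poly → ℕ → K.Carrier
  co f = coeff (red f)

  private
    module Q = Ring quotientRing

  co-reduced : ∀ f → Deg< N f → ∀ i → co f i ≈ coeff f i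
  co-reduced f df i = reduced-unique (red f) f (red-Deg< f) df (Q.sym {f} {red f} (red-≈F f)) i

  co-vanish : ∀ f i → N ≤ i → co f i ≈ 0#
  co-vanish = red-Deg<

  co-cong : ∀ {f g} → f ≈F g → ∀ i → co f i ≈ co g i
  co-cong {f} {g} e = reduced-unique (red f) (red g) (red-Deg< f) (red-Deg< g)
    (Q.trans {red f} {f} {red g} (Q.sym {f} {red f} (red-≈F f)) (Q.trans {f} {g} {red g} e (red-≈F g)))

  co-injective : ∀ f g → (∀ i → co f i ≈ co g i) → f ≈F g
  co-injective f g e = Q.trans {f} {red f} {g} (red-≈F f) (Q.trans {red f} {red g} {g} (≈⇒~ {red f} {red g} e) (Q.sym {g} {red g} (red-≈F g)))

  private
    co-via : ∀ {f} g → f ≈F g → Deg< N g → ∀ i → co f i ≈ coeff g i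
    co-via {f} g e dg i = K.trans (co-cong {f} {g} e i) (co-reduced g dg i)

  co-+ : ∀ f g i → co (f +ₚ g) i ≈ co f i + co g i
  co-+ f g i = K.trans (co-via (red f +ₚ red g) (Q.+-cong {f} {red f} {g} {red g} (red-≈F f) (red-≈F g)) (Deg<-+ (red f) (red g) (red-Deg< f) (red-Deg< g)) i)
    (coeff-+ (red f) (red g) i)

  co-const* : ∀ a f i → co (const a *ₚ f) i ≈ a * co f i
  co-const* a f i = K.trans (co-via (const a *ₚ red f) (Q.*-congˡ {const a} {f} {red f} (red-≈F f)) (Deg<-const* a (red f) (red-Deg< f)) i)
    (coeff-const* a (red f) i)

  co-*const : ∀ f a i → co (f *ₚ const a) i ≈ co f i * iterate σ a i
  co-*const f a i = K.trans (co-via (red f *ₚ const a) (Q.*-congʳ {const a} {f} {red f} (red-≈F f)) deg i)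
    (coeff-*const (red f) a i)
    where
    deg : Deg< N (red f *ₚ const a)
    deg i p = K.trans (coeff-*const (red f) a i) (K.trans (K.*-congʳ (red-Deg< f i p)) (K.zeroˡ _))

  -- When the coordinate at N - 1 vanishes, multiplying the reduced representative by X on either
  -- side keeps it reduced, so there is a shift and no wrap-around.
  module _ (f : Poly) (top : ∀ i → suc i ≡ N → co f i ≈ 0#) where
    private
      vanish : ∀ i → N ≤ suc i → co f i ≈ 0#
      vanish i p with suc i ℕₚ.≟ N
      ... | yes e = top i e
      ... | no  e = red-Deg< f i (ℕₚ.≤-pred (ℕₚ.≤∧≢⇒< p (e ∘ ≡.sym)))

      X*-Deg< : Deg< N (X *ₚ red f)
      X*-Deg< zero    p = coeff-X*-zero (red f)
      X*-Deg< (suc i) p = K.trans (coeff-X*-suc (red f) i) (K.trans (σ-cong (vanish i p)) σ-0)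

      *X-Deg< : Deg< N (red f *ₚ X)
      *X-Deg< zero    p = coeff-*X-zero (red f)
      *X-Deg< (suc i) p = K.trans (coeff-*X-suc (red f) i) (vanish i p)

    co-X*-suc : ∀ i → co (X *ₚ f) (suc i) ≈ σ (co f i)
    co-X*-suc i = K.trans (co-via (X *ₚ red f) (Q.*-congˡ {X} {f} {red f} (red-≈F f)) X*-Deg< (suc i)) (coeff-X*-suc (red f) i)

    co-*X-zero : co (f *ₚ X) 0 ≈ 0#
    co-*X-zero = K.trans (co-via (red f *ₚ X) (Q.*-congʳ {X} {f} {red f} (red-≈F f)) *X-Deg< 0) (coeff-*X-zero (red f))

    co-*X-suc : ∀ i → co (f *ₚ X) (suc i) ≈ co f i
    co-*X-suc i = K.trans (co-via (red f *ₚ X) (Q.*-congʳ {X} {f} {red f} (red-≈F f)) *X-Deg< (suc i)) (coeff-*X-suc (red f) i)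

  -- Because d ≤ N, the list of d coefficients is itself reduced, and its entries are the
  -- coordinates.
  𝒮⇒co : ∀ {d} → d ≤ N → ∀ {f} → 𝒮 d f → ∀ i → d ≤ i → co f i ≈ 0#
  𝒮⇒co {d} d≤N {f} (α , e) i p =
    K.trans (co-via (toList α) e (Deg<-mono (toList α) d≤N (toList-Deg< α)) i) (toList-Deg< α i p)
    where
    toList-Deg< : ∀ {d} (α : Vec K.Carrier d) → Deg< d (toList α)
    toList-Deg< []      i       _       = K.refl
    toList-Deg< (a ∷ α) (suc i) (s≤s p) = toList-Deg< α i p

  co⇒𝒮 : ∀ {d} f → (∀ i → d ≤ i → co f i ≈ 0#) → 𝒮 d f
  co⇒𝒮 {d} f df = Vec.tabulate (co f ∘ toℕ) ,
    Q.trans {f} {red f} {toList (Vec.tabulate (co f ∘ toℕ))} (red-≈F f)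
      (≈⇒~ {red f} {toList (Vec.tabulate (co f ∘ toℕ))} (go d (co f) df))
    where
    go : ∀ d (h : ℕ → K.Carrier) → (∀ i → d ≤ i → h i ≈ 0#) → ∀ i → h i ≈ coeff (toList (Vec.tabulate {n = d} (h ∘ toℕ))) i
    go zero    h h0 i       = h0 i z≤n
    go (suc d) h h0 zero    = K.refl
    go (suc d) h h0 (suc i) = go d (h ∘ suc) (λ j p → h0 (suc j) (s≤s p)) i

-- Units, and the properties of the quotient on which the argument rests.

module Units {c ℓ} (Q : Ring c ℓ) where
  open Ring Q hiding (zero)
  open Exp semiring
  open SetoidReasoning setoid

  Unit : Carrier → Set _
  Unit u = ∃ λ v → v * u ≈ 1# × u * v ≈ 1#

  Unit-* : ∀ {u v} → Unit u → Unit v → Unit (u * v)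
  Unit-* {u} {v} (u′ , u′u , uu′) (v′ , v′v , vv′) = v′ * u′ ,
    (begin
      v′ * u′ * (u * v) ≈⟨ solve *-monoid ⟩
      v′ * ((u′ * u) * v) ≈⟨ *-congˡ (trans (*-congʳ u′u) (*-identityˡ v)) ⟩
      v′ * v ≈⟨ v′v ⟩
      1# ∎) ,
    (begin
      u * v * (v′ * u′) ≈⟨ solve *-monoid ⟩
      u * ((v * v′) * u′) ≈⟨ *-congˡ (trans (*-congʳ vv′) (*-identityˡ u′)) ⟩
      u * u′ ≈⟨ uu′ ⟩
      1# ∎)

  Unit-1 : Unit 1#
  Unit-1 = 1# , *-identityˡ 1# , *-identityˡ 1#

  Unit-^ : ∀ {u} → Unit u → ∀ m → Unit (u ^ m)
  Unit-^ uu zero    = Unit-1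
  Unit-^ uu (suc m) = Unit-* uu (Unit-^ uu m)

  cancelˡ : ∀ {u x y} → Unit u → u * x ≈ u * y → x ≈ y
  cancelˡ {u} {x} {y} (v , vu , _) e = begin
    x ≈⟨ trans (*-congʳ vu) (*-identityˡ x) ⟨
    v * u * x ≈⟨ *-assoc v u x ⟩
    v * (u * x) ≈⟨ *-congˡ e ⟩
    v * (u * y) ≈⟨ *-assoc v u y ⟨
    v * u * y ≈⟨ trans (*-congʳ vu) (*-identityˡ y) ⟩
    y ∎

  cancelʳ : ∀ {u x y} → Unit u → x * u ≈ y * u → x ≈ y
  cancelʳ {u} {x} {y} (v , _ , uv) e = begin
    x ≈⟨ trans (*-congˡ uv) (*-identityʳ x) ⟨
    x * (u * v) ≈⟨ *-assoc x u v ⟨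
    x * u * v ≈⟨ *-congʳ e ⟩
    y * u * v ≈⟨ *-assoc y u v ⟩
    y * (u * v) ≈⟨ trans (*-congˡ uv) (*-identityʳ y) ⟩
    y ∎

-- The quotient F_{q^n}[X;σ]/(F(Xⁿ)) with C the constants, co the coordinates
-- in the basis Xⁱ, i < N, and ev z the class of z(Xⁿ).
record SkewQuotientRing {c₁ ℓ₁ c₂ ℓ₂} {q m : ℕ}
  (k : FiniteField c₁ ℓ₁ q) (K : FiniteField c₂ ℓ₂ m)
  (ι : FiniteField.Carrier k → FiniteField.Carrier K)
  (σ : FiniteField.Carrier K → FiniteField.Carrier K)
  (n s : ℕ) .{{nz : NonZero n}} c ℓ : Set (c₁ ⊔ ℓ₁ ⊔ c₂ ⊔ ℓ₂ ⊔ Level.suc (c ⊔ ℓ)) where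
  module k = FiniteField k
  module K = FiniteField K
  module kP = Polynomial k.rawRing
  N : ℕ
  N = s ℕ.* n
  field
    Q : Ring c ℓ
  open Ring Q hiding (zero) public
  open Exp semiring public
  open Units Q public
  field
    C      : K.Carrier → Carrier
    C-cong : ∀ {a b} → a K.≈ b → C a ≈ C b
    C-+    : ∀ a b → C (a K.+ b) ≈ C a + C b
    C-*    : ∀ a b → C (a K.* b) ≈ C a * C b
    C-1    : C K.1# ≈ 1#
    C-ι-central : ∀ a u → C (ι a) * u ≈ u * C (ι a)
    X      : Carrier
    X-C    : ∀ a → X * C a ≈ C (σ a) * X
    Xⁿ-central : ∀ u → X ^ n * u ≈ u * X ^ n
    X-unit : Unit X
    co     : Carrier → ℕ → K.Carrier
    co-cong      : ∀ {u v} → u ≈ v → ∀ i → co u i K.≈ co v i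
    co-injective : ∀ u v → (∀ i → co u i K.≈ co v i) → u ≈ v
    co-vanish    : ∀ u i → N ≤ i → co u i K.≈ K.0#
    co-+   : ∀ u v i → co (u + v) i K.≈ co u i K.+ co v i
    co-C*  : ∀ a u i → co (C a * u) i K.≈ a K.* co u i
    co-*C  : ∀ u a i → co (u * C a) i K.≈ co u i K.* iterate σ a i
    co-1-zero : co 1# 0 K.≈ K.1#
    co-1-suc  : ∀ i → co 1# (suc i) K.≈ K.0#
    co-X*-suc  : ∀ u → (∀ i → suc i ≡ N → co u i K.≈ K.0#) → ∀ i → co (X * u) (suc i) K.≈ σ (co u i)
    co-*X-zero : ∀ u → (∀ i → suc i ≡ N → co u i K.≈ K.0#) → co (u * X) 0 K.≈ K.0#
    co-*X-suc  : ∀ u → (∀ i → suc i ≡ N → co u i K.≈ K.0#) → ∀ i → co (u * X) (suc i) K.≈ co u i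
    ev     : kP.Poly → Carrier
    ev-central : ∀ z u → ev z * u ≈ u * ev z
    ev-cong : ∀ {z w} → z kP.≈ₚ w → ev z ≈ ev w
    ev-unit : ∀ d z → d < s → kP.IsMonicOfDegree d z → Unit (ev z)
    co-ev   : ∀ d z → d < s → kP.IsMonicOfDegree d z → ∀ j → co (ev z) (j ℕ.* n) K.≈ ι (kP.coeff z j)
    co-ev-% : ∀ d z → d < s → kP.IsMonicOfDegree d z → ∀ i → i % n ≢ 0 → co (ev z) i K.≈ K.0#

-- Degrees, monomials and twists in the quotient.

module SkewQuotientRingProperties {c₁ ℓ₁ c₂ ℓ₂ c ℓ} {q n s : ℕ} .{{nz : NonZero n}}
  (2≤q : 2 ≤ q) (2≤n : 2 ≤ n)  (1≤s : 1 ≤ s)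
  (k : FiniteField c₁ ℓ₁ q) (K : FiniteField c₂ ℓ₂ (q ℕ.^ n))
  (ι : FiniteField.Carrier k → FiniteField.Carrier K) (ι-hom : IsExtension k K ι)
  (σ : FiniteField.Carrier K → FiniteField.Carrier K) (gen : GeneratesGaloisGroup k K ι σ)
  (A : SkewQuotientRing k K ι σ n s c ℓ)
  where
  private
    module k where
      open FiniteField k public
      open FieldProperties k public
    module K where
      open FiniteField K hiding (zero) public
      open FieldProperties K public
    module kP = Polynomial k.rawRing
    module ≈K = SetoidReasoning K.setoid
    module ι = RingMorphisms.IsRingHomomorphism ι-hom
  module G = Galois 2≤q k K ι ι-hom σ gen
  open SkewQuotientRing A hiding (N; module k; module K; module kP) public
  open RingMorphisms.IsRingHomomorphism G.σ-hom public
    using () renaming (⟦⟧-cong to σ-cong; *-homo to σ-*; 0#-homo to σ-0; 1#-homo to σ-1)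
  open SetoidReasoning setoid

  N : ℕ
  N = s ℕ.* n

  n≤N : n ≤ N
  n≤N = ℕₚ.m≤n*m n s {{ℕ.>-nonZero 1≤s}}

  1≤N : 1 ≤ N
  1≤N = ℕₚ.≤-trans (ℕₚ.≤-trans (s≤s z≤n) 2≤n) n≤N

  σ^ : ℕ → K.Carrier → K.Carrier
  σ^ i a = iterate σ a i

  σ^-cong : ∀ i {a b} → a K.≈ b → σ^ i a K.≈ σ^ i b
  σ^-cong = G.iterate-cong σ σ-cong

  σ^-0 : ∀ i → σ^ i K.0# K.≈ K.0#
  σ^-0 zero    = K.refl
  σ^-0 (suc i) = K.trans (σ^-cong i σ-0) (σ^-0 i)

  σ^-injective : ∀ i {a b} → σ^ i a K.≈ σ^ i b → a K.≈ b
  σ^-injective = G.iterate-injective σ G.σ-injective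

  σ^-≉0 : ∀ i {a} → ¬ (a K.≈ K.0#) → ¬ (σ^ i a K.≈ K.0#)
  σ^-≉0 i a≉0 e = a≉0 (σ^-injective i (K.trans e (K.sym (σ^-0 i))))

  σ^-surjective : ∀ i b → ∃ λ a → σ^ i a K.≈ b
  σ^-surjective i = injection⇒surjection K.isEquivalence K.isEquivalence K.cardinality K.cardinality (σ^ i) (σ^-injective i)

  co-C-zero : ∀ a → co (C a) 0 K.≈ a
  co-C-zero a = ≈K.begin
    co (C a) 0 ≈K.≈⟨ co-cong (*-identityʳ (C a)) 0 ⟨
    co (C a * 1#) 0 ≈K.≈⟨ co-C* a 1# 0 ⟩
    a K.* co 1# 0 ≈K.≈⟨ K.trans (K.*-congˡ co-1-zero) (K.*-identityʳ a) ⟩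
    a ≈K.∎

  co-C-suc : ∀ a i → co (C a) (suc i) K.≈ K.0#
  co-C-suc a i = ≈K.begin
    co (C a) (suc i) ≈K.≈⟨ co-cong (*-identityʳ (C a)) (suc i) ⟨
    co (C a * 1#) (suc i) ≈K.≈⟨ co-C* a 1# (suc i) ⟩
    a K.* co 1# (suc i) ≈K.≈⟨ K.trans (K.*-congˡ (co-1-suc i)) (K.zeroʳ a) ⟩
    K.0# ≈K.∎

  C-injective : ∀ {a b} → C a ≈ C b → a K.≈ b
  C-injective {a} {b} e = K.trans (K.sym (co-C-zero a)) (K.trans (co-cong e 0) (co-C-zero b))

  C-0 : C K.0# ≈ 0#
  C-0 = begin
    C K.0# ≈⟨ +-identityʳ _ ⟨
    C K.0# + 0# ≈⟨ +-congˡ (-‿inverseʳ (C K.0#)) ⟨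
    C K.0# + (C K.0# - C K.0#) ≈⟨ +-assoc _ _ _ ⟨
    (C K.0# + C K.0#) - C K.0# ≈⟨ +-congʳ (C-+ K.0# K.0#) ⟨
    C (K.0# K.+ K.0#) - C K.0# ≈⟨ +-congʳ (C-cong (K.+-identityʳ K.0#)) ⟩
    C K.0# - C K.0# ≈⟨ -‿inverseʳ _ ⟩
    0# ∎

  co-0 : ∀ i → co 0# i K.≈ K.0#
  co-0 i = ≈K.begin
    co 0# i ≈K.≈⟨ co-cong (trans (*-congʳ C-0) (zeroˡ 0#)) i ⟨
    co (C K.0# * 0#) i ≈K.≈⟨ co-C* K.0# 0# i ⟩
    K.0# K.* co 0# i ≈K.≈⟨ K.zeroˡ _ ⟩
    K.0# ≈K.∎

  C-unit : ∀ {a} → ¬ (a K.≈ K.0#) → Unit (C a)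
  C-unit {a} a≉0 = C (a K.⁻¹) ,
    trans (sym (C-* _ _)) (trans (C-cong (K.⁻¹-inverseˡ a≉0)) C-1) ,
    trans (sym (C-* _ _)) (trans (C-cong (K.⁻¹-inverseʳ a≉0)) C-1)

  Unit-≉0 : ∀ {u} → Unit u → ¬ (u ≈ 0#)
  Unit-≉0 {u} (v , vu , _) e = K.0≉1 (K.trans (K.sym (co-0 0)) (K.trans (co-cong (trans (sym (zeroʳ v)) (trans (*-congˡ (sym e)) vu)) 0) co-1-zero))

  Deg< : ℕ → Carrier → Set ℓ₂
  Deg< d u = ∀ i → d ≤ i → co u i K.≈ K.0#

  Deg<-N : ∀ u → Deg< N u
  Deg<-N = co-vanish

  Deg<-resp : ∀ {d u v} → u ≈ v → Deg< d u → Deg< d v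
  Deg<-resp e du i p = K.trans (co-cong (sym e) i) (du i p)

  Deg<-mono : ∀ {d e u} → d ≤ e → Deg< d u → Deg< e u
  Deg<-mono d≤e du i p = du i (ℕₚ.≤-trans d≤e p)

  Deg<-+ : ∀ {d u v} → Deg< d u → Deg< d v → Deg< d (u + v)
  Deg<-+ du dv i p = K.trans (co-+ _ _ i) (K.trans (K.+-cong (du i p) (dv i p)) (K.+-identityˡ _))

  Deg<-C* : ∀ {d u} a → Deg< d u → Deg< d (C a * u)
  Deg<-C* a du i p = K.trans (co-C* a _ i) (K.trans (K.*-congˡ (du i p)) (K.zeroʳ a))

  Deg<-*C : ∀ {d u} a → Deg< d u → Deg< d (u * C a)
  Deg<-*C a du i p = K.trans (co-*C _ a i) (K.trans (K.*-congʳ (du i p)) (K.zeroˡ _))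

  Deg<-step : ∀ {d u} → Deg< (suc d) u → co u d K.≈ K.0# → Deg< d u
  Deg<-step {d} du e i p with d ℕₚ.≟ i
  ... | yes ≡.refl = e
  ... | no  d≢i    = du i (ℕₚ.≤∧≢⇒< p d≢i)

  private
    top : ∀ {d u} → d < N → Deg< d u → ∀ i → suc i ≡ N → co u i K.≈ K.0#
    top {d} d<N du i e = du i (ℕₚ.≤-pred (≡.subst (d <_) (≡.sym e) d<N))

  -- Multiplication by X^m does not wrap around as long as the degree stays below N.
  module _ {d u} (du : Deg< d u) where

    X^*-Deg< : ∀ m → m ℕ.+ d ≤ N → Deg< (m ℕ.+ d) (X ^ m * u)
    X^*-Deg< zero    p = Deg<-resp (sym (*-identityˡ u)) du
    X^*-Deg< (suc m) p = Deg<-resp (sym (*-assoc X _ u)) λ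
      { (suc i) (s≤s r) → K.trans (co-X*-suc (X ^ m * u) (top p (X^*-Deg< m (ℕₚ.<⇒≤ p))) i)
          (K.trans (σ-cong (X^*-Deg< m (ℕₚ.<⇒≤ p) i r)) σ-0) }

    X^*-co : ∀ m → m ℕ.+ d ≤ N → ∀ i → co (X ^ m * u) (m ℕ.+ i) K.≈ σ^ m (co u i)
    X^*-co zero    p i = co-cong (*-identityˡ u) i
    X^*-co (suc m) p i = K.trans (co-cong (*-assoc X _ u) _)
      (K.trans (co-X*-suc (X ^ m * u) (top p (X^*-Deg< m (ℕₚ.<⇒≤ p))) (m ℕ.+ i))
        (K.trans (σ-cong (X^*-co m (ℕₚ.<⇒≤ p) i)) (K.reflexive (σ-σ^ m (co u i)))))
      where
      σ-σ^ : ∀ m a → σ (σ^ m a) ≡ σ^ m (σ a)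
      σ-σ^ zero    a = ≡.refl
      σ-σ^ (suc m) a = σ-σ^ m (σ a)

  -- Unlike X^m on the left, which applies σ^m, X^m on the right moves the coefficients unchanged.
  *X^-Deg< : ∀ {d u} → Deg< d u → ∀ m → d ℕ.+ m ≤ N → Deg< (d ℕ.+ m) (u * X ^ m)
  *X^-co   : ∀ {d u} → Deg< d u → ∀ m → d ℕ.+ m ≤ N → ∀ i → co (u * X ^ m) (m ℕ.+ i) K.≈ co u i
  *X^-co-< : ∀ {d u} → Deg< d u → ∀ m → d ℕ.+ m ≤ N → ∀ i → i < m → co (u * X ^ m) i K.≈ K.0#

  private
    *X-Deg< : ∀ {d u} → Deg< d u → d < N → Deg< (suc d) (u * X)
    *X-Deg< du d<N (suc i) (s≤s p) = K.trans (co-*X-suc _ (top d<N du) i) (du i p)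

    d<N′ : ∀ {d m} → d ℕ.+ suc m ≤ N → d < N
    d<N′ {d} {m} p = ℕₚ.≤-trans (ℕₚ.≤-trans (s≤s (ℕₚ.m≤m+n d m)) (ℕₚ.≤-reflexive (≡.sym (ℕₚ.+-suc d m)))) p

  *X^-Deg< {d} {u} du zero    p = ≡.subst (λ t → Deg< t (u * 1#)) (≡.sym (ℕₚ.+-identityʳ d)) (Deg<-resp (sym (*-identityʳ u)) du)
  *X^-Deg< {d} {u} du (suc m) p = Deg<-resp (*-assoc u X _) (≡.subst (λ t → Deg< t (u * X * X ^ m)) (≡.sym (ℕₚ.+-suc d m))
    (*X^-Deg< (*X-Deg< du (d<N′ p)) m (≡.subst (_≤ N) (ℕₚ.+-suc d m) p)))
  *X^-co {d} {u} du zero    p i = co-cong (*-identityʳ u) i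
  *X^-co {d} {u} du (suc m) p i = ≈K.begin
    co (u * (X * X ^ m)) (suc (m ℕ.+ i)) ≈K.≈⟨ co-cong (*-assoc u X _) _ ⟨
    co (u * X * X ^ m) (suc (m ℕ.+ i)) ≈K.≡⟨ ≡.cong (co (u * X * X ^ m)) (ℕₚ.+-suc m i) ⟨
    co (u * X * X ^ m) (m ℕ.+ suc i) ≈K.≈⟨ *X^-co (*X-Deg< du (d<N′ p)) m (≡.subst (_≤ N) (ℕₚ.+-suc d m) p) (suc i) ⟩
    co (u * X) (suc i) ≈K.≈⟨ co-*X-suc u (top (d<N′ p) du) i ⟩
    co u i ≈K.∎
  *X^-co-< {d} {u} du (suc m) p i i<m with i ℕₚ.<? m
  ... | yes i<m′ = K.trans (co-cong (sym (*-assoc u X _)) i) (*X^-co-< (*X-Deg< du (d<N′ p)) m (≡.subst (_≤ N) (ℕₚ.+-suc d m) p) i i<m′)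
  ... | no  i≮m with ≡.refl ← ℕₚ.≤-antisym (ℕₚ.≤-pred i<m) (ℕₚ.≮⇒≥ i≮m) = ≈K.begin
    co (u * (X * X ^ m)) m ≈K.≈⟨ co-cong (*-assoc u X _) _ ⟨
    co (u * X * X ^ m) m ≈K.≡⟨ ≡.cong (co (u * X * X ^ m)) (ℕₚ.+-identityʳ m) ⟨
    co (u * X * X ^ m) (m ℕ.+ 0) ≈K.≈⟨ *X^-co (*X-Deg< du (d<N′ p)) m (≡.subst (_≤ N) (ℕₚ.+-suc d m) p) 0 ⟩
    co (u * X) 0 ≈K.≈⟨ co-*X-zero u (top (d<N′ p) du) ⟩
    K.0# ≈K.∎

  C-Deg< : ∀ a → Deg< 1 (C a)
  C-Deg< a (suc i) p = co-C-suc a i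

  co-monomial : ∀ a e → e < N → co (C a * X ^ e) e K.≈ a
  co-monomial a e e<N = K.trans (K.reflexive (≡.cong (co (C a * X ^ e)) (≡.sym (ℕₚ.+-identityʳ e))))
    (K.trans (*X^-co (C-Deg< a) e e<N 0) (co-C-zero a))

  co-monomial-≢ : ∀ a e → e < N → ∀ i → i ≢ e → co (C a * X ^ e) i K.≈ K.0#
  co-monomial-≢ a e e<N i i≢e with ℕₚ.<-cmp i e
  ... | Tri.tri< i<e _ _ = *X^-co-< (C-Deg< a) e e<N i i<e
  ... | Tri.tri≈ _ i≡e _ = ⊥-elim (i≢e i≡e)
  ... | Tri.tri> _ _ e<i = *X^-Deg< (C-Deg< a) e e<N i e<i

  monomial-Deg< : ∀ {d} a e → e < d → e < N → Deg< d (C a * X ^ e)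
  monomial-Deg< a e e<d e<N i d≤i = co-monomial-≢ a e e<N i (λ { ≡.refl → ℕₚ.<⇒≱ e<d d≤i })

  monomial : ∀ u e → e < N → (∀ i → i ≢ e → co u i K.≈ K.0#) → u ≈ C (co u e) * X ^ e
  monomial u e e<N vanish = co-injective _ _ go
    where
    go : ∀ i → co u i K.≈ co (C (co u e) * X ^ e) i
    go i with i ℕₚ.≟ e
    ... | yes ≡.refl = K.sym (co-monomial (co u e) e e<N)
    ... | no  i≢e    = K.trans (vanish i i≢e) (K.sym (co-monomial-≢ (co u e) e e<N i i≢e))

  constant : ∀ u → Deg< 1 u → u ≈ C (co u 0)
  constant u du = trans (monomial u 0 1≤N (λ { zero 0≢0 → ⊥-elim (0≢0 ≡.refl) ; (suc i) _ → du (suc i) (s≤s z≤n) })) (*-identityʳ _)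

  -- Stripping the top term reduces additive properties to monomials.
  Deg<-induction : ∀ {p} (T : Carrier → Set p) → (∀ {u v} → u ≈ v → T u → T v) →
    (∀ {u v} → T u → T v → T (u + v)) → T 0# →
    ∀ d → d ≤ N → (∀ a e → e < d → T (C a * X ^ e)) → ∀ u → Deg< d u → T u
  Deg<-induction T resp add T0 zero    d≤N mono u du =
    resp (sym (co-injective u 0# (λ i → K.trans (du i z≤n) (K.sym (co-0 i))))) T0
  Deg<-induction T resp add T0 (suc d) d≤N mono u du =
    resp split (add (Deg<-induction T resp add T0 d (ℕₚ.<⇒≤ d≤N) (λ a e e<d → mono a e (ℕₚ.m<n⇒m<1+n e<d)) u′ du′)
      (mono (co u d) d ℕₚ.≤-refl))
    where
    t = C (co u d) * X ^ d
    t⁻ = C (K.- co u d) * X ^ d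
    u′ = u + t⁻
    du′ : Deg< d u′
    du′ = Deg<-step (Deg<-+ du (monomial-Deg< (K.- co u d) d ℕₚ.≤-refl d≤N))
      (K.trans (co-+ u t⁻ d) (K.trans (K.+-congˡ (co-monomial _ d d≤N)) (K.-‿inverseʳ _)))
    split : u′ + t ≈ u
    split = begin
      u + t⁻ + t ≈⟨ +-assoc u t⁻ t ⟩
      u + (t⁻ + t) ≈⟨ +-congˡ (distribʳ _ _ _) ⟨
      u + (C (K.- co u d) + C (co u d)) * X ^ d ≈⟨ +-congˡ (*-congʳ (trans (sym (C-+ _ _)) (trans (C-cong (K.-‿inverseˡ _)) C-0))) ⟩
      u + 0# * X ^ d ≈⟨ trans (+-congˡ (zeroˡ _)) (+-identityʳ u) ⟩
      u ∎

  leading : ∀ d u → Deg< d u → (u ≈ 0#) ⊎ ∃ λ e → e < d × ¬ (co u e K.≈ K.0#) × Deg< (suc e) u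
  leading zero    u du = inj₁ (co-injective u 0# (λ i → K.trans (du i z≤n) (K.sym (co-0 i))))
  leading (suc d) u du with co u d K.≟ K.0#
  ... | no  ≉0 = inj₂ (d , ℕₚ.≤-refl , ≉0 , du)
  ... | yes ≈0 with leading d u (Deg<-step du ≈0)
  ...   | inj₁ e = inj₁ e
  ...   | inj₂ (e , e<d , ≉0 , de) = inj₂ (e , ℕₚ.m<n⇒m<1+n e<d , ≉0 , de)

  unit-leading : ∀ d u → Unit u → Deg< d u → ∃ λ e → e < d × ¬ (co u e K.≈ K.0#) × Deg< (suc e) u
  unit-leading d u uu du with leading d u du
  ... | inj₁ u≈0 = ⊥-elim (Unit-≉0 uu u≈0)
  ... | inj₂ e   = e

  -- u normalizes the constants, acting on them as σ^i.
  Twists : ℕ → Carrier → Set _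
  Twists i u = ∀ a → u * C a ≈ C (σ^ i a) * u

  Twists-resp : ∀ {i u v} → u ≈ v → Twists i u → Twists i v
  Twists-resp e tu a = trans (*-congʳ (sym e)) (trans (tu a) (*-congˡ e))

  Twists-* : ∀ {i j u v} → Twists i u → Twists j v → Twists (j ℕ.+ i) (u * v)
  Twists-* {i} {j} {u} {v} tu tv a = begin
    u * v * C a ≈⟨ *-assoc u v _ ⟩
    u * (v * C a) ≈⟨ *-congˡ (tv a) ⟩
    u * (C (σ^ j a) * v) ≈⟨ *-assoc u _ v ⟨
    u * C (σ^ j a) * v ≈⟨ *-congʳ (tu _) ⟩
    C (σ^ i (σ^ j a)) * u * v ≈⟨ *-assoc _ u v ⟩
    C (σ^ i (σ^ j a)) * (u * v) ≡⟨ ≡.cong (λ b → C b * (u * v)) (iterate-+ σ a j i) ⟨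
    C (σ^ (j ℕ.+ i) a) * (u * v) ∎

  Twists-C : ∀ b → Twists 0 (C b)
  Twists-C b a = trans (sym (C-* b a)) (trans (C-cong (K.*-comm b a)) (C-* a b))

  Twists-X : Twists 1 X
  Twists-X = X-C

  Twists-X^ : ∀ m → Twists m (X ^ m)
  Twists-X^ zero    a = trans (*-identityˡ _) (sym (*-identityʳ _))
  Twists-X^ (suc m) = ≡.subst (λ t → Twists t (X ^ suc m)) (ℕₚ.+-comm m 1) (Twists-* {1} {m} Twists-X (Twists-X^ m))

  Twists-% : ∀ {i u} → Twists i u → Twists (i % n) u
  Twists-% {i} tu a = trans (tu a) (*-congʳ (C-cong (G.σ-% i a)))

  -- The coordinate at m of u a = σ^i(a) u reads u_m σ^m(a) = σ^i(a) u_m. If u_m ≠ 0, then σ^m = σ^i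
  -- on K, and σ has order n.
  Twists-co : ∀ {i u} → Twists i u → ∀ m → ¬ (co u m K.≈ K.0#) → m % n ≡ i % n
  Twists-co {i} {u} tu m ≉0 = G.σ-power-injective m i λ a → K.*-cancelˡ (co u m) ≉0 (≈K.begin
    co u m K.* σ^ m a ≈K.≈⟨ co-*C u a m ⟨
    co (u * C a) m ≈K.≈⟨ co-cong (tu a) m ⟩
    co (C (σ^ i a) * u) m ≈K.≈⟨ co-C* _ u m ⟩
    σ^ i a K.* co u m ≈K.≈⟨ K.*-comm _ _ ⟩
    co u m K.* σ^ i a ≈K.∎)

  Twists-vanish : ∀ {i u} → Twists i u → ∀ m → m % n ≢ i % n → co u m K.≈ K.0#
  Twists-vanish {u = u} tu m m≢ with co u m K.≟ K.0#
  ... | yes e = e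
  ... | no ¬e = ⊥-elim (m≢ (Twists-co tu m ¬e))

  X^a*n-central : ∀ a u → X ^ (a ℕ.* n) * u ≈ u * X ^ (a ℕ.* n)
  X^a*n-central zero    u = trans (*-identityˡ u) (sym (*-identityʳ u))
  X^a*n-central (suc a) u = begin
    X ^ (n ℕ.+ a ℕ.* n) * u ≈⟨ *-congʳ (^-homo-* X n (a ℕ.* n)) ⟩
    X ^ n * X ^ (a ℕ.* n) * u ≈⟨ *-assoc _ _ u ⟩
    X ^ n * (X ^ (a ℕ.* n) * u) ≈⟨ *-congˡ (X^a*n-central a u) ⟩
    X ^ n * (u * X ^ (a ℕ.* n)) ≈⟨ *-assoc _ u _ ⟨
    X ^ n * u * X ^ (a ℕ.* n) ≈⟨ *-congʳ (Xⁿ-central u) ⟩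
    u * X ^ n * X ^ (a ℕ.* n) ≈⟨ *-assoc u _ _ ⟩
    u * (X ^ n * X ^ (a ℕ.* n)) ≈⟨ *-congˡ (^-homo-* X n (a ℕ.* n)) ⟨
    u * X ^ (n ℕ.+ a ℕ.* n) ∎

  -- Conjugation by u is a Galois automorphism, hence a power of σ.
  normalizer-twists : ∀ u v → v * u ≈ 1# → (∀ a → ∃ λ b → u * C a * v ≈ C b) → ∃ λ i → i < n × Twists i u
  normalizer-twists u v vu conj with proj₂ gen τ (G.galois-automorphism τ τ-cong τ-+ τ-* τ-0 τ-1 τ-ι)
    where
    τ : K.Carrier → K.Carrier
    τ a = proj₁ (conj a)
    τ-def : ∀ a → u * C a * v ≈ C (τ a)
    τ-def a = proj₂ (conj a)
    -- Given is v u = 1. The product u v = τ(1) is an idempotent of the field K, nonzero because v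
    -- (u v) u = 1; hence it is 1.
    uv : u * v ≈ 1#
    uv = begin
      u * v ≈⟨ *-congʳ (trans (*-congˡ C-1) (*-identityʳ u)) ⟨
      u * C K.1# * v ≈⟨ τ-def K.1# ⟩
      C (τ K.1#) ≈⟨ C-cong τ1 ⟩
      C K.1# ≈⟨ C-1 ⟩
      1# ∎
      where
      t = τ K.1#
      e : C t ≈ u * v
      e = trans (sym (τ-def K.1#)) (*-congʳ (trans (*-congˡ C-1) (*-identityʳ u)))
      idem : t K.* t K.≈ t
      idem = C-injective (begin
        C (t K.* t) ≈⟨ trans (C-* t t) (*-cong e e) ⟩
        u * v * (u * v) ≈⟨ solve *-monoid ⟩
        u * (v * u) * v ≈⟨ *-congʳ (trans (*-congˡ vu) (*-identityʳ u)) ⟩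
        u * v ≈⟨ e ⟨
        C t ∎)
      t≉0 : ¬ (t K.≈ K.0#)
      t≉0 t≈0 = K.0≉1 (C-injective (begin
        C K.0# ≈⟨ C-0 ⟩
        0# ≈⟨ trans (*-congˡ (zeroˡ u)) (zeroʳ v) ⟨
        v * (0# * u) ≈⟨ *-congˡ (*-congʳ (trans (sym C-0) (trans (C-cong (K.sym t≈0)) e))) ⟩
        v * (u * v * u) ≈⟨ solve *-monoid ⟩
        (v * u) * (v * u) ≈⟨ trans (*-cong vu vu) (*-identityˡ 1#) ⟩
        1# ≈⟨ C-1 ⟨
        C K.1# ∎))
      τ1 : t K.≈ K.1#
      τ1 = K.*-cancelˡ t t≉0 (K.trans idem (K.sym (K.*-identityʳ t)))
    τ-cong : ∀ {a b} → a K.≈ b → τ a K.≈ τ b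
    τ-cong {a} {b} e = C-injective (trans (sym (τ-def a)) (trans (*-congʳ (*-congˡ (C-cong e))) (τ-def b)))
    τ-+ : ∀ a b → τ (a K.+ b) K.≈ τ a K.+ τ b
    τ-+ a b = C-injective (begin
      C (τ (a K.+ b)) ≈⟨ τ-def _ ⟨
      u * C (a K.+ b) * v ≈⟨ *-congʳ (trans (*-congˡ (C-+ a b)) (distribˡ u _ _)) ⟩
      (u * C a + u * C b) * v ≈⟨ distribʳ v _ _ ⟩
      u * C a * v + u * C b * v ≈⟨ +-cong (τ-def a) (τ-def b) ⟩
      C (τ a) + C (τ b) ≈⟨ C-+ _ _ ⟨
      C (τ a K.+ τ b) ∎)
    τ-* : ∀ a b → τ (a K.* b) K.≈ τ a K.* τ b
    τ-* a b = C-injective (begin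
      C (τ (a K.* b)) ≈⟨ τ-def _ ⟨
      u * C (a K.* b) * v ≈⟨ *-congʳ (*-congˡ (C-* a b)) ⟩
      u * (C a * C b) * v ≈⟨ *-congʳ (*-congˡ (*-congˡ (trans (*-congʳ vu) (*-identityˡ (C b))))) ⟨
      u * (C a * (v * u * C b)) * v ≈⟨ solve *-monoid ⟩
      u * C a * v * (u * C b * v) ≈⟨ *-cong (τ-def a) (τ-def b) ⟩
      C (τ a) * C (τ b) ≈⟨ C-* _ _ ⟨
      C (τ a K.* τ b) ∎)
    τ-central : ∀ a → (∀ w → C a * w ≈ w * C a) → τ a K.≈ a
    τ-central a ca = C-injective (begin
      C (τ a) ≈⟨ τ-def a ⟨
      u * C a * v ≈⟨ *-congʳ (ca u) ⟨
      C a * u * v ≈⟨ *-assoc _ u v ⟩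
      C a * (u * v) ≈⟨ trans (*-congˡ uv) (*-identityʳ _) ⟩
      C a ∎)
    τ-0 : τ K.0# K.≈ K.0#
    τ-0 = τ-central K.0# (λ w → trans (*-congʳ C-0) (trans (zeroˡ w) (sym (trans (*-congˡ C-0) (zeroʳ w)))))
    τ-1 : τ K.1# K.≈ K.1#
    τ-1 = τ-central K.1# (λ w → trans (*-congʳ C-1) (trans (*-identityˡ w) (sym (trans (*-congˡ C-1) (*-identityʳ w)))))
    τ-ι : ∀ a → τ (ι a) K.≈ ι a
    τ-ι a = τ-central (ι a) (C-ι-central a)
  ... | i , τ≈ = i % n , DivMod.m%n<n i n , Twists-% {i} (λ a → begin
    u * C a ≈⟨ trans (*-congˡ vu) (*-identityʳ _) ⟨
    u * C a * (v * u) ≈⟨ *-assoc _ v u ⟨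
    u * C a * v * u ≈⟨ *-congʳ (proj₂ (conj a)) ⟩
    C (proj₁ (conj a)) * u ≈⟨ *-congʳ (C-cong (τ≈ a)) ⟩
    C (σ^ i a) * u ∎)

-- Residues, and monic polynomials with prescribed coefficients.

%-+-distribˡ : ∀ a b n .{{_ : NonZero n}} → (a ℕ.+ b % n) % n ≡ (a ℕ.+ b) % n
%-+-distribˡ a b n = ≡.trans (DivMod.%-distribˡ-+ a (b % n) n)
  (≡.trans (≡.cong (λ t → (a % n ℕ.+ t) % n) (DivMod.m%n%n≡m%n b n)) (≡.sym (DivMod.%-distribˡ-+ a b n)))

≡-mod⇒+* : ∀ n .{{_ : NonZero n}} d t → d ≤ t → t % n ≡ d % n → ∃ λ a → t ≡ a ℕ.* n ℕ.+ d
≡-mod⇒+* n d t d≤t e = t/n ℕ.∸ d/n , (begin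
  t ≡⟨ DivMod.m≡m%n+[m/n]*n t n ⟩
  t % n ℕ.+ t/n ℕ.* n ≡⟨ ≡.cong₂ (λ u v → u ℕ.+ v ℕ.* n) e (≡.sym (ℕₚ.m∸n+n≡m (DivMod./-monoˡ-≤ n d≤t))) ⟩
  d % n ℕ.+ (t/n ℕ.∸ d/n ℕ.+ d/n) ℕ.* n ≡⟨ ≡.cong (d % n ℕ.+_) (ℕₚ.*-distribʳ-+ n (t/n ℕ.∸ d/n) d/n) ⟩
  d % n ℕ.+ (a*n ℕ.+ d/n ℕ.* n) ≡⟨ ℕₚ.+-assoc (d % n) a*n _ ⟨
  d % n ℕ.+ a*n ℕ.+ d/n ℕ.* n ≡⟨ ≡.cong (ℕ._+ d/n ℕ.* n) (ℕₚ.+-comm (d % n) a*n) ⟩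
  a*n ℕ.+ d % n ℕ.+ d/n ℕ.* n ≡⟨ ℕₚ.+-assoc a*n (d % n) _ ⟩
  a*n ℕ.+ (d % n ℕ.+ d/n ℕ.* n) ≡⟨ ≡.cong (a*n ℕ.+_) (DivMod.m≡m%n+[m/n]*n d n) ⟨
  a*n ℕ.+ d ∎)
  where
  open ≡.≡-Reasoning
  t/n = t ℕ./ n
  d/n = d ℕ./ n
  a*n = (t/n ℕ.∸ d/n) ℕ.* n

module _ {c ℓ} (R : CommutativeRing c ℓ) where
  open CommutativeRing R hiding (zero)
  open Polynomial rawRing

  monic-with-coefficients : ∀ (f : ℕ → Carrier) d → f d ≈ 1# →
    ∃ λ z → IsMonicOfDegree d z × (∀ j → j ≤ d → coeff z j ≈ f j)
  monic-with-coefficients f d fd = applyUpTo f (suc d) ,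
    (trans (below f (suc d) d ℕₚ.≤-refl) fd , above f (suc d)) , (λ j j≤d → below f (suc d) j (s≤s j≤d))
    where
    below : ∀ (f : ℕ → Carrier) m j → j < m → coeff (applyUpTo f m) j ≈ f j
    below f (suc m) zero    _       = refl
    below f (suc m) (suc j) (s≤s p) = below (f ∘ suc) m j p
    above : ∀ (f : ℕ → Carrier) m j → m ≤ j → coeff (applyUpTo f m) j ≈ 0#
    above f zero    j       _       = refl
    above f (suc m) (suc j) (s≤s p) = above (f ∘ suc) m j p

-- Every automorphism has standard form.

module Automorphism {c₁ ℓ₁ c₂ ℓ₂ c ℓ} {q n s : ℕ} .{{nz : NonZero n}}
  (2≤q : 2 ≤ q) (2≤n : 2 ≤ n) (2≤s : 2 ≤ s)
  (k : FiniteField c₁ ℓ₁ q) (K : FiniteField c₂ ℓ₂ (q ℕ.^ n))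
  (ι : FiniteField.Carrier k → FiniteField.Carrier K) (ι-hom : IsExtension k K ι)
  (σ : FiniteField.Carrier K → FiniteField.Carrier K) (gen : GeneratesGaloisGroup k K ι σ)
  (A : SkewQuotientRing k K ι σ n s c ℓ)
  -- The excluded polynomials enter through this consequence: for n = s = 2 the element X⁴ = X^N is
  -- not a constant.
  (excluded : n ≡ 2 → s ≡ 2 → ∀ ν → ¬ SkewQuotientRing._≈_ A (SkewQuotientRing._^_ A (SkewQuotientRing.X A) 4) (SkewQuotientRing.C A ν))
  -- Two exponents, M and M + 1, lie outside S and still below N.
  (M : ℕ) (2≤M : 2 ≤ M) (M+2≤N : 2 ℕ.+ M ≤ s ℕ.* n)
  where
  open SkewQuotientRingProperties 2≤q 2≤n (ℕₚ.≤-trans (s≤s z≤n) 2≤s) k K ι ι-hom σ gen A public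
  private
    module k where
      open FiniteField k public
      open FieldProperties k public
    module K where
      open FiniteField K hiding (zero) public
      open FieldProperties K public
    module kP = Polynomial k.rawRing
    module ≈K = SetoidReasoning K.setoid
    module ι = RingMorphisms.IsRingHomomorphism ι-hom
  open SetoidReasoning setoid

  S : Carrier → Set ℓ₂
  S = Deg< M

  M<N : M < N
  M<N = ℕₚ.<⇒≤ M+2≤N

  1≤M : 1 ≤ M
  1≤M = ℕₚ.<⇒≤ 2≤M

  0<n : 0 < n
  0<n = ℕₚ.<⇒≤ 2≤n

  S-X^ : ∀ m → m < M → S (X ^ m)
  S-X^ m m<M = Deg<-resp (trans (*-congʳ C-1) (*-identityˡ _)) (monomial-Deg< K.1# m m<M (ℕₚ.<-trans m<M M<N))

  private
    descend : ∀ f → (∀ d → suc d < M → Deg< (suc (suc d)) f → co f (suc d) K.≈ K.0#) →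
              ∀ d → d < M → Deg< (suc d) f → f ≈ C (co f 0)
    descend f step zero    d<M df = constant f df
    descend f step (suc d) d<M df = descend f step d (ℕₚ.<⇒≤ d<M) (Deg<-step df (step d d<M df))

    constant-by-descent : ∀ f → S f → (∀ d → suc d < M → Deg< (suc (suc d)) f → co f (suc d) K.≈ K.0#) → ∃ λ b → f ≈ C b
    constant-by-descent f Sf step = co f 0 ,
      descend f step (M ℕ.∸ 1) (ℕₚ.≤-reflexive M-1) (≡.subst (λ t → Deg< t f) (≡.sym M-1) Sf)
      where
      M-1 : suc (M ℕ.∸ 1) ≡ M
      M-1 = ℕₚ.m+[n∸m]≡n 1≤M

  -- If f has degree d with 1 ≤ d < M, then f X^{M−d} has degree M.
  left-idealizer : ∀ f → (∀ c → S c → S (f * c)) → ∃ λ b → f ≈ C b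
  left-idealizer f stable = constant-by-descent f
    (Deg<-resp (*-identityʳ f) (stable 1# (S-X^ 0 1≤M))) step
    where
    step : ∀ d → suc d < M → Deg< (suc (suc d)) f → co f (suc d) K.≈ K.0#
    step d d<M df = ≈K.begin
      co f (suc d) ≈K.≈⟨ *X^-co df e bound (suc d) ⟨
      co (f * X ^ e) (e ℕ.+ suc d) ≈K.≈⟨ stable (X ^ e) (S-X^ e e<M) _ (ℕₚ.≤-reflexive (≡.sym e+d)) ⟩
      K.0# ≈K.∎
      where
      e = M ℕ.∸ suc d
      e+d : e ℕ.+ suc d ≡ M
      e+d = ℕₚ.m∸n+n≡m (ℕₚ.<⇒≤ d<M)
      e<M : e < M
      e<M = ℕₚ.∸-monoʳ-< {M} {suc d} {0} (s≤s z≤n) (ℕₚ.<⇒≤ d<M)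
      bound : suc (suc d) ℕ.+ e ≤ N
      bound = ℕₚ.≤-trans (ℕₚ.≤-reflexive (≡.cong suc (≡.trans (ℕₚ.+-comm (suc d) e) e+d))) M<N

  -- Here X^(M-d) f has degree M. Its top coefficient is the image under σ^(M-d) of that of f, and σ
  -- is injective.
  right-idealizer : ∀ f → (∀ c → S c → S (c * f)) → ∃ λ b → f ≈ C b
  right-idealizer f stable = constant-by-descent f
    (Deg<-resp (*-identityˡ f) (stable 1# (S-X^ 0 1≤M))) step
    where
    step : ∀ d → suc d < M → Deg< (suc (suc d)) f → co f (suc d) K.≈ K.0#
    step d d<M df = σ^-injective e (≈K.begin
      σ^ e (co f (suc d)) ≈K.≈⟨ X^*-co df e bound (suc d) ⟨
      co (X ^ e * f) (e ℕ.+ suc d) ≈K.≈⟨ stable (X ^ e) (S-X^ e e<M) _ (ℕₚ.≤-reflexive (≡.sym e+d)) ⟩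
      K.0# ≈K.≈⟨ σ^-0 e ⟨
      σ^ e K.0# ≈K.∎)
      where
      e = M ℕ.∸ suc d
      e+d : e ℕ.+ suc d ≡ M
      e+d = ℕₚ.m∸n+n≡m (ℕₚ.<⇒≤ d<M)
      e<M : e < M
      e<M = ℕₚ.∸-monoʳ-< {M} {suc d} {0} (s≤s z≤n) (ℕₚ.<⇒≤ d<M)
      bound : e ℕ.+ suc (suc d) ≤ N
      bound = ℕₚ.≤-trans (ℕₚ.≤-reflexive (≡.trans (ℕₚ.+-suc e (suc d)) (≡.cong suc e+d))) M<N

  record Standard (u : Carrier) (i : ℕ) (d : ℕ) (z : kP.Poly) (a : K.Carrier) : Set (ℓ₁ ⊔ ℓ₂ ⊔ ℓ) where
    field
      d<s   : d < s
      monic : kP.IsMonicOfDegree d z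
      a≉0   : ¬ (a K.≈ K.0#)
      form  : u ≈ C a * ev z * X ^ i

  module _ (u : Carrier) (κ : K.Carrier) (u-unit : Unit u) (u-twists : Twists 0 u) (uX : u * X ≈ C κ * (X * u)) where
    private
      -- u is supported on multiples of n, and N - 1 is not one, because n divides N and n ≥ 2. So u
      -- X and X u do not wrap around.
      u-top : ∀ t → suc t ≡ N → co u t K.≈ K.0#
      u-top t e = Twists-vanish {0} u-twists t λ p →
        ℕₚ.<⇒≢ 2≤n (≡.sym (Div.∣1⇒≡1 (Div.∣m+n∣m⇒∣n (≡.subst (n ∣_) (≡.trans (≡.sym e) (ℕₚ.+-comm 1 t)) (Div.divides s ≡.refl))
          (Div.m%n≡0⇒n∣m t n (≡.trans p (DivMod.m<n⇒m%n≡m 0<n))))))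

      -- The coordinate at t + 1 of u X = κ X u.
      co-u-σ : ∀ t → co u t K.≈ κ K.* σ (co u t)
      co-u-σ t = ≈K.begin
        co u t ≈K.≈⟨ co-*X-suc u u-top t ⟨
        co (u * X) (suc t) ≈K.≈⟨ co-cong uX (suc t) ⟩
        co (C κ * (X * u)) (suc t) ≈K.≈⟨ co-C* κ _ (suc t) ⟩
        κ K.* co (X * u) (suc t) ≈K.≈⟨ K.*-congˡ (co-X*-suc u u-top t) ⟩
        κ K.* σ (co u t) ≈K.∎

      module Top (D : ℕ) (D<N : D < N) (a≉0 : ¬ (co u D K.≈ K.0#)) (deg : Deg< (suc D) u) where
        a : K.Carrier
        a = co u D

        d : ℕ
        d = D ℕ./ n

        D≡d*n : D ≡ d ℕ.* n
        D≡d*n = ≡.trans (DivMod.m≡m%n+[m/n]*n D n)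
          (≡.cong (ℕ._+ d ℕ.* n) (≡.trans (Twists-co {0} u-twists D a≉0) (DivMod.m<n⇒m%n≡m 0<n)))

        d<s : d < s
        d<s = ℕₚ.*-cancelʳ-< n d s (≡.subst (_< N) D≡d*n D<N)

        -- Dividing by the leading coefficient makes z monic and, at the same time, brings all
        -- coefficients into the fixed field of σ.
        x : ℕ → K.Carrier
        x t = a K.⁻¹ K.* co u t

        ax : ∀ t → a K.* x t K.≈ co u t
        ax t = K.trans (K.sym (K.*-assoc _ _ _)) (K.trans (K.*-congʳ (K.⁻¹-inverseʳ a≉0)) (K.*-identityˡ _))

        -- The ratio of two coefficients, both satisfying y = κ σ(y), is fixed by σ.
        x-fixed : ∀ t → σ (x t) K.≈ x t
        x-fixed t = K.*-cancelˡ a a≉0 (≈K.begin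
          a K.* σ (x t) ≈K.≈⟨ K.*-congʳ (co-u-σ D) ⟩
          κ K.* σ a K.* σ (x t) ≈K.≈⟨ K.*-assoc _ _ _ ⟩
          κ K.* (σ a K.* σ (x t)) ≈K.≈⟨ K.*-congˡ (K.trans (K.sym (σ-* a (x t))) (σ-cong (ax t))) ⟩
          κ K.* σ (co u t) ≈K.≈⟨ co-u-σ t ⟨
          co u t ≈K.≈⟨ ax t ⟨
          a K.* x t ≈K.∎)

        module _ (zc : ℕ → k.Carrier) (zc-x : ∀ j → x (j ℕ.* n) K.≈ ι (zc j)) where

          zc-top : zc d k.≈ k.1#
          zc-top = G.ι-injective (≈K.begin
            ι (zc d) ≈K.≈⟨ zc-x d ⟨
            x (d ℕ.* n) ≈K.≡⟨ ≡.cong x D≡d*n ⟨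
            a K.⁻¹ K.* a ≈K.≈⟨ K.⁻¹-inverseˡ a≉0 ⟩
            K.1# ≈K.≈⟨ ι.1#-homo ⟨
            ι k.1# ≈K.∎)

          module _ (z : kP.Poly) (monic : kP.IsMonicOfDegree d z) (z≈zc : ∀ j → j ≤ d → kP.coeff z j k.≈ zc j) where

            co-z : ∀ j → Dec (j ≤ d) → co (C a * ev z) (j ℕ.* n) K.≈ co u (j ℕ.* n)
            co-z j (yes j≤d) = ≈K.begin
              co (C a * ev z) (j ℕ.* n) ≈K.≈⟨ co-C* a (ev z) (j ℕ.* n) ⟩
              a K.* co (ev z) (j ℕ.* n) ≈K.≈⟨ K.*-congˡ (co-ev d z d<s monic j) ⟩
              a K.* ι (kP.coeff z j) ≈K.≈⟨ K.*-congˡ (ι.⟦⟧-cong (z≈zc j j≤d)) ⟩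
              a K.* ι (zc j) ≈K.≈⟨ K.*-congˡ (zc-x j) ⟨
              a K.* x (j ℕ.* n) ≈K.≈⟨ ax (j ℕ.* n) ⟩
              co u (j ℕ.* n) ≈K.∎
            co-z j (no j≰d) = ≈K.begin
              co (C a * ev z) (j ℕ.* n) ≈K.≈⟨ co-C* a (ev z) (j ℕ.* n) ⟩
              a K.* co (ev z) (j ℕ.* n) ≈K.≈⟨ K.*-congˡ (co-ev d z d<s monic j) ⟩
              a K.* ι (kP.coeff z j) ≈K.≈⟨ K.*-congˡ (K.trans (ι.⟦⟧-cong (proj₂ monic j (ℕₚ.≰⇒> j≰d))) ι.0#-homo) ⟩
              a K.* K.0# ≈K.≈⟨ K.zeroʳ a ⟩
              K.0# ≈K.≈⟨ deg (j ℕ.* n) (≡.subst (_< j ℕ.* n) (≡.sym D≡d*n) (ℕₚ.*-monoˡ-< n (ℕₚ.≰⇒> j≰d))) ⟨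
              co u (j ℕ.* n) ≈K.∎

            same : ∀ t → Dec (t % n ≡ 0) → co (C a * ev z) t K.≈ co u t
            same t (yes t%n≡0) = ≡.subst (λ t → co (C a * ev z) t K.≈ co u t)
              (≡.sym (≡.trans (DivMod.m≡m%n+[m/n]*n t n) (≡.cong (ℕ._+ (t ℕ./ n) ℕ.* n) t%n≡0)))
              (co-z (t ℕ./ n) (t ℕ./ n ℕₚ.≤? d))
            same t (no t%n≢0) = ≈K.begin
              co (C a * ev z) t ≈K.≈⟨ co-C* a (ev z) t ⟩
              a K.* co (ev z) t ≈K.≈⟨ K.*-congˡ (co-ev-% d z d<s monic t t%n≢0) ⟩
              a K.* K.0# ≈K.≈⟨ K.zeroʳ a ⟩
              K.0# ≈K.≈⟨ Twists-vanish {0} u-twists t (λ p → t%n≢0 (≡.trans p (DivMod.m<n⇒m%n≡m 0<n))) ⟨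
              co u t ≈K.∎

            u≈ : u ≈ C a * ev z
            u≈ = co-injective u (C a * ev z) (λ t → K.sym (same t (t % n ℕₚ.≟ 0)))

          form : (∃ λ z → kP.IsMonicOfDegree d z × (∀ j → j ≤ d → kP.coeff z j k.≈ zc j)) →
                 ∃ λ d → ∃ λ z → ∃ λ a → d < s × kP.IsMonicOfDegree d z × ¬ (a K.≈ K.0#) × u ≈ C a * ev z
          form (z , monic , z≈zc) = d , z , a , d<s , monic , a≉0 , u≈ z monic z≈zc

    polynomial-form : ∃ λ d → ∃ λ z → ∃ λ a → d < s × kP.IsMonicOfDegree d z × ¬ (a K.≈ K.0#) × u ≈ C a * ev z
    polynomial-form = top (unit-leading N u u-unit (Deg<-N u))
      where
      top : (∃ λ D → D < N × ¬ (co u D K.≈ K.0#) × Deg< (suc D) u) →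
            ∃ λ d → ∃ λ z → ∃ λ a → d < s × kP.IsMonicOfDegree d z × ¬ (a K.≈ K.0#) × u ≈ C a * ev z
      top (D , D<N , a≉0 , deg) = form zc zc-x (monic-with-coefficients k.commutativeRing zc d (zc-top zc zc-x))
        where
        open Top D D<N a≉0 deg
        zc : ℕ → k.Carrier
        zc j = proj₁ (G.σ-fixed (x (j ℕ.* n)) (x-fixed (j ℕ.* n)))
        zc-x : ∀ j → x (j ℕ.* n) K.≈ ι (zc j)
        zc-x j = proj₂ (G.σ-fixed (x (j ℕ.* n)) (x-fixed (j ℕ.* n)))

  -- From b X^T h⁻¹ = g X^T: moving X^T to the front past the central z(Xⁿ) and the constant leaves
  -- the same z and i, with a′ determined by b σ^T(a′) = a.
  standard-right : ∀ g h h⁻¹ → h * h⁻¹ ≈ 1# → ∀ i d z a T b → ¬ (b K.≈ K.0#) → Standard g i d z a →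
    g * X ^ T * h ≈ C b * X ^ T → ∀ a′ → σ^ T a′ K.≈ b K.⁻¹ K.* a → Standard h⁻¹ i d z a′
  standard-right g h h⁻¹ hh⁻¹ i d z a T b b≉0 std wT a′ e = record
    { d<s = d<s ; monic = monic ; a≉0 = a′≉0
    ; form = cancelˡ (Unit-^ X-unit T) (cancelˡ (C-unit b≉0) (begin
        C b * (X ^ T * h⁻¹) ≈⟨ *-assoc _ _ _ ⟨
        C b * X ^ T * h⁻¹ ≈⟨ *-congʳ wT ⟨
        g * X ^ T * h * h⁻¹ ≈⟨ trans (*-assoc _ _ _) (trans (*-congˡ hh⁻¹) (*-identityʳ _)) ⟩
        g * X ^ T ≈⟨ *-congʳ form ⟩
        C a * ev z * X ^ i * X ^ T ≈⟨ trans (*-assoc _ _ _) (*-congˡ (trans (sym (^-homo-* X i T)) (trans (reflexive (≡.cong (X ^_) (ℕₚ.+-comm i T))) (^-homo-* X T i)))) ⟩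
        C a * ev z * (X ^ T * X ^ i) ≈⟨ trans (sym (*-assoc _ _ _)) (*-congʳ (trans (*-assoc _ _ _) (*-congˡ (ev-central z _)))) ⟩
        C a * (X ^ T * ev z) * X ^ i ≈⟨ *-congʳ (*-congʳ (trans (sym (C-* b (σ^ T a′))) (C-cong be))) ⟨
        C b * C (σ^ T a′) * (X ^ T * ev z) * X ^ i ≈⟨ solve *-monoid ⟩
        C b * (C (σ^ T a′) * X ^ T * (ev z * X ^ i)) ≈⟨ *-congˡ (*-congʳ (Twists-X^ T a′)) ⟨
        C b * (X ^ T * C a′ * (ev z * X ^ i)) ≈⟨ solve *-monoid ⟩
        C b * (X ^ T * (C a′ * ev z * X ^ i)) ∎)) }
    where
    open Standard std
    be : b K.* σ^ T a′ K.≈ a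
    be = K.trans (K.*-congˡ e)
      (K.trans (K.sym (K.*-assoc _ _ _)) (K.trans (K.*-congʳ (K.⁻¹-inverseʳ b≉0)) (K.*-identityˡ a)))
    a′≉0 : ¬ (a′ K.≈ K.0#)
    a′≉0 a′≈0 = a≉0 (K.trans (K.sym be) (K.trans (K.*-congˡ (K.trans (σ^-cong T a′≈0) (σ^-0 T))) (K.zeroʳ b)))

  -- The hypotheses say g S h = S.
  module _ (g h : Carrier) (g-unit : Unit g) (h-unit : Unit h)
    (fwd : ∀ c → S c → S (g * c * h)) (bwd : ∀ f → S f → ∃ λ c → S c × f ≈ g * c * h) where
    private
      g⁻¹ = proj₁ g-unit
      h⁻¹ = proj₁ h-unit
      g⁻¹g = proj₁ (proj₂ g-unit)
      h⁻¹h = proj₁ (proj₂ h-unit)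
      hh⁻¹ = proj₂ (proj₂ h-unit)

    abstract
      -- Each c in S is g c′ h with c′ in S, and then g a g⁻¹ c = g (a c′) h lies in S. So g a g⁻¹
      -- is in the left idealizer.
      g-twists : ∃ λ i → i < n × Twists i g
      g-twists = normalizer-twists g g⁻¹ g⁻¹g λ a → left-idealizer (g * C a * g⁻¹) λ c Sc →
        let c′ , Sc′ , e = bwd c Sc in Deg<-resp (begin
          g * (C a * c′) * h ≈⟨ *-congʳ (*-congˡ (*-congˡ (trans (*-congʳ g⁻¹g) (*-identityˡ c′)))) ⟨
          g * (C a * (g⁻¹ * g * c′)) * h ≈⟨ solve *-monoid ⟩
          g * C a * g⁻¹ * (g * c′ * h) ≈⟨ *-congˡ e ⟨
          g * C a * g⁻¹ * c ∎) (fwd (C a * c′) (Deg<-C* a Sc′))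

      -- S is stable under right multiplication by constants, so g c h a lies in S and equals g c′ h
      -- for some c′ in S. Cancelling gives c′ = c (h a h⁻¹).
      h-twists : ∃ λ j → j < n × Twists j h
      h-twists = normalizer-twists h h⁻¹ h⁻¹h λ a → right-idealizer (h * C a * h⁻¹) λ c Sc →
        let c′ , Sc′ , e = bwd (g * c * h * C a) (Deg<-*C a (fwd c Sc)) in
        Deg<-resp (cancelˡ g-unit (cancelʳ h-unit (begin
          g * c′ * h ≈⟨ e ⟨
          g * c * h * C a ≈⟨ trans (*-congˡ h⁻¹h) (*-identityʳ _) ⟨
          g * c * h * C a * (h⁻¹ * h) ≈⟨ solve *-monoid ⟩
          g * (c * (h * C a * h⁻¹)) * h ∎))) Sc′

  module _ (g h : Carrier) (g-unit : Unit g) (h-unit : Unit h)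
    (fwd : ∀ c → S c → S (g * c * h)) (bwd : ∀ f → S f → ∃ λ c → S c × f ≈ g * c * h)
    (i : ℕ) (i<n : i < n) (gα : Twists i g) (j : ℕ) (hα : Twists j h) where
    private
      g⁻¹ = proj₁ g-unit
      h⁻¹ = proj₁ h-unit
      g⁻¹g = proj₁ (proj₂ g-unit)
      hh⁻¹ = proj₂ (proj₂ h-unit)

      l = (i ℕ.+ j) % n

      l<n : l < n
      l<n = DivMod.m%n<n (i ℕ.+ j) n

      w : ℕ → Carrier
      w m = g * X ^ m * h

      w-twists : ∀ m → Twists (j ℕ.+ (m ℕ.+ i)) (w m)
      w-twists m = Twists-* {m ℕ.+ i} {j} (Twists-* {i} {m} gα (Twists-X^ m)) hα

      w-residue : ∀ m → (j ℕ.+ (m ℕ.+ i)) % n ≡ (m ℕ.+ l) % n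
      w-residue m = ≡.trans (≡.cong (_% n) (≡.trans (ℕₚ.+-comm j _) (ℕₚ.+-assoc m i j)))
        (≡.sym (%-+-distribˡ m (i ℕ.+ j) n))

      w-unit : ∀ m → Unit (w m)
      w-unit m = Unit-* (Unit-* g-unit (Unit-^ X-unit m)) h-unit

      w-shift : ∀ a m → w (a ℕ.* n ℕ.+ m) ≈ X ^ (a ℕ.* n) * w m
      w-shift a m = begin
        g * X ^ (a ℕ.* n ℕ.+ m) * h ≈⟨ *-congʳ (*-congˡ (^-homo-* X (a ℕ.* n) m)) ⟩
        g * (X ^ (a ℕ.* n) * X ^ m) * h ≈⟨ *-congʳ (*-assoc g _ _) ⟨
        g * X ^ (a ℕ.* n) * X ^ m * h ≈⟨ *-congʳ (*-congʳ (X^a*n-central a g)) ⟨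
        X ^ (a ℕ.* n) * g * X ^ m * h ≈⟨ trans (*-assoc _ _ h) (trans (*-assoc _ g _) (*-congˡ (sym (*-assoc g _ h)))) ⟩
        X ^ (a ℕ.* n) * (g * X ^ m * h) ∎

      abstract
        -- w_m is a unit, hence nonzero, and it lies in S.
        w-leading : ∀ m → m < M → ∃ λ D → D < M × ¬ (co (w m) D K.≈ K.0#) × Deg< (suc D) (w m)
        w-leading m m<M = unit-leading M (w m) (w-unit m) (fwd (X ^ m) (S-X^ m m<M))

      -- X^{T−D} w_m = w_{m+T−D} has degree T ≥ M, so m + T − D ≥ M.
      w-degree : ∀ m D T → D < M → ¬ (co (w m) D K.≈ K.0#) → Deg< (suc D) (w m) →
                 M ≤ T → T < N → T % n ≡ D % n → M ℕ.+ D ≤ m ℕ.+ T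
      w-degree m D T D<M ≉0 deg M≤T T<N T≡D with ≡-mod⇒+* n D T (ℕₚ.≤-trans (ℕₚ.<⇒≤ D<M) M≤T) T≡D
      ... | a , ≡.refl = ℕₚ.≮⇒≥ λ lt → σ^-≉0 (a ℕ.* n) ≉0 (≈K.begin
        σ^ (a ℕ.* n) (co (w m) D) ≈K.≈⟨ X^*-co deg (a ℕ.* n) bound D ⟨
        co (X ^ (a ℕ.* n) * w m) (a ℕ.* n ℕ.+ D) ≈K.≈⟨ co-cong (w-shift a m) _ ⟨
        co (w (a ℕ.* n ℕ.+ m)) (a ℕ.* n ℕ.+ D) ≈K.≈⟨ fwd _ (S-X^ _ (small lt)) _ M≤T ⟩
        K.0# ≈K.∎)
        where
        bound : a ℕ.* n ℕ.+ suc D ≤ N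
        bound = ≡.subst (_≤ N) (≡.sym (ℕₚ.+-suc (a ℕ.* n) D)) T<N
        small : m ℕ.+ (a ℕ.* n ℕ.+ D) < M ℕ.+ D → a ℕ.* n ℕ.+ m < M
        small lt = ℕₚ.+-cancelʳ-< D (a ℕ.* n ℕ.+ m) M (≡.subst (_< M ℕ.+ D)
          (≡.trans (≡.sym (ℕₚ.+-assoc m (a ℕ.* n) D)) (≡.cong (ℕ._+ D) (ℕₚ.+-comm m (a ℕ.* n)))) lt)

      -- T is any exponent in [M, N) in the residue class of w_m; the closer T is to M, the sharper
      -- the bound on D.
      w-bound : ∀ m T → m < M → M ≤ T → T < N → T % n ≡ (m ℕ.+ l) % n →
                ∃ λ D → ¬ (co (w m) D K.≈ K.0#) × Deg< (suc D) (w m) × D % n ≡ (m ℕ.+ l) % n × M ℕ.+ D ≤ m ℕ.+ T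
      w-bound m T m<M M≤T T<N T≡ with w-leading m m<M
      ... | D , D<M , ≉0 , deg = D , ≉0 , deg , D≡ , w-degree m D T D<M ≉0 deg M≤T T<N (≡.trans T≡ (≡.sym D≡))
        where
        D≡ : D % n ≡ (m ℕ.+ l) % n
        D≡ = ≡.trans (Twists-co (w-twists m) D ≉0) (w-residue m)

      -- D is at least its own residue T % n, so the bound D ≤ m + T - M cannot fall below that.
      w-impossible : ∀ m T → m < M → M ≤ T → T < N → T % n ≡ (m ℕ.+ l) % n → ¬ (m ℕ.+ T < M ℕ.+ T % n)
      w-impossible m T m<M M≤T T<N T≡ lt with w-bound m T m<M M≤T T<N T≡
      ... | D , _ , _ , D≡ , M+D≤ = ℕₚ.<⇒≱ lt (ℕₚ.≤-trans
        (ℕₚ.+-monoʳ-≤ M (≡.subst (_≤ D) (≡.trans D≡ (≡.sym T≡)) (DivMod.m%n≤m D n))) M+D≤)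

      Monomial : ℕ → ℕ → Set _
      Monomial m e = ∃ λ b → ¬ (b K.≈ K.0#) × w m ≈ C b * X ^ e

      -- Below T % n + n the residue class contains only T % n, so a single exponent is left for
      -- w_m.
      w-monomial : ∀ m T → m < M → M ≤ T → T < N → T % n ≡ (m ℕ.+ l) % n →
                   m ℕ.+ T < M ℕ.+ (T % n ℕ.+ n) → Monomial m (T % n)
      w-monomial m T m<M M≤T T<N T≡ lt with w-bound m T m<M M≤T T<N T≡
      ... | D , ≉0 , deg , D≡ , M+D≤ = co (w m) D , ≉0 , ≡.subst (λ t → w m ≈ C (co (w m) D) * X ^ t) D≡e (monomial (w m) D
          (ℕₚ.<-≤-trans D<n n≤N) vanish)
        where
        e = T % n
        D%n≡e : D % n ≡ e
        D%n≡e = ≡.trans D≡ (≡.sym T≡)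
        D<e+n : D < e ℕ.+ n
        D<e+n = ℕₚ.+-cancelˡ-< M D (e ℕ.+ n) (ℕₚ.≤-<-trans M+D≤ lt)
        D≡e : D ≡ e
        D≡e with ≡-mod⇒+* n e D (≡.subst (_≤ D) D%n≡e (DivMod.m%n≤m D n)) (≡.trans D%n≡e (≡.sym (DivMod.m%n%n≡m%n T n)))
        ... | zero  , p = p
        ... | suc a , p = ⊥-elim (ℕₚ.<⇒≱ D<e+n (ℕₚ.≤-trans (ℕₚ.≤-reflexive (ℕₚ.+-comm e n))
          (ℕₚ.≤-trans (ℕₚ.+-monoˡ-≤ e (ℕₚ.m≤m+n n (a ℕ.* n))) (ℕₚ.≤-reflexive (≡.sym p)))))
        D<n : D < n
        D<n = ≡.subst (_< n) (≡.sym D≡e) (DivMod.m%n<n T n)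
        vanish : ∀ t → t ≢ D → co (w m) t K.≈ K.0#
        vanish t t≢D with ℕₚ.<-cmp t D
        ... | Tri.tri≈ _ t≡D _ = ⊥-elim (t≢D t≡D)
        ... | Tri.tri> _ _ D<t = deg t D<t
        ... | Tri.tri< t<D _ _ = Twists-vanish (w-twists m) t λ p → t≢D (≡.trans (≡.sym (DivMod.m<n⇒m%n≡m (ℕₚ.<-trans t<D D<n)))
          (≡.trans (≡.trans p (w-residue m)) (≡.trans (≡.sym D≡) (DivMod.m<n⇒m%n≡m D<n))))

      -- Only a central factor is pulled out and no coordinate is read, so indices and exponents may
      -- go beyond M and N.
      Monomial-shift : ∀ a m e → Monomial m e → Monomial (a ℕ.* n ℕ.+ m) (a ℕ.* n ℕ.+ e)
      Monomial-shift a m e (b , b≉0 , p) = b , b≉0 , (begin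
        w (a ℕ.* n ℕ.+ m) ≈⟨ w-shift a m ⟩
        X ^ (a ℕ.* n) * w m ≈⟨ *-congˡ p ⟩
        X ^ (a ℕ.* n) * (C b * X ^ e) ≈⟨ *-assoc _ _ _ ⟨
        X ^ (a ℕ.* n) * C b * X ^ e ≈⟨ *-congʳ (X^a*n-central a (C b)) ⟩
        C b * X ^ (a ℕ.* n) * X ^ e ≈⟨ *-assoc _ _ _ ⟩
        C b * (X ^ (a ℕ.* n) * X ^ e) ≈⟨ *-congˡ (^-homo-* X (a ℕ.* n) e) ⟨
        C b * X ^ (a ℕ.* n ℕ.+ e) ∎)

      ψ : Carrier
      ψ = g * X * g⁻¹

      -- ψ w_m = w_{m+1}
      ψ-step : ∀ {m e e′} → Monomial m e → Monomial (suc m) e′ →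
               ∃ λ b → ∃ λ b′ → ¬ (b K.≈ K.0#) × ¬ (b′ K.≈ K.0#) × ψ * (C b * X ^ e) ≈ C b′ * X ^ e′
      ψ-step {m} {e} {e′} (b , b≉0 , p) (b′ , b′≉0 , p′) = b , b′ , b≉0 , b′≉0 , (begin
        g * X * g⁻¹ * (C b * X ^ e) ≈⟨ *-congˡ p ⟨
        g * X * g⁻¹ * (g * X ^ m * h) ≈⟨ solve *-monoid ⟩
        g * X * (g⁻¹ * g) * X ^ m * h ≈⟨ *-congʳ (*-congʳ (trans (*-congˡ g⁻¹g) (*-identityʳ _))) ⟩
        g * X * X ^ m * h ≈⟨ *-congʳ (*-assoc g X _) ⟩
        g * X ^ suc m * h ≈⟨ p′ ⟩
        C b′ * X ^ e′ ∎)

      -- X^e and b are cancelled on the right; bringing b⁻¹ to the front past X^e′ applies σ^e′ to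
      -- it.
      ψ-cancel : ∀ {b b′ e} e′ → ¬ (b K.≈ K.0#) → ¬ (b′ K.≈ K.0#) → ψ * (C b * X ^ e) ≈ C b′ * X ^ (e′ ℕ.+ e) →
                 ∃ λ κ → ¬ (κ K.≈ K.0#) × ψ ≈ C κ * X ^ e′
      ψ-cancel {b} {b′} {e} e′ b≉0 b′≉0 p = b′ K.* σ^ e′ (b K.⁻¹) , K.*-≉0 b′≉0 (σ^-≉0 e′ (K.⁻¹-≉0 b≉0)) , (begin
        ψ ≈⟨ trans (*-congˡ (trans (sym (C-* _ _)) (trans (C-cong (K.⁻¹-inverseʳ b≉0)) C-1))) (*-identityʳ ψ) ⟨
        ψ * (C b * C (b K.⁻¹)) ≈⟨ *-assoc _ _ _ ⟨
        ψ * C b * C (b K.⁻¹) ≈⟨ *-congʳ (cancelʳ (Unit-^ X-unit e) ψb) ⟩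
        C b′ * X ^ e′ * C (b K.⁻¹) ≈⟨ *-assoc _ _ _ ⟩
        C b′ * (X ^ e′ * C (b K.⁻¹)) ≈⟨ *-congˡ (Twists-X^ e′ (b K.⁻¹)) ⟩
        C b′ * (C (σ^ e′ (b K.⁻¹)) * X ^ e′) ≈⟨ *-assoc _ _ _ ⟨
        C b′ * C (σ^ e′ (b K.⁻¹)) * X ^ e′ ≈⟨ *-congʳ (C-* _ _) ⟨
        C (b′ K.* σ^ e′ (b K.⁻¹)) * X ^ e′ ∎)
        where
        ψb : ψ * C b * X ^ e ≈ C b′ * X ^ e′ * X ^ e
        ψb = begin
          ψ * C b * X ^ e ≈⟨ *-assoc _ _ _ ⟩
          ψ * (C b * X ^ e) ≈⟨ p ⟩
          C b′ * X ^ (e′ ℕ.+ e) ≈⟨ *-congˡ (^-homo-* X e′ e) ⟩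
          C b′ * (X ^ e′ * X ^ e) ≈⟨ *-assoc _ _ _ ⟨
          C b′ * X ^ e′ * X ^ e ∎

      ψ-monomial : ∀ m e e′ → Monomial m e → Monomial (suc m) (e′ ℕ.+ e) → ∃ λ κ → ¬ (κ K.≈ K.0#) × ψ ≈ C κ * X ^ e′
      ψ-monomial m e e′ mono mono′ with ψ-step {m} {e} {e′ ℕ.+ e} mono mono′
      ... | b , b′ , b≉0 , b′≉0 , p = ψ-cancel {b} {b′} {e} e′ b≉0 b′≉0 p

      -- When the exponent returns to 0, the equation ψ w_m = w_(m+1) reads κ X^e′ b X^e = b′, so
      -- X^(e′+e) is a constant.
      ψ-wrap : ∀ κ m e e′ → ¬ (κ K.≈ K.0#) → ψ ≈ C κ * X ^ e′ → Monomial m e → Monomial (suc m) 0 → ∃ λ ν → ¬ (ν K.≈ K.0#) × X ^ (e′ ℕ.+ e) ≈ C ν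
      ψ-wrap κ m e e′ κ≉0 ψ≈ mono mono′ with ψ-step {m} {e} {0} mono mono′
      ... | b , b′ , b≉0 , b′≉0 , p = ν K.⁻¹ K.* b′ , K.*-≉0 (K.⁻¹-≉0 ν≉0) b′≉0 , cancelˡ (C-unit ν≉0) (begin
        C ν * X ^ (e′ ℕ.+ e) ≈⟨ *-cong (C-* _ _) (^-homo-* X e′ e) ⟩
        C κ * C (σ^ e′ b) * (X ^ e′ * X ^ e) ≈⟨ *-assoc _ _ _ ⟩
        C κ * (C (σ^ e′ b) * (X ^ e′ * X ^ e)) ≈⟨ *-congˡ (trans (sym (*-assoc _ _ _)) (*-congʳ (sym (Twists-X^ e′ b)))) ⟩
        C κ * (X ^ e′ * C b * X ^ e) ≈⟨ trans (*-congˡ (*-assoc _ _ _)) (sym (*-assoc _ _ _)) ⟩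
        C κ * X ^ e′ * (C b * X ^ e) ≈⟨ *-congʳ ψ≈ ⟨
        ψ * (C b * X ^ e) ≈⟨ p ⟩
        C b′ * 1# ≈⟨ *-identityʳ _ ⟩
        C b′ ≈⟨ C-cong (K.trans (K.sym (K.*-assoc _ _ _)) (K.trans (K.*-congʳ (K.⁻¹-inverseʳ ν≉0)) (K.*-identityˡ b′))) ⟨
        C (ν K.* (ν K.⁻¹ K.* b′)) ≈⟨ C-* _ _ ⟩
        C ν * C (ν K.⁻¹ K.* b′) ∎)
        where
        ν = κ K.* σ^ e′ b
        ν≉0 : ¬ (ν K.≈ K.0#)
        ν≉0 = K.*-≉0 κ≉0 (σ^-≉0 e′ b≉0)

      X^-nonconstant : ∀ e ν → 0 < e → e < N → ¬ (ν K.≈ K.0#) → ¬ (X ^ e ≈ C ν)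
      X^-nonconstant e ν 0<e e<N ν≉0 p = ν≉0 (≈K.begin
        ν ≈K.≈⟨ co-C-zero ν ⟨
        co (C ν) 0 ≈K.≈⟨ co-cong p 0 ⟨
        co (X ^ e) 0 ≈K.≈⟨ co-cong (trans (*-congʳ C-1) (*-identityˡ _)) 0 ⟨
        co (C K.1# * X ^ e) 0 ≈K.≈⟨ co-monomial-≢ K.1# e e<N 0 (ℕₚ.<⇒≢ 0<e) ⟩
        K.0# ≈K.∎)

      residue-small : ∀ {t} → t < n → t % n ≡ t
      residue-small = DivMod.m<n⇒m%n≡m

      residue-+* : ∀ t a → (t ℕ.+ a ℕ.* n) % n ≡ t % n
      residue-+* t a = DivMod.[m+kn]%n≡m%n t a n

      M≡ : M ≡ M % n ℕ.+ (M ℕ./ n) ℕ.* n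
      M≡ = DivMod.m≡m%n+[m/n]*n M n

      Aₘ = M ℕ./ n
      Bₘ = M % n

      -- The block of n consecutive exponents that contains M ends below N, since M < N = s n.
      block : ∀ t → t < n → t ℕ.+ Aₘ ℕ.* n < N
      block t t<n = ℕₚ.<-≤-trans (ℕₚ.+-monoˡ-< (Aₘ ℕ.* n) t<n) (ℕₚ.*-monoˡ-≤ n A<s)
        where
        A<s : Aₘ < s
        A<s = ℕₚ.*-cancelʳ-< n Aₘ s (ℕₚ.≤-<-trans (DivMod.m/n*n≤m M n) M<N)

      module _ (0<l : 0 < l) where
        -- Suppose M has positive residue Bₘ. If l ≤ Bₘ, then m = Bₘ - l and T = M give degree at
        -- most Bₘ - l in the class of Bₘ. If l > Bₘ, then m = 0 and T = l + Aₘ n give degree at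
        -- most l - Bₘ in the class of l. Both bounds are below the residue.
        B≡0 : Bₘ ≡ 0
        B≡0 with Bₘ ℕₚ.≟ 0
        ... | yes e = e
        ... | no B≢0 with l ℕₚ.≤? Bₘ
        ...   | yes l≤B = ⊥-elim (w-impossible (Bₘ ℕ.∸ l) M
                  (ℕₚ.<-≤-trans (ℕₚ.∸-monoʳ-< {Bₘ} {l} {0} 0<l l≤B) (DivMod.m%n≤m M n)) ℕₚ.≤-refl M<N
                  (≡.sym (≡.trans (≡.cong (_% n) (ℕₚ.m∸n+n≡m l≤B)) (DivMod.m%n%n≡m%n M n)))
                  (≡.subst (_< M ℕ.+ Bₘ) (ℕₚ.+-comm M _) (ℕₚ.+-monoʳ-< M (ℕₚ.∸-monoʳ-< {Bₘ} {l} {0} 0<l l≤B))))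
        ...   | no l≰B = ⊥-elim (w-impossible 0 (l ℕ.+ Aₘ ℕ.* n) 1≤M
                  (ℕₚ.≤-trans (ℕₚ.≤-reflexive M≡) (ℕₚ.+-monoˡ-≤ (Aₘ ℕ.* n) (ℕₚ.<⇒≤ (ℕₚ.≰⇒> l≰B))))
                  (block l l<n) (residue-+* l Aₘ)
                  (≡.subst (λ t → l ℕ.+ Aₘ ℕ.* n < M ℕ.+ t) (≡.sym (≡.trans (residue-+* l Aₘ) (residue-small l<n)))
                    (≡.subst (_< M ℕ.+ l) (ℕₚ.+-comm (Aₘ ℕ.* n) l) (ℕₚ.+-monoˡ-< l
                      (≡.subst (Aₘ ℕ.* n <_) (≡.sym M≡) (ℕₚ.m<n+m (Aₘ ℕ.* n) (ℕₚ.n≢0⇒n>0 B≢0)))))))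

        M≡A*n : M ≡ Aₘ ℕ.* n
        M≡A*n = ≡.trans M≡ (≡.cong (ℕ._+ Aₘ ℕ.* n) B≡0)

        n≤M : n ≤ M
        n≤M with Aₘ in eq
        ... | zero  = ⊥-elim (ℕₚ.<⇒≱ 1≤M (ℕₚ.≤-reflexive (≡.trans M≡A*n (≡.cong (ℕ._* n) eq))))
        ... | suc a = ≡.subst (n ≤_) (≡.sym (≡.trans M≡A*n (≡.cong (ℕ._* n) eq))) (ℕₚ.m≤m+n n (a ℕ.* n))

        -- Now n divides M, and T = e + M with e the residue of m + l gives degree at most m + e < n
        -- + e.
        mono : ∀ m → m < n → Monomial m ((m ℕ.+ l) % n)
        mono m m<n = ≡.subst (Monomial m) T%n (w-monomial m T (ℕₚ.<-≤-trans m<n n≤M)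
          (≡.subst (_≤ T) (≡.sym M≡A*n) (ℕₚ.m≤n+m (Aₘ ℕ.* n) e)) (block e e<n) T%n
          (≡.subst₂ _<_ (≡.trans (≡.cong (m ℕ.+_) (≡.cong (e ℕ.+_) M≡A*n)) ≡.refl) (≡.cong (λ t → M ℕ.+ (t ℕ.+ n)) (≡.sym T%n)) bound))
          where
          e = (m ℕ.+ l) % n
          e<n = DivMod.m%n<n (m ℕ.+ l) n
          T = e ℕ.+ Aₘ ℕ.* n
          T%n : T % n ≡ e
          T%n = ≡.trans (residue-+* e Aₘ) (residue-small e<n)
          bound : m ℕ.+ (e ℕ.+ M) < M ℕ.+ (e ℕ.+ n)
          bound = ≡.subst₂ _<_
            (≡.trans (≡.cong (ℕ._+ m) (ℕₚ.+-comm M e)) (ℕₚ.+-comm (e ℕ.+ M) m))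
            (ℕₚ.+-assoc M e n)
            (ℕₚ.+-monoʳ-< (M ℕ.+ e) m<n)

        mono-at : ∀ m e → m < n → (m ℕ.+ l) % n ≡ e → Monomial m e
        mono-at m e m<n ≡.refl = mono m m<n

        -- For n ≥ 3 some step m → m+1 does not wrap around modulo n.
        3≤n⇒⊥ : 3 ≤ n → ⊥
        3≤n⇒⊥ 3≤n = let ν , ν≉0 , eq = ψ-wrap (proj₁ ψ≈) p (n ℕ.∸ 1) 1 (proj₁ (proj₂ ψ≈)) (proj₂ (proj₂ ψ≈)) last first in
          X^-nonconstant (1 ℕ.+ (n ℕ.∸ 1)) ν (s≤s z≤n) (≡.subst (_< N) (≡.sym 1+n-1) n<N) ν≉0 eq
          where
          1+n-1 : suc (n ℕ.∸ 1) ≡ n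
          1+n-1 = ℕₚ.m+[n∸m]≡n 0<n
          n<N : n < N
          n<N = ℕₚ.<-≤-trans (ℕₚ.m<m+n n 0<n) (ℕₚ.≤-trans (ℕₚ.≤-reflexive (≡.cong (n ℕ.+_) (≡.sym (ℕₚ.+-identityʳ n)))) (ℕₚ.*-monoˡ-≤ n 2≤s))
          -- The index at which m + l wraps around: w_p has exponent n - 1 and the next one exponent
          -- 0.
          p = n ℕ.∸ suc l
          p+l : suc (p ℕ.+ l) ≡ n
          p+l = ≡.trans (≡.sym (ℕₚ.+-suc p l)) (ℕₚ.m∸n+n≡m l<n)
          p<n : suc p < n
          p<n = ≡.subst (suc p <_) p+l (s≤s (ℕₚ.m<m+n p 0<l))
          last : Monomial p (n ℕ.∸ 1)
          last = mono-at p (n ℕ.∸ 1) (ℕₚ.<⇒≤ p<n) (≡.trans (residue-small (≡.subst (p ℕ.+ l <_) p+l ℕₚ.≤-refl)) (≡.cong (ℕ._∸ 1) p+l))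
          first : Monomial (suc p) 0
          first = mono-at (suc p) 0 p<n (≡.trans (≡.cong (_% n) p+l) (DivMod.n%n≡0 n))
          ψ≈ : ∃ λ κ → ¬ (κ K.≈ K.0#) × ψ ≈ C κ * X ^ 1
          -- The step from w₀ to w₁ raises the exponent from l to l + 1 unless l = n - 1. In that
          -- case the step from w₁ to w₂ raises it from 0 to 1, and 2 < n.
          ψ≈ with suc l ℕₚ.<? n
          ... | yes l+1<n = ψ-monomial 0 l 1 (mono-at 0 l 0<n (residue-small l<n)) (mono-at 1 (suc l) 2≤n (residue-small l+1<n))
          ... | no ¬l+1<n = ψ-monomial 1 0 1 (mono-at 1 0 2≤n (≡.trans (≡.cong (_% n) 1+l≡n) (DivMod.n%n≡0 n)))
                              (mono-at 2 1 3≤n (≡.trans (≡.cong (_% n) (≡.cong suc 1+l≡n)) (DivMod.[m+n]%n≡m%n 1 n ⊙ residue-small 2≤n)))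
            where
            1+l≡n : suc l ≡ n
            1+l≡n = ℕₚ.≤-antisym l<n (ℕₚ.≮⇒≥ ¬l+1<n)
            _⊙_ : ∀ {a b c : ℕ} → a ≡ b → b ≡ c → a ≡ c
            _⊙_ = ≡.trans

        -- Here l = 1, so w₀, w₁ and w₂ = X² w₀ have exponents 1, 0 and 3. The step from w₁ to w₂
        -- gives ψ = κ X³, and then the step from w₀ to w₁ makes X⁴ constant. This is excluded for s
        -- = 2; for s ≥ 3 it is absurd because N ≥ 6.
        2≡n⇒⊥ : n ≡ 2 → ⊥
        2≡n⇒⊥ n≡2 = go (s ℕₚ.≟ 2)
          where
          l≡1 : l ≡ 1
          l≡1 = ℕₚ.≤-antisym (ℕₚ.≤-pred (≡.subst (l <_) n≡2 l<n)) 0<l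
          1+l≡n : suc l ≡ n
          1+l≡n = ≡.trans (≡.cong suc l≡1) (≡.sym n≡2)
          m₀ : Monomial 0 1
          m₀ = mono-at 0 1 0<n (≡.trans (residue-small l<n) l≡1)
          m₁ : Monomial 1 0
          m₁ = mono-at 1 0 2≤n (≡.trans (≡.cong (_% n) 1+l≡n) (DivMod.n%n≡0 n))
          m₂ : Monomial 2 3
          m₂ = ≡.subst₂ Monomial (≡.cong (λ t → 1 ℕ.* t ℕ.+ 0) n≡2) (≡.cong (λ t → 1 ℕ.* t ℕ.+ 1) n≡2) (Monomial-shift 1 0 1 m₀)
          ψ≈ = ψ-monomial 1 0 3 m₁ m₂
          X⁴ = ψ-wrap (proj₁ ψ≈) 0 1 3 (proj₁ (proj₂ ψ≈)) (proj₂ (proj₂ ψ≈)) m₀ m₁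
          go : Dec (s ≡ 2) → ⊥
          go (yes s≡2) = excluded n≡2 s≡2 _ (proj₂ (proj₂ X⁴))
          go (no s≢2)  = X^-nonconstant 4 _ (s≤s z≤n) (ℕₚ.≤-trans (ℕₚ.n≤1+n 5) (ℕₚ.*-mono-≤ (ℕₚ.≤∧≢⇒< 2≤s (s≢2 ∘ ≡.sym)) 2≤n))
            (proj₁ (proj₂ X⁴)) (proj₂ (proj₂ X⁴))

        impossible : ⊥
        impossible with n ℕₚ.≟ 2
        ... | yes n≡2 = 2≡n⇒⊥ n≡2
        ... | no  n≢2 = 3≤n⇒⊥ (ℕₚ.≤∧≢⇒< 2≤n (n≢2 ∘ ≡.sym))

      l≡0 : l ≡ 0
      l≡0 with l ℕₚ.≟ 0
      ... | yes e = e
      ... | no l≢0 = ⊥-elim (impossible (ℕₚ.n≢0⇒n>0 l≢0))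

      -- Let m be the residue of T. As l = 0 and T < M + n, the bound leaves only the exponent m for
      -- w_m, and a power of Xⁿ carries both m's to T. The index T lies outside the range of S.
      diagonal : ∀ T → M ≤ T → T < N → T % n < M → T < M ℕ.+ n → Monomial T T
      diagonal T M≤T T<N m<M T<M+n = ≡.subst (λ t → Monomial t t) (≡.trans (ℕₚ.+-comm ((T ℕ./ n) ℕ.* n) (T % n)) (≡.sym (DivMod.m≡m%n+[m/n]*n T n)))
        (Monomial-shift (T ℕ./ n) (T % n) (T % n) (w-monomial (T % n) T m<M M≤T T<N
          (≡.sym (≡.trans (≡.cong (λ t → (T % n ℕ.+ t) % n) l≡0) (≡.trans (≡.cong (_% n) (ℕₚ.+-identityʳ (T % n))) (DivMod.m%n%n≡m%n T n))))
          (≡.subst (T % n ℕ.+ T <_) swap (ℕₚ.+-monoʳ-< (T % n) T<M+n))))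
        where
        swap : T % n ℕ.+ (M ℕ.+ n) ≡ M ℕ.+ (T % n ℕ.+ n)
        swap = ≡.trans (≡.sym (ℕₚ.+-assoc (T % n) M n)) (≡.trans (≡.cong (ℕ._+ n) (ℕₚ.+-comm (T % n) M)) (ℕₚ.+-assoc M (T % n) n))

      abstract
        -- The residues of T and T + 1 have to be below M. For n ≤ M this is automatic, and T = M is
        -- taken. Otherwise T = n gives the residues 0 and 1, which are below M because M ≥ 2.
        diagonals : ∃ λ T → Monomial T T × Monomial (suc T) (suc T)
        diagonals with n ℕₚ.≤? M
        ... | yes n≤M = M ,
          diagonal M ℕₚ.≤-refl M<N (ℕₚ.<-≤-trans (DivMod.m%n<n M n) n≤M) (ℕₚ.m<m+n M 0<n) ,
          diagonal (suc M) (ℕₚ.n≤1+n M) M+2≤N (ℕₚ.<-≤-trans (DivMod.m%n<n (suc M) n) n≤M)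
            (ℕₚ.≤-trans (ℕₚ.≤-reflexive (ℕₚ.+-comm 2 M)) (ℕₚ.+-monoʳ-≤ M 2≤n))
        ... | no n≰M = n ,
          diagonal n (ℕₚ.<⇒≤ M<n) n<N (≡.subst (_< M) (≡.sym (DivMod.n%n≡0 n)) 1≤M) (ℕₚ.m<n+m n 1≤M) ,
          diagonal (suc n) (ℕₚ.<⇒≤ (ℕₚ.m<n⇒m<1+n M<n)) (ℕₚ.≤-trans (ℕₚ.+-monoˡ-≤ n 2≤n) 2n≤N)
            (≡.subst (_< M) (≡.sym (≡.trans (DivMod.[m+n]%n≡m%n 1 n) (residue-small 2≤n))) 2≤M)
            (ℕₚ.+-monoˡ-≤ n 2≤M)
          where
          M<n : M < n
          M<n = ℕₚ.≰⇒> n≰M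
          2n≤N : n ℕ.+ n ≤ N
          2n≤N = ℕₚ.≤-trans (ℕₚ.≤-reflexive (≡.cong (n ℕ.+_) (≡.sym (ℕₚ.+-identityʳ n)))) (ℕₚ.*-monoˡ-≤ n 2≤s)
          n<N : n < N
          n<N = ℕₚ.<-≤-trans (ℕₚ.m<m+n n 0<n) 2n≤N

      abstract
        κ-twist : ∃ λ κ → g * X ≈ C κ * X * g
        κ-twist = let T , t , t′ = diagonals in twist (ψ-monomial T T 1 t t′)
          where
          twist : (∃ λ κ → ¬ (κ K.≈ K.0#) × ψ ≈ C κ * X ^ 1) → ∃ λ κ → g * X ≈ C κ * X * g
          twist (κ , _ , ψ≈) = κ , (begin
            g * X ≈⟨ trans (*-congˡ g⁻¹g) (*-identityʳ _) ⟨
            g * X * (g⁻¹ * g) ≈⟨ *-assoc _ _ _ ⟨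
            g * X * g⁻¹ * g ≈⟨ *-congʳ ψ≈ ⟩
            C κ * (X * 1#) * g ≈⟨ *-congʳ (*-congˡ (*-identityʳ X)) ⟩
            C κ * X * g ∎)

      Xⁱ = Unit-^ X-unit i
      -- `proj₁ Xⁱ` is the inverse of X^i, so conjugation by u will be trivial on K.
      u = g * proj₁ Xⁱ

      g≈uXⁱ : g ≈ u * X ^ i
      g≈uXⁱ = sym (trans (*-assoc _ _ _) (trans (*-congˡ (proj₁ (proj₂ Xⁱ))) (*-identityʳ g)))

      u-unit : Unit u
      u-unit = Unit-* g-unit (X ^ i , proj₂ (proj₂ Xⁱ) , proj₁ (proj₂ Xⁱ))

      u-twists : Twists 0 u
      u-twists a with σ^-surjective i a
      ... | b , e = cancelʳ (Unit-^ X-unit i) (begin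
        u * C a * X ^ i ≈⟨ *-congʳ (*-congˡ (C-cong e)) ⟨
        u * C (σ^ i b) * X ^ i ≈⟨ *-assoc _ _ _ ⟩
        u * (C (σ^ i b) * X ^ i) ≈⟨ *-congˡ (Twists-X^ i b) ⟨
        u * (X ^ i * C b) ≈⟨ *-assoc _ _ _ ⟨
        u * X ^ i * C b ≈⟨ *-congʳ g≈uXⁱ ⟨
        g * C b ≈⟨ gα b ⟩
        C (σ^ i b) * g ≈⟨ *-cong (C-cong e) g≈uXⁱ ⟩
        C a * (u * X ^ i) ≈⟨ *-assoc _ _ _ ⟨
        C a * u * X ^ i ∎)

      κ = proj₁ κ-twist

      uX : u * X ≈ C κ * (X * u)
      uX = cancelʳ (Unit-^ X-unit i) (begin
        u * X * X ^ i ≈⟨ *-assoc u X _ ⟩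
        u * X ^ suc i ≈⟨ *-congˡ (X^-comm i) ⟨
        u * (X ^ i * X) ≈⟨ *-assoc u _ X ⟨
        u * X ^ i * X ≈⟨ *-congʳ g≈uXⁱ ⟨
        g * X ≈⟨ proj₂ κ-twist ⟩
        C κ * X * g ≈⟨ *-congˡ g≈uXⁱ ⟩
        C κ * X * (u * X ^ i) ≈⟨ trans (sym (*-assoc _ _ _)) (*-congʳ (*-assoc _ _ _)) ⟩
        C κ * (X * u) * X ^ i ∎)
        where
        X^-comm : ∀ i → X ^ i * X ≈ X * X ^ i
        X^-comm zero    = trans (*-identityˡ X) (sym (*-identityʳ X))
        X^-comm (suc i) = trans (*-assoc X _ X) (*-congˡ (X^-comm i))

      u-form : ∃ λ d → ∃ λ z → ∃ λ a → d < s × kP.IsMonicOfDegree d z × ¬ (a K.≈ K.0#) × u ≈ C a * ev z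
      u-form = polynomial-form u κ u-unit u-twists uX

      conclude : (∃ λ d → ∃ λ z → ∃ λ a → d < s × kP.IsMonicOfDegree d z × ¬ (a K.≈ K.0#) × u ≈ C a * ev z) →
                 (∃ λ T → Monomial T T × Monomial (suc T) (suc T)) →
                 ∃ λ d → ∃ λ z → ∃ λ a → ∃ λ b → Standard g i d z a × Standard h⁻¹ i d z b
      conclude (d , z , a , d<s , monic , a≉0 , u≈) (T , (b , b≉0 , wT) , _) =
        d , z , a , proj₁ std , g-std , proj₂ std
        where
        g-std : Standard g i d z a
        g-std = record { d<s = d<s ; monic = monic ; a≉0 = a≉0 ; form = trans g≈uXⁱ (*-congʳ u≈) }
        std : ∃ λ b → Standard h⁻¹ i d z b
        std = let a′ , e = σ^-surjective T (b K.⁻¹ K.* a) in a′ , standard-right g h h⁻¹ hh⁻¹ i d z a T b b≉0 g-std wT a′ e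

    abstract
      standard-form : ∃ λ d → ∃ λ z → ∃ λ a → ∃ λ b → Standard g i d z a × Standard h⁻¹ i d z b
      standard-form = conclude u-form diagonals

  standard : ∀ g h (g-unit : Unit g) (h-unit : Unit h) → (∀ c → S c → S (g * c * h)) →
    (∀ f → S f → ∃ λ c → S c × f ≈ g * c * h) →
    ∃ λ i → i < n × ∃ λ d → ∃ λ z → ∃ λ a → ∃ λ b → Standard g i d z a × Standard (proj₁ h-unit) i d z b
  standard g h g-unit h-unit fwd bwd = build (g-twists g h g-unit h-unit fwd bwd) (h-twists g h g-unit h-unit fwd bwd)
    where
    build : (∃ λ i → i < n × Twists i g) → (∃ λ j → j < n × Twists j h) →
            ∃ λ i → i < n × ∃ λ d → ∃ λ z → ∃ λ a → ∃ λ b → Standard g i d z a × Standard (proj₁ h-unit) i d z b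
    build (i , i<n , gα) (j , _ , hα) = i , i<n , standard-form g h g-unit h-unit fwd bwd i i<n gα j hα

-- The number of monic polynomials of degree below s.

geometric : ℕ → ℕ → ℕ
geometric q zero    = 0
geometric q (suc s) = geometric q s ℕ.+ q ℕ.^ s

geometric-sum : ∀ q s → 1 ≤ q → geometric q s ℕ.* (q ℕ.∸ 1) ≡ q ℕ.^ s ℕ.∸ 1
geometric-sum (suc p) s _ = ≡.trans (≡.sym (ℕₚ.m+n∸m≡n 1 _)) (≡.cong (ℕ._∸ 1) (go s))
  where
  open ≡.≡-Reasoning
  go : ∀ s → suc (geometric (suc p) s ℕ.* p) ≡ suc p ℕ.^ s
  go zero    = ≡.refl
  go (suc s) = begin
    suc ((geometric (suc p) s ℕ.+ suc p ℕ.^ s) ℕ.* p) ≡⟨ ≡.cong suc (ℕₚ.*-distribʳ-+ p (geometric (suc p) s) _) ⟩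
    suc (geometric (suc p) s ℕ.* p) ℕ.+ suc p ℕ.^ s ℕ.* p ≡⟨ ≡.cong₂ ℕ._+_ (go s) (ℕₚ.*-comm (suc p ℕ.^ s) p) ⟩
    suc p ℕ.^ s ℕ.+ p ℕ.* suc p ℕ.^ s ∎

module MonicCount {c ℓ q} (k : FiniteField c ℓ q) where
  open FiniteField k hiding (zero)
  open Polynomial rawRing

  MonicBelow : ℕ → Set _
  MonicBelow s = Σ[ z ∈ Poly ] ∃ λ d → d < s × IsMonicOfDegree d z

  -- The polynomial determines its degree, so the degree is not compared.
  _≈ₘ_ : ∀ {s} → Rel (MonicBelow s) ℓ
  z ≈ₘ w = proj₁ z ≈ₚ proj₁ w

  ≈ₚ-isEquivalence : IsEquivalence _≈ₚ_
  ≈ₚ-isEquivalence = record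
    { refl = λ _ → refl ; sym = λ e i → sym (e i) ; trans = λ e e′ i → trans (e i) (e′ i) }

  ≈ₘ-isEquivalence : ∀ {s} → IsEquivalence (_≈ₘ_ {s})
  ≈ₘ-isEquivalence = On.isEquivalence proj₁ ≈ₚ-isEquivalence

  monic-degree-unique : ∀ {d e} z w → IsMonicOfDegree d z → IsMonicOfDegree e w → z ≈ₚ w → d ≡ e
  monic-degree-unique {d} {e} z w (zd , dz) (we , dw) z≈w with ℕₚ.<-cmp d e
  ... | Tri.tri< d<e _ _ = ⊥-elim (0≉1 (trans (sym (dz e d<e)) (trans (z≈w e) we)))
  ... | Tri.tri≈ _ d≡e _ = d≡e
  ... | Tri.tri> _ _ e<d = ⊥-elim (0≉1 (trans (sym (dw d e<d)) (trans (sym (z≈w d)) zd)))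

  private
    monic : ∀ {d} → Vec Carrier d → Poly
    monic []      = 1# ∷ []
    monic (a ∷ v) = a ∷ monic v

    monic-monic : ∀ {d} (v : Vec Carrier d) → IsMonicOfDegree d (monic v)
    monic-monic []      = refl , λ { (suc i) _ → refl }
    monic-monic (a ∷ v) = proj₁ (monic-monic v) , λ { (suc i) (s≤s p) → proj₂ (monic-monic v) i p }

    monic-cong : ∀ {d} {v w : Vec Carrier d} → VecPointwise.Pointwise _≈_ v w → monic v ≈ₚ monic w
    monic-cong []       i       = refl
    monic-cong (e ∷ es) zero    = e
    monic-cong (e ∷ es) (suc i) = monic-cong es i

    monic-injective : ∀ {d} (v w : Vec Carrier d) → monic v ≈ₚ monic w → VecPointwise.Pointwise _≈_ v w
    monic-injective []      []      e = []
    monic-injective (a ∷ v) (b ∷ w) e = e 0 ∷ monic-injective v w (e ∘ suc)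

    monic-surjective : ∀ d z → IsMonicOfDegree d z → ∃ λ (v : Vec Carrier d) → monic v ≈ₚ z
    monic-surjective zero    z       (l , dz) = [] , λ { zero → sym l ; (suc i) → sym (dz (suc i) (s≤s z≤n)) }
    monic-surjective (suc d) []      (l , dz) = ⊥-elim (0≉1 l)
    monic-surjective (suc d) (a ∷ z) (l , dz) with monic-surjective d z (l , λ i p → dz (suc i) (s≤s p))
    ... | v , e = a ∷ v , λ { zero → refl ; (suc i) → e i }

  -- Each degree d < s contributes the q^d choices of lower coefficients, which are the summands of
  -- `geometric`.
  MonicBelow-cardinality : ∀ s → HasCardinality (MonicBelow s) _≈ₘ_ (geometric q s)
  MonicBelow-cardinality zero    = (λ ()) , (λ { {()} }) , λ { (_ , _ , () , _) }
  MonicBelow-cardinality (suc s) =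
    ⊎-cardinality (≈ₘ-isEquivalence {s}) (VecPointwise.isEquivalence isEquivalence s) (≈ₘ-isEquivalence {suc s})
      (MonicBelow-cardinality s) (Vec-cardinality isEquivalence cardinality s)
      (λ (z , d , d<s , m) → z , d , ℕₚ.m<n⇒m<1+n d<s , m)
      (λ v → monic v , s , ℕₚ.≤-refl , monic-monic v)
      id id monic-cong (monic-injective _ _)
      (λ { {z , d , d<s , m} {v} e → ℕₚ.<⇒≢ d<s (monic-degree-unique z (monic v) m (monic-monic v) e) })
      cover
    where
    cover : ∀ (z : MonicBelow (suc s)) → (∃ λ (w : MonicBelow s) → proj₁ w ≈ₚ proj₁ z) ⊎ (∃ λ v → monic v ≈ₚ proj₁ z)
    cover (z , d , d<1+s , m) with d ℕₚ.≟ s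
    ... | yes ≡.refl = inj₂ (monic-surjective d z m)
    ... | no d≢s     = inj₁ ((z , d , ℕₚ.≤∧≢⇒< (ℕₚ.≤-pred d<1+s) d≢s , m) , λ _ → refl)

-- The parameters of an automorphism and their number.

module AutomorphismCount {c₁ ℓ₁ c₂ ℓ₂ c ℓ} {q n s : ℕ} .{{nz : NonZero n}}
  (2≤q : 2 ≤ q) (2≤n : 2 ≤ n) (2≤s : 2 ≤ s)
  (k : FiniteField c₁ ℓ₁ q) (K : FiniteField c₂ ℓ₂ (q ℕ.^ n))
  (ι : FiniteField.Carrier k → FiniteField.Carrier K) (ι-hom : IsExtension k K ι)
  (σ : FiniteField.Carrier K → FiniteField.Carrier K) (gen : GeneratesGaloisGroup k K ι σ)
  (A : SkewQuotientRing k K ι σ n s c ℓ)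
  (excluded : n ≡ 2 → s ≡ 2 → ∀ ν → ¬ SkewQuotientRing._≈_ A (SkewQuotientRing._^_ A (SkewQuotientRing.X A) 4) (SkewQuotientRing.C A ν))
  (M : ℕ) (2≤M : 2 ≤ M) (M+2≤N : 2 ℕ.+ M ≤ s ℕ.* n)
  where
  open Automorphism 2≤q 2≤n 2≤s k K ι ι-hom σ gen A excluded M 2≤M M+2≤N
  open MonicCount k
  private
    module k where
      open FiniteField k public
      open FieldProperties k public
    module K where
      open FiniteField K hiding (zero) public
      open FieldProperties K public
    module kP = Polynomial k.rawRing
    module ≈K = SetoidReasoning K.setoid
    module ι = RingMorphisms.IsRingHomomorphism ι-hom
  open SetoidReasoning setoid

  standardElement : ℕ → kP.Poly → K.Carrier → Carrier
  standardElement i z a = C a * ev z * X ^ i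

  standard-unit : ∀ i d z a → d < s → kP.IsMonicOfDegree d z → ¬ (a K.≈ K.0#) → Unit (standardElement i z a)
  standard-unit i d z a d<s m a≉0 = Unit-* (Unit-* (C-unit a≉0) (ev-unit d z d<s m)) (Unit-^ X-unit i)

  standard-twists : ∀ i z a → Twists i (standardElement i z a)
  standard-twists i z a = ≡.subst (λ t → Twists t (standardElement i z a)) (ℕₚ.+-identityʳ i)
    (Twists-* {0} {i} (Twists-* {0} {0} (Twists-C a) (λ b → ev-central z (C b))) (Twists-X^ i))

  private
    standard-co : ∀ d z a → d < s → kP.IsMonicOfDegree d z → ∀ j → co (C a * ev z) (j ℕ.* n) K.≈ a K.* ι (kP.coeff z j)
    standard-co d z a d<s m j = K.trans (co-C* a (ev z) (j ℕ.* n)) (K.*-congˡ (co-ev d z d<s m j))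

    times-1 : ∀ d z → kP.IsMonicOfDegree d z → ∀ a → a K.* ι (kP.coeff z d) K.≈ a
    times-1 d z m a = K.trans (K.*-congˡ (K.trans (ι.⟦⟧-cong (proj₁ m)) ι.1#-homo)) (K.*-identityʳ a)

    no-smaller : ∀ d z a d′ z′ a′ → kP.IsMonicOfDegree d z → kP.IsMonicOfDegree d′ z′ → ¬ (a′ K.≈ K.0#) →
      (∀ j → a K.* ι (kP.coeff z j) K.≈ a′ K.* ι (kP.coeff z′ j)) → ¬ (d < d′)
    no-smaller d z a d′ z′ a′ m m′ a′≉0 e d<d′ = a′≉0 (≈K.begin
      a′ ≈K.≈⟨ times-1 d′ z′ m′ a′ ⟨
      a′ K.* ι (kP.coeff z′ d′) ≈K.≈⟨ e d′ ⟨
      a K.* ι (kP.coeff z d′) ≈K.≈⟨ K.*-congˡ (K.trans (ι.⟦⟧-cong (proj₂ m d′ d<d′)) ι.0#-homo) ⟩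
      a K.* K.0# ≈K.≈⟨ K.zeroʳ a ⟩
      K.0# ≈K.∎)

    same-degree : ∀ d z a d′ z′ a′ → kP.IsMonicOfDegree d z → kP.IsMonicOfDegree d′ z′ → ¬ (a K.≈ K.0#) → d ≡ d′ →
      (∀ j → a K.* ι (kP.coeff z j) K.≈ a′ K.* ι (kP.coeff z′ j)) → z kP.≈ₚ z′ × a K.≈ a′
    same-degree d z a d z′ a′ m m′ a≉0 ≡.refl e = (λ j → G.ι-injective (K.*-cancelˡ a a≉0 (K.trans (e j) (K.*-congʳ (K.sym a≈a′))))) , a≈a′
      where
      a≈a′ : a K.≈ a′
      a≈a′ = K.trans (K.sym (times-1 d z m a)) (K.trans (e d) (times-1 d z′ m′ a′))

  -- The conjugation action on K gives i, since i < n. After X^i is cancelled, a is the leading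
  -- coefficient because z is monic, and then z follows.
  standard-unique : ∀ i d z a i′ d′ z′ a′ → i < n → i′ < n → d < s → d′ < s →
    kP.IsMonicOfDegree d z → kP.IsMonicOfDegree d′ z′ → ¬ (a K.≈ K.0#) → ¬ (a′ K.≈ K.0#) →
    standardElement i z a ≈ standardElement i′ z′ a′ → i ≡ i′ × z kP.≈ₚ z′ × a K.≈ a′
  standard-unique i d z a i′ d′ z′ a′ i<n i′<n d<s d′<s m m′ a≉0 a′≉0 e =
    i≡i′ , same-degree d z a d′ z′ a′ m m′ a≉0
      (ℕₚ.≤-antisym (ℕₚ.≮⇒≥ (no-smaller d′ z′ a′ d z a m′ m a≉0 (K.sym ∘ coefficients)))
                    (ℕₚ.≮⇒≥ (no-smaller d z a d′ z′ a′ m m′ a′≉0 coefficients)))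
      coefficients
    where
    i≡i′ : i ≡ i′
    i≡i′ = let D , _ , ≉0 , _ = unit-leading N _ (standard-unit i d z a d<s m a≉0) (Deg<-N _) in
      ≡.trans (≡.sym (DivMod.m<n⇒m%n≡m i<n))
        (≡.trans (≡.sym (Twists-co {i} (standard-twists i z a) D ≉0))
          (≡.trans (Twists-co {i′} (Twists-resp {i′} (sym e) (standard-twists i′ z′ a′)) D ≉0) (DivMod.m<n⇒m%n≡m i′<n)))
    cancelled : C a * ev z ≈ C a′ * ev z′
    cancelled = cancelʳ (Unit-^ X-unit i) (trans e (*-congˡ (reflexive (≡.cong (X ^_) (≡.sym i≡i′)))))
    coefficients : ∀ j → a K.* ι (kP.coeff z j) K.≈ a′ K.* ι (kP.coeff z′ j)
    coefficients j = K.trans (K.sym (standard-co d z a d<s m j)) (K.trans (co-cong cancelled (j ℕ.* n)) (standard-co d′ z′ a′ d′<s m′ j))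

  private
    sandwich : ∀ x y → (∀ a e → e < M → S (x * (C a * X ^ e) * y)) → ∀ c → S c → S (x * c * y)
    sandwich x y mono = Deg<-induction (λ c → S (x * c * y))
      (λ e → Deg<-resp (*-congʳ (*-congˡ e)))
      (λ {u} {v} Su Sv → Deg<-resp (trans (sym (distribʳ y _ _)) (*-congʳ (sym (distribˡ x u v)))) (Deg<-+ Su Sv))
      (λ i p → K.trans (co-cong (trans (*-congʳ (zeroʳ x)) (zeroˡ y)) i) (co-0 i))
      M (ℕₚ.<⇒≤ M<N) mono

    -- Both sides are a constant times z(Xⁿ) X^(i+e), and the hypothesis equates the constants. For
    -- g and h⁻¹ in standard form it says g (c X^e) h = r X^e, so g S h = S can be checked on
    -- monomials.
    exchange : ∀ i z a b c r e → r K.* σ^ e b K.≈ a K.* σ^ i c →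
      standardElement i z a * (C c * X ^ e) ≈ C r * X ^ e * standardElement i z b
    exchange i z a b c r e p = begin
      C a * ev z * X ^ i * (C c * X ^ e) ≈⟨ solve *-monoid ⟩
      C a * (ev z * (X ^ i * C c * X ^ e)) ≈⟨ *-congˡ (*-congˡ (*-congʳ (Twists-X^ i c))) ⟩
      C a * (ev z * (C (σ^ i c) * X ^ i * X ^ e)) ≈⟨ *-congˡ (ev-central z _) ⟩
      C a * (C (σ^ i c) * X ^ i * X ^ e * ev z) ≈⟨ solve *-monoid ⟩
      C a * C (σ^ i c) * (X ^ i * X ^ e) * ev z ≈⟨ *-congʳ (*-cong (trans (sym (C-* a _)) (trans (C-cong (K.sym p)) (C-* r _))) X-swap) ⟩
      C r * C (σ^ e b) * (X ^ e * X ^ i) * ev z ≈⟨ solve *-monoid ⟩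
      C r * (C (σ^ e b) * X ^ e) * (X ^ i * ev z) ≈⟨ *-cong (*-congˡ (sym (Twists-X^ e b))) (sym (ev-central z _)) ⟩
      C r * (X ^ e * C b) * (ev z * X ^ i) ≈⟨ solve *-monoid ⟩
      C r * X ^ e * (C b * ev z * X ^ i) ∎
      where
      X-swap : X ^ i * X ^ e ≈ X ^ e * X ^ i
      X-swap = trans (sym (^-homo-* X i e)) (trans (reflexive (≡.cong (X ^_) (ℕₚ.+-comm i e))) (^-homo-* X e i))

  module _ (i : ℕ) (z : kP.Poly) (a b : K.Carrier) (a≉0 : ¬ (a K.≈ K.0#)) (b≉0 : ¬ (b K.≈ K.0#))
    (g⁻¹ h : Carrier) (g⁻¹g : g⁻¹ * standardElement i z a ≈ 1#) (gg⁻¹ : standardElement i z a * g⁻¹ ≈ 1#)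
    (hh⁻¹ : h * standardElement i z b ≈ 1#) (h⁻¹h : standardElement i z b * h ≈ 1#) where
    private
      g = standardElement i z a
      h⁻¹ = standardElement i z b

      S-monomial : ∀ r e → e < M → S (C r * X ^ e)
      S-monomial r e e<M = monomial-Deg< r e e<M (ℕₚ.<-trans e<M M<N)

    standard-preserves : ∀ c → S c → S (g * c * h)
    standard-preserves = sandwich g h λ c e e<M →
      let r = a K.* σ^ i c K.* σ^ e b K.⁻¹ in Deg<-resp (begin
        C r * X ^ e ≈⟨ trans (*-congˡ h⁻¹h) (*-identityʳ _) ⟨
        C r * X ^ e * (h⁻¹ * h) ≈⟨ *-assoc _ _ h ⟨
        C r * X ^ e * h⁻¹ * h ≈⟨ *-congʳ (exchange i z a b c r e
          (K.trans (K.*-assoc _ _ _) (K.trans (K.*-congˡ (K.⁻¹-inverseˡ (σ^-≉0 e b≉0))) (K.*-identityʳ _)))) ⟨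
        g * (C c * X ^ e) * h ∎) (S-monomial r e e<M)

    -- The inverse map f ↦ g⁻¹ f h⁻¹ also sends monomials of S to monomials of S; the new
    -- coefficient exists because σ^i is surjective.
    standard-reflects : ∀ f → S f → ∃ λ c → S c × f ≈ g * c * h
    standard-reflects f Sf = g⁻¹ * f * h⁻¹ , sandwich g⁻¹ h⁻¹ mono f Sf , (begin
      f ≈⟨ trans (*-congʳ gg⁻¹) (*-identityˡ f) ⟨
      g * g⁻¹ * f ≈⟨ trans (*-congˡ h⁻¹h) (*-identityʳ _) ⟨
      g * g⁻¹ * f * (h⁻¹ * h) ≈⟨ solve *-monoid ⟩
      g * (g⁻¹ * f * h⁻¹) * h ∎)
      where
      mono : ∀ c e → e < M → S (g⁻¹ * (C c * X ^ e) * h⁻¹)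
      mono c e e<M = from (σ^-surjective i (a K.⁻¹ K.* (c K.* σ^ e b)))
        where
        from : (∃ λ r → σ^ i r K.≈ a K.⁻¹ K.* (c K.* σ^ e b)) → S (g⁻¹ * (C c * X ^ e) * h⁻¹)
        from (r , p) = Deg<-resp (begin
          C r * X ^ e ≈⟨ trans (*-congʳ g⁻¹g) (*-identityˡ _) ⟨
          g⁻¹ * g * (C r * X ^ e) ≈⟨ *-assoc g⁻¹ g _ ⟩
          g⁻¹ * (g * (C r * X ^ e)) ≈⟨ *-congˡ (exchange i z a b r c e
            (K.sym (K.trans (K.*-congˡ p) (K.trans (K.sym (K.*-assoc _ _ _)) (K.trans (K.*-congʳ (K.⁻¹-inverseʳ a≉0)) (K.*-identityˡ _)))))) ⟩
          g⁻¹ * (C c * X ^ e * h⁻¹) ≈⟨ *-assoc g⁻¹ _ h⁻¹ ⟨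
          g⁻¹ * (C c * X ^ e) * h⁻¹ ∎) (S-monomial r e e<M)

  Automorphisms : Set _
  Automorphisms = Σ[ (g , h) ∈ Carrier × Carrier ] Unit g × Unit h ×
    (∀ c → S c → S (g * c * h)) × (∀ f → S f → ∃ λ c → S c × f ≈ g * c * h)

  _≈Auts_ : Rel Automorphisms ℓ
  ((g , h) , _) ≈Auts ((g′ , h′) , _) = g ≈ g′ × h ≈ h′

  ≈Auts-isEquivalence : IsEquivalence _≈Auts_
  ≈Auts-isEquivalence = On.isEquivalence proj₁ (×-isEquivalence isEquivalence isEquivalence)

  private
    K* : Set _
    K* = Σ[ x ∈ K.Carrier ] ¬ (x K.≈ K.0#)

    _≈*_ : Rel K* ℓ₂
    x ≈* y = proj₁ x K.≈ proj₁ y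

    ≈*-isEquivalence : IsEquivalence _≈*_
    ≈*-isEquivalence = On.isEquivalence proj₁ K.isEquivalence

    Parameters : Set _
    Parameters = Fin n × MonicBelow s × K* × K*

    _≈Par_ : Rel Parameters _
    (i , z , a , b) ≈Par (i′ , z′ , a′ , b′) = i ≡ i′ × z ≈ₘ z′ × a ≈* a′ × b ≈* b′

    ≈Par-isEquivalence : IsEquivalence _≈Par_
    ≈Par-isEquivalence = ×-isEquivalence ≡.isEquivalence (×-isEquivalence (≈ₘ-isEquivalence {s}) (×-isEquivalence ≈*-isEquivalence ≈*-isEquivalence))

    K*-cardinality : HasCardinality K* _≈*_ (q ℕ.^ n ℕ.∸ 1)
    K*-cardinality = without-cardinality K.isEquivalence K.cardinality K.0#

    Parameters-cardinality : HasCardinality Parameters _≈Par_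
      (n ℕ.* (geometric q s ℕ.* ((q ℕ.^ n ℕ.∸ 1) ℕ.* (q ℕ.^ n ℕ.∸ 1))))
    Parameters-cardinality =
      ×-cardinality ≡.isEquivalence (×-isEquivalence (≈ₘ-isEquivalence {s}) (×-isEquivalence ≈*-isEquivalence ≈*-isEquivalence))
        (id , id , λ y → y , id)
        (×-cardinality (≈ₘ-isEquivalence {s}) (×-isEquivalence ≈*-isEquivalence ≈*-isEquivalence) (MonicBelow-cardinality s)
          (×-cardinality ≈*-isEquivalence ≈*-isEquivalence K*-cardinality K*-cardinality))

    element : Fin n → MonicBelow s → K* → Carrier
    element i (z , _) (a , _) = standardElement (toℕ i) z a

    element-unit : ∀ i z a → Unit (element i z a)
    element-unit i (z , d , d<s , m) (a , a≉0) = standard-unit (toℕ i) d z a d<s m a≉0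

    element-cong : ∀ {i z a i′ z′ a′} → i ≡ i′ → z ≈ₘ z′ → a ≈* a′ → element i z a ≈ element i′ z′ a′
    element-cong ≡.refl z≈ a≈ = *-congʳ (*-cong (C-cong a≈) (ev-cong z≈))

    element-injective : ∀ i z a i′ z′ a′ → element i z a ≈ element i′ z′ a′ → i ≡ i′ × z ≈ₘ z′ × a ≈* a′
    element-injective i (z , d , d<s , m) (a , a≉0) i′ (z′ , d′ , d′<s , m′) (a′ , a′≉0) e =
      let p , r = standard-unique (toℕ i) d z a (toℕ i′) d′ z′ a′ (Finₚ.toℕ<n i) (Finₚ.toℕ<n i′) d<s d′<s m m′ a≉0 a′≉0 e
      in Finₚ.toℕ-injective p , r

    -- h is the inverse of a standard element: g and h⁻¹ share i and z, while a and b are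
    -- independent.
    toAut : Parameters → Automorphisms
    toAut (i , z , a , b) = (element i z a , h) ,
      (g⁻¹ , g⁻¹g , gg⁻¹) , (element i z b , h⁻¹h , hh⁻¹) ,
      standard-preserves (toℕ i) (proj₁ z) (proj₁ a) (proj₁ b) (proj₂ a) (proj₂ b) g⁻¹ h g⁻¹g gg⁻¹ hh⁻¹ h⁻¹h ,
      standard-reflects (toℕ i) (proj₁ z) (proj₁ a) (proj₁ b) (proj₂ a) (proj₂ b) g⁻¹ h g⁻¹g gg⁻¹ hh⁻¹ h⁻¹h
      where
      g⁻¹ = proj₁ (element-unit i z a)
      g⁻¹g = proj₁ (proj₂ (element-unit i z a))
      gg⁻¹ = proj₂ (proj₂ (element-unit i z a))
      h = proj₁ (element-unit i z b)
      hh⁻¹ = proj₁ (proj₂ (element-unit i z b))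
      h⁻¹h = proj₂ (proj₂ (element-unit i z b))

    inverse-cong : ∀ {u u′ v v′} → v * u ≈ 1# → u′ * v′ ≈ 1# → u ≈ u′ → v ≈ v′
    inverse-cong {u} {u′} {v} {v′} vu u′v′ e = begin
      v ≈⟨ trans (*-congˡ u′v′) (*-identityʳ v) ⟨
      v * (u′ * v′) ≈⟨ *-assoc v u′ v′ ⟨
      v * u′ * v′ ≈⟨ *-congʳ (trans (*-congˡ (sym e)) vu) ⟩
      1# * v′ ≈⟨ *-identityˡ v′ ⟩
      v′ ∎

    inverse-of : ∀ i z b → proj₁ (element-unit i z b) * element i z b ≈ 1# × element i z b * proj₁ (element-unit i z b) ≈ 1#
    inverse-of i z b = proj₂ (element-unit i z b)

    toAut-cong : ∀ {x y} → x ≈Par y → toAut x ≈Auts toAut y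
    toAut-cong {i , z , a , b} {i′ , z′ , a′ , b′} (i≡ , z≈ , a≈ , b≈) =
      element-cong {i} {z} {a} {i′} {z′} {a′} i≡ z≈ a≈ ,
      inverse-cong (proj₁ (inverse-of i z b)) (proj₂ (inverse-of i′ z′ b′)) (element-cong {i} {z} {b} {i′} {z′} {b′} i≡ z≈ b≈)

    toAut-injective : ∀ {x y} → toAut x ≈Auts toAut y → x ≈Par y
    toAut-injective {i , z , a , b} {i′ , z′ , a′ , b′} (g≈ , h≈) =
      let i≡ , z≈ , a≈ = element-injective i z a i′ z′ a′ g≈
          _ , _ , b≈ = element-injective i z b i′ z′ b′ (inverse-cong (proj₂ (inverse-of i z b)) (proj₁ (inverse-of i′ z′ b′)) h≈)
      in i≡ , z≈ , a≈ , b≈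

    toAut-surjective : ∀ y → ∃ λ x → toAut x ≈Auts y
    toAut-surjective ((g , h) , g-unit , h-unit , fwd , bwd) = from (standard g h g-unit h-unit fwd bwd)
      where
      from : (∃ λ i → i < n × ∃ λ d → ∃ λ z → ∃ λ a → ∃ λ b → Standard g i d z a × Standard (proj₁ h-unit) i d z b) →
             ∃ λ x → toAut x ≈Auts ((g , h) , g-unit , h-unit , fwd , bwd)
      from (i , i<n , d , z , a , b , g-std , h-std) = (i′ , z′ , (a , gs.a≉0) , (b , hs.a≉0)) ,
        trans (*-congˡ (reflexive (≡.cong (X ^_) (Finₚ.toℕ-fromℕ< i<n)))) (sym gs.form) ,
        inverse-cong (proj₁ (inverse-of i′ z′ (b , hs.a≉0))) (proj₁ (proj₂ h-unit))
          (trans (*-congˡ (reflexive (≡.cong (X ^_) (Finₚ.toℕ-fromℕ< i<n)))) (sym hs.form))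
        where
        module gs = Standard g-std
        module hs = Standard h-std
        i′ = fromℕ< i<n
        z′ : MonicBelow s
        z′ = z , d , gs.d<s , gs.monic

  Automorphisms-cardinality : HasCardinality Automorphisms _≈Auts_
    (n ℕ.* (geometric q s ℕ.* ((q ℕ.^ n ℕ.∸ 1) ℕ.* (q ℕ.^ n ℕ.∸ 1))))
  Automorphisms-cardinality = transfer-cardinality ≈Par-isEquivalence ≈Auts-isEquivalence Parameters-cardinality
    toAut (λ {x} {y} → toAut-cong {x} {y}) (λ {x} {y} → toAut-injective {x} {y}) toAut-surjective

-- Irreducibility of F and inverses modulo F.

module _ {c ℓ} (Q : Ring c ℓ) where
  open Ring Q hiding (zero)
  open Units Q
  open Exp semiring
  open RingProperties Q using (-‿distribˡ-*; -‿distribʳ-*)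
  open SetoidReasoning setoid

  -- Multiplying f = q z + r by y c gives y c q z = y c f - 1 - t f, so an inverse of c r modulo f
  -- yields one of z.
  euclid-step : ∀ {f z q r c y t} → f ≈ q * z + r → y * (c * r) ≈ 1# + t * f →
                (- (y * c * q)) * z ≈ 1# + (t - y * c) * f
  euclid-step {f} {z} {q} {r} {c} {y} {t} e inv = begin
    (- (y * c * q)) * z ≈⟨ -‿distribˡ-* _ z ⟨
    - (y * c * q * z) ≈⟨ +-identityˡ _ ⟨
    0# - y * c * q * z ≈⟨ +-congʳ (-‿inverseʳ (y * c * f)) ⟨
    (y * c * f - y * c * f) - y * c * q * z ≈⟨ trans (+-assoc _ _ _) (trans (+-congˡ (+-comm _ _)) (sym (+-assoc _ _ _))) ⟩
    (y * c * f - y * c * q * z) - y * c * f ≈⟨ +-congʳ (+-congʳ split) ⟩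
    (y * c * q * z + y * (c * r) - y * c * q * z) - y * c * f
      ≈⟨ +-congʳ (trans (+-congʳ (+-comm _ _)) (trans (+-assoc _ _ _) (trans (+-congˡ (-‿inverseʳ _)) (+-identityʳ _)))) ⟩
    y * (c * r) - y * c * f ≈⟨ +-congʳ inv ⟩
    1# + t * f - y * c * f ≈⟨ +-assoc _ _ _ ⟩
    1# + (t * f - y * c * f) ≈⟨ +-congˡ (+-congˡ (-‿distribˡ-* _ f)) ⟩
    1# + (t * f + (- (y * c)) * f) ≈⟨ +-congˡ (distribʳ f t _) ⟨
    1# + (t - y * c) * f ∎
    where
    split : y * c * f ≈ y * c * q * z + y * (c * r)
    split = begin
      y * c * f ≈⟨ *-congˡ e ⟩
      y * c * (q * z + r) ≈⟨ distribˡ _ _ r ⟩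
      y * c * (q * z) + y * c * r ≈⟨ +-cong (sym (*-assoc _ q z)) (*-assoc y c r) ⟩
      y * c * q * z + y * (c * r) ∎

  power-unit : ∀ x y m → (∀ u → y * u ≈ u * y) → y * x ^ suc m ≈ 1# → Unit x
  power-unit x y m y-central e = y * x ^ m ,
    (begin
      y * x ^ m * x ≈⟨ *-assoc y _ x ⟩
      y * (x ^ m * x) ≈⟨ *-congˡ (x^-comm m) ⟩
      y * x ^ suc m ≈⟨ e ⟩
      1# ∎) ,
    (begin
      x * (y * x ^ m) ≈⟨ *-assoc x y _ ⟨
      x * y * x ^ m ≈⟨ *-congʳ (y-central x) ⟨
      y * x * x ^ m ≈⟨ *-assoc y x _ ⟩
      y * x ^ suc m ≈⟨ e ⟩
      1# ∎)
    where
    x^-comm : ∀ m → x ^ m * x ≈ x * x ^ m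
    x^-comm zero    = trans (*-identityˡ x) (sym (*-identityʳ x))
    x^-comm (suc m) = trans (*-assoc x _ x) (*-congˡ (x^-comm m))

module IrreduciblePolynomial {c ℓ q} (k : FiniteField c ℓ q) {s : ℕ} (2≤s : 2 ≤ s)
  (F : List (FiniteField.Carrier k)) (F-monic : Polynomial.IsMonicOfDegree (FiniteField.rawRing k) s F)
  (F-irreducible : Polynomial.Irreducible (FiniteField.rawRing k) F) where
  open FiniteField k hiding (zero)
  open FieldProperties k
  open P
  private
    module R = Ring polyRing
    module F = RawSemiringDefs.Irreducible F-irreducible
  open RawMagmaDefs R.*-rawMagma using (_∣ʳ_; _,_)

  private
    monic-nonunit : ∀ d z → Monic (suc d) z → ¬ (z ∣ʳ const 1#)
    monic-nonunit d z m (w , e) = 0≉1 (trans (sym (R.*-congʳ {z} {w} {[]} w≈0 0)) (e 0))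
      where
      w≈0 : w ≈ₚ []
      w≈0 i = quotient-Deg< z m 0 w
        (Deg<-cong (const 1#) (w *ₚ z) (λ i → sym (e i)) (λ { zero () ; (suc i) _ → refl })) i z≤n

  -- Otherwise F = F′ X, and both factors have positive degree because s ≥ 2.
  F₀≉0 : ¬ (coeff F 0 ≈ 0#)
  F₀≉0 F₀≈0 = go F F-monic F.split-∣1 F₀≈0 2≤s
    where
    go : ∀ {s} F → Monic s F → (∀ {x y} → F ≈ₚ x *ₚ y → x ∣ʳ const 1# ⊎ y ∣ʳ const 1#) → coeff F 0 ≈ 0# → ¬ (2 ≤ s)
    go []      (l , _)  split F₀≈0 _ = 0≉1 l
    go (f ∷ F) (l , dF) split F₀≈0 (s≤s (s≤s {n = s} _)) with split {F} {X} (λ { zero → trans F₀≈0 (sym (coeff-*X-zero F)) ; (suc i) → sym (coeff-*X-suc F i) })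
    ... | inj₁ F∣1     = monic-nonunit s F (l , λ i p → dF (suc i) (s≤s p)) F∣1
    ... | inj₂ (w , e) = 0≉1 (trans (sym (coeff-*X-zero w)) (e 0))

  InvertibleModF : Poly → Set _
  InvertibleModF z = ∃ λ y → ∃ λ t → y *ₚ z ≈ₚ const 1# +ₚ t *ₚ F

  private
    leading : ∀ d r → Deg< d r → (r ≈ₚ []) ⊎ ∃ λ e → e < d × ¬ (coeff r e ≈ 0#) × Deg< (suc e) r
    leading zero    r dr = inj₁ λ i → dr i z≤n
    leading (suc d) r dr with coeff r d ≟ 0#
    ... | no  ≉0 = inj₂ (d , ℕₚ.≤-refl , ≉0 , dr)
    ... | yes ≈0 with leading d r (Deg<-step r dr ≈0)
    ...   | inj₁ e = inj₁ e
    ...   | inj₂ (e , e<d , ≉0 , de) = inj₂ (e , ℕₚ.m<n⇒m<1+n e<d , ≉0 , de)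

    -- Descent on the degree: z inverts modulo F once F mod z does.
    descend : ∀ b d z → d < b → Monic d z → d < s → InvertibleModF z
    descend (suc b) zero    z _ (l , dz) _ = const 1# , [] ,
      λ { zero → trans (R.*-identityˡ z 0) l ; (suc i) → trans (R.*-identityˡ z (suc i)) (dz (suc i) (s≤s z≤n)) }
    descend (suc b) (suc d) z (s≤s d<b) m d<s with divMod z m (*ₚ-comm z X) F
    ... | q , r , dr , e with leading (suc d) r dr
    -- The remainder is scaled to be monic, so that the recursion applies to it.
    ...   | inj₂ (e′ , e′≤d , a≉0 , de) =
      let y , t , inv = descend b e′ (const (a ⁻¹) *ₚ r) (ℕₚ.<-≤-trans e′≤d d<b) r-monic (ℕₚ.<-trans e′≤d d<s)
      in R.- (y *ₚ const (a ⁻¹) *ₚ q) , t R.- y *ₚ const (a ⁻¹) , euclid-step polyRing {F} {z} {q} {r} {const (a ⁻¹)} {y} {t} e inv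
      where
      a : Carrier
      a = coeff r e′
      r-monic : Monic e′ (const (a ⁻¹) *ₚ r)
      r-monic = trans (coeff-const* (a ⁻¹) r e′) (⁻¹-inverseˡ a≉0) , Deg<-const* (a ⁻¹) r de
    -- Now z divides F. If z is a unit, this contradicts its positive degree; if q is a unit, z is a
    -- multiple of F of smaller degree, hence 0, which no monic polynomial is.
    ...   | inj₁ r≈0 with F.split-∣1 {q} {z} (λ i → trans (e i) (trans (coeff-+ (q *ₚ z) r i) (trans (+-congˡ (r≈0 i)) (+-identityʳ _))))
    ...     | inj₂ z∣1     = ⊥-elim (monic-nonunit d z m z∣1)
    ...     | inj₁ (w , wq) = ⊥-elim (1≉0 (trans (sym (proj₁ m)) (trans (z≈wF (suc d)) (R.*-congʳ {F} {w} {[]} w≈0 (suc d)))))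
      where
      F≈qz : F ≈ₚ q *ₚ z
      F≈qz i = trans (e i) (trans (coeff-+ (q *ₚ z) r i) (trans (+-congˡ (r≈0 i)) (+-identityʳ _)))
      z≈wF : z ≈ₚ w *ₚ F
      z≈wF i = sym (trans (R.*-congˡ {w} {F} {q *ₚ z} F≈qz i) (trans (sym (R.*-assoc w q z i))
        (trans (R.*-congʳ {z} {w *ₚ q} {const 1#} wq i) (R.*-identityˡ z i))))
      w≈0 : w ≈ₚ []
      w≈0 i = quotient-Deg< F F-monic 0 w (Deg<-cong z (w *ₚ F) z≈wF (Deg<-mono z d<s (proj₂ m))) i z≤n

  invertible-mod-F : ∀ d z → Monic d z → d < s → InvertibleModF z
  invertible-mod-F d z = descend (suc d) d z ℕₚ.≤-refl

-- The concrete quotient has the required properties.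

module Instance {c₁ ℓ₁ c₂ ℓ₂} {q n : ℕ} (2≤q : 2 ≤ q) .{{nz : NonZero n}}
  (k : FiniteField c₁ ℓ₁ q) (K : FiniteField c₂ ℓ₂ (q ℕ.^ n))
  (ι : FiniteField.Carrier k → FiniteField.Carrier K) (ι-hom : IsExtension k K ι)
  (σ : FiniteField.Carrier K → FiniteField.Carrier K) (gen : GeneratesGaloisGroup k K ι σ)
  (s : ℕ) (2≤s : 2 ≤ s) (F : List (FiniteField.Carrier k)) (F-monic : Polynomial.IsMonicOfDegree (FiniteField.rawRing k) s F)
  (F-irreducible : Polynomial.Irreducible (FiniteField.rawRing k) F)
  where
  private
    module k where
      open FiniteField k public
      open FieldProperties k public
    module K where
      open FiniteField K hiding (zero) public
      open FieldProperties K public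
    module ι = RingMorphisms.IsRingHomomorphism ι-hom
    module G = Galois 2≤q k K ι ι-hom σ gen
  open SkewRing K.commutativeRing σ G.σ-hom
  open SkewQuotient 2≤q k K ι ι-hom σ gen s F F-monic public
  open Code k K ι σ n F using (evalXⁿ; _≈F_)
  open IrreduciblePolynomial k 2≤s F F-monic F-irreducible
  private
    module R = Ring polyRing
    module Q = Ring quotientRing
    module U = Units quotientRing
  open RawMagmaDefs R.*-rawMagma using (_,_)
  open Exp Q.semiring using (_^_)
  open RawSemiringDefs (RawRing.rawSemiring rawRingₚ) using () renaming (_^_ to _^ᵖ_)

  private
    ^≡^ᵖ : ∀ f m → f ^ m ≡ f ^ᵖ m
    ^≡^ᵖ f zero    = ≡.refl
    ^≡^ᵖ f (suc m) = ≡.cong (f *ₚ_) (^≡^ᵖ f m)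

  private
    P~0 : P ≈F []
    P~0 = const K.1# , λ i → K.trans (R.*-identityˡ P i) (K.sym (R.+-identityʳ P i))

    -- F(Xⁿ) has nonzero constant term, so X is a unit modulo F(Xⁿ).
    X-unit : U.Unit X
    X-unit = go F F₀≉0 P~0
      where
      go : ∀ f → ¬ (k.P.coeff f 0 k.≈ k.0#) → evalXⁿ f ≈F [] → U.Unit X
      go []      f₀≉0 _  = ⊥-elim (f₀≉0 k.refl)
      go (a ∷ f) a≉0  e  = power-unit quotientRing X y (n ℕ.∸ 1) y-central
        (≡.subst (λ t → y *ₚ t ≈F const K.1#)
          (≡.trans (≡.sym (^≡^ᵖ X n)) (≡.cong (X ^_) (≡.sym (ℕₚ.suc-pred n)))) yXⁿ)
        where
        b : k.Carrier
        b = k.- (a k.⁻¹)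
        y : Poly
        y = const (ι b) *ₚ evalXⁿ f
        open SetoidReasoning Q.setoid
        y-central : ∀ u → y *ₚ u ≈F u *ₚ y
        y-central u = begin
          const (ι b) *ₚ evalXⁿ f *ₚ u ≈⟨ Q.*-assoc (const (ι b)) (evalXⁿ f) u ⟩
          const (ι b) *ₚ (evalXⁿ f *ₚ u) ≈⟨ ≈⇒~ {const (ι b) *ₚ (evalXⁿ f *ₚ u)} {(evalXⁿ f *ₚ u) *ₚ const (ι b)} (ι-central b (evalXⁿ f *ₚ u)) ⟩
          evalXⁿ f *ₚ u *ₚ const (ι b) ≈⟨ Q.*-congʳ {const (ι b)} {evalXⁿ f *ₚ u} {u *ₚ evalXⁿ f} (≈⇒~ {evalXⁿ f *ₚ u} {u *ₚ evalXⁿ f} (evalXⁿ-central f u)) ⟩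
          u *ₚ evalXⁿ f *ₚ const (ι b) ≈⟨ Q.*-assoc u (evalXⁿ f) (const (ι b)) ⟩
          u *ₚ (evalXⁿ f *ₚ const (ι b)) ≈⟨ Q.*-congˡ {u} {evalXⁿ f *ₚ const (ι b)} {y} (≈⇒~ {evalXⁿ f *ₚ const (ι b)} {y} (λ i → K.sym (ι-central b (evalXⁿ f) i))) ⟩
          u *ₚ y ∎
        ιba : const (ι b) *ₚ const (ι a) ≈ₚ const (K.- K.1#)
        ιba zero    = K.trans (coeff-const* (ι b) (const (ι a)) 0) (K.trans (K.sym (ι.*-homo b a))
          (K.trans (ι.⟦⟧-cong (k.trans (k.sym (-‿distribˡ-* _ _)) (k.-‿cong (k.⁻¹-inverseˡ a≉0)))) (K.trans (ι.-‿homo k.1#) (K.-‿cong ι.1#-homo))))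
          where open RingProperties k.ring using (-‿distribˡ-*)
        ιba (suc i) = K.trans (coeff-const* (ι b) (const (ι a)) (suc i)) (K.zeroʳ _)
        -- Multiplying a + f(Xⁿ) Xⁿ = 0 by b = −1/a.
        yXⁿ : y *ₚ X ^ᵖ n ≈F const K.1#
        yXⁿ = begin
          y *ₚ X ^ᵖ n ≈⟨ Q.+-identityˡ (y *ₚ X ^ᵖ n) ⟨
          [] +ₚ y *ₚ X ^ᵖ n ≈⟨ Q.+-congʳ {y *ₚ X ^ᵖ n} {const K.1# +ₚ const (K.- K.1#)} {[]} (≈⇒~ {const K.1# +ₚ const (K.- K.1#)} {[]} (λ { zero → K.-‿inverseʳ K.1# ; (suc i) → K.refl })) ⟨
          const K.1# +ₚ const (K.- K.1#) +ₚ y *ₚ X ^ᵖ n ≈⟨ Q.+-assoc (const K.1#) (const (K.- K.1#)) (y *ₚ X ^ᵖ n) ⟩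
          const K.1# +ₚ (const (K.- K.1#) +ₚ y *ₚ X ^ᵖ n) ≈⟨ Q.+-congˡ {const K.1#} {const (K.- K.1#) +ₚ y *ₚ X ^ᵖ n} {[]} zero-sum ⟩
          const K.1# +ₚ [] ≈⟨ Q.+-identityʳ (const K.1#) ⟩
          const K.1# ∎
          where
          zero-sum : const (K.- K.1#) +ₚ y *ₚ X ^ᵖ n ≈F []
          zero-sum = begin
            const (K.- K.1#) +ₚ y *ₚ X ^ᵖ n
              ≈⟨ Q.+-cong {const (K.- K.1#)} {const (ι b) *ₚ const (ι a)} {y *ₚ X ^ᵖ n} {const (ι b) *ₚ (evalXⁿ f *ₚ X ^ᵖ n)}
                   (≈⇒~ {const (K.- K.1#)} {const (ι b) *ₚ const (ι a)} (λ i → K.sym (ιba i))) (Q.*-assoc (const (ι b)) (evalXⁿ f) (X ^ᵖ n)) ⟩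
            const (ι b) *ₚ const (ι a) +ₚ const (ι b) *ₚ (evalXⁿ f *ₚ X ^ᵖ n)
              ≈⟨ Q.distribˡ (const (ι b)) (const (ι a)) (evalXⁿ f *ₚ X ^ᵖ n) ⟨
            const (ι b) *ₚ evalXⁿ (a ∷ f)
              ≈⟨ Q.*-congˡ {const (ι b)} {evalXⁿ (a ∷ f)} {[]} e ⟩
            const (ι b) *ₚ []
              ≈⟨ Q.zeroʳ (const (ι b)) ⟩
            [] ∎

    -- The identity y z = 1 + t F is evaluated at Xⁿ, and F(Xⁿ) = 0 in the quotient.
    ev-unit : ∀ d z → d < s → k.P.Monic d z → U.Unit (evalXⁿ z)
    ev-unit d z d<s m with invertible-mod-F d z m d<s
    ... | y , t , e = evalXⁿ y , left ,
      Q.trans {evalXⁿ z *ₚ evalXⁿ y} {evalXⁿ y *ₚ evalXⁿ z} {const K.1#}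
        (≈⇒~ {evalXⁿ z *ₚ evalXⁿ y} {evalXⁿ y *ₚ evalXⁿ z} (evalXⁿ-central z (evalXⁿ y))) left
      where
      open SetoidReasoning Q.setoid
      lift : ∀ {f g} → f ≈ₚ g → f ≈F g
      lift {f} {g} = ≈⇒~ {f} {g}
      ev-1 : evalXⁿ (k.P.const k.1#) ≈ₚ const K.1#
      ev-1 zero    = ι.1#-homo
      ev-1 (suc i) = K.refl
      left : evalXⁿ y *ₚ evalXⁿ z ≈F const K.1#
      left = begin
        evalXⁿ y *ₚ evalXⁿ z ≈⟨ lift {evalXⁿ (y k.P.*ₚ z)} {evalXⁿ y *ₚ evalXⁿ z} (evalXⁿ-* y z) ⟨
        evalXⁿ (y k.P.*ₚ z) ≈⟨ lift {evalXⁿ (y k.P.*ₚ z)} {evalXⁿ (k.P.const k.1# k.P.+ₚ t k.P.*ₚ F)} (evalXⁿ-cong (y k.P.*ₚ z) (k.P.const k.1# k.P.+ₚ t k.P.*ₚ F) e) ⟩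
        evalXⁿ (k.P.const k.1# k.P.+ₚ t k.P.*ₚ F) ≈⟨ lift {evalXⁿ (k.P.const k.1# k.P.+ₚ t k.P.*ₚ F)} {evalXⁿ (k.P.const k.1#) +ₚ evalXⁿ (t k.P.*ₚ F)} (evalXⁿ-+ (k.P.const k.1#) (t k.P.*ₚ F)) ⟩
        evalXⁿ (k.P.const k.1#) +ₚ evalXⁿ (t k.P.*ₚ F) ≈⟨ Q.+-cong {evalXⁿ (k.P.const k.1#)} {const K.1#} {evalXⁿ (t k.P.*ₚ F)} {evalXⁿ t *ₚ P} (lift {evalXⁿ (k.P.const k.1#)} {const K.1#} ev-1) (lift {evalXⁿ (t k.P.*ₚ F)} {evalXⁿ t *ₚ P} (evalXⁿ-* t F)) ⟩
        const K.1# +ₚ evalXⁿ t *ₚ P ≈⟨ Q.+-congˡ {const K.1#} {evalXⁿ t *ₚ P} {evalXⁿ t *ₚ []} (Q.*-congˡ {evalXⁿ t} {P} {[]} P~0) ⟩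
        const K.1# +ₚ evalXⁿ t *ₚ [] ≈⟨ Q.+-congˡ {const K.1#} {evalXⁿ t *ₚ []} {[]} (Q.zeroʳ (evalXⁿ t)) ⟩
        const K.1# +ₚ [] ≈⟨ Q.+-identityʳ (const K.1#) ⟩
        const K.1# ∎

    0<n : 0 < n
    0<n = ℕ.>-nonZero⁻¹ n

    1≤N : 1 ≤ N
    1≤N = ℕₚ.*-mono-≤ (ℕₚ.<⇒≤ 2≤s) 0<n

    ev-Deg<N : ∀ d z → d < s → k.P.Monic d z → Deg< N (evalXⁿ z)
    ev-Deg<N d z d<s m = Deg<-mono (evalXⁿ z) (ℕₚ.*-monoˡ-< n d<s) (evalXⁿ-Deg< d z (proj₂ m))

    1-Deg<N : Deg< N (const K.1#)
    1-Deg<N = Deg<-mono (const K.1#) 1≤N (λ { (suc i) _ → K.refl })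

  skewQuotientRing : SkewQuotientRing k K ι σ n s _ _
  skewQuotientRing = record
    { Q = quotientRing
    ; C = const
    ; C-cong = λ {a} {b} e → ≈⇒~ {const a} {const b} λ { zero → e ; (suc i) → K.refl }
    ; C-+ = λ a b → Q.refl {const (a K.+ b)}
    ; C-* = λ a b → ≈⇒~ {const (a K.* b)} {const a *ₚ const b} λ
        { zero → K.sym (coeff-const* a (const b) 0) ; (suc i) → K.sym (K.trans (coeff-const* a (const b) (suc i)) (K.zeroʳ a)) }
    ; C-1 = Q.refl {const K.1#}
    ; C-ι-central = λ a u → ≈⇒~ {const (ι a) *ₚ u} {u *ₚ const (ι a)} (ι-central a u)
    ; X = X
    ; X-C = λ a → ≈⇒~ {X *ₚ const a} {const (σ a) *ₚ X} (X-const a)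
    ; Xⁿ-central = λ u → ≡.subst (λ t → t *ₚ u ≈F u *ₚ t) (≡.sym (^≡^ᵖ X n)) (≈⇒~ {X ^ᵖ n *ₚ u} {u *ₚ X ^ᵖ n} (Xⁿ-central u))
    ; X-unit = X-unit
    ; co = co
    ; co-cong = λ {u} {v} → co-cong {u} {v}
    ; co-injective = co-injective
    ; co-vanish = co-vanish
    ; co-+ = co-+
    ; co-C* = co-const*
    ; co-*C = co-*const
    ; co-1-zero = co-reduced (const K.1#) 1-Deg<N 0
    ; co-1-suc = λ i → co-reduced (const K.1#) 1-Deg<N (suc i)
    ; co-X*-suc = co-X*-suc
    ; co-*X-zero = co-*X-zero
    ; co-*X-suc = co-*X-suc
    ; ev = evalXⁿ
    ; ev-central = λ z u → ≈⇒~ {evalXⁿ z *ₚ u} {u *ₚ evalXⁿ z} (evalXⁿ-central z u)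
    ; ev-cong = λ {z} {w} e → ≈⇒~ {evalXⁿ z} {evalXⁿ w} (evalXⁿ-cong z w e)
    ; ev-unit = ev-unit
    ; co-ev = λ d z d<s m j → K.trans (co-reduced (evalXⁿ z) (ev-Deg<N d z d<s m) (j ℕ.* n)) (coeff-evalXⁿ z j)
    ; co-ev-% = λ d z d<s m i p → K.trans (co-reduced (evalXⁿ z) (ev-Deg<N d z d<s m) i) (coeff-evalXⁿ-% z i p)
    }

  -- If n = s = 2 and X⁴ is constant then F₁ = 0, since X⁴ − F(X²) is reduced.
  X⁴-constant : (∀ ν → ¬ (ν k.≈ k.0#) → ¬ (n ≡ 2 × s ≡ 2 × F k.P.≈ₚ Polynomial.Y²-_ k.rawRing ν)) →
                n ≡ 2 → s ≡ 2 → ∀ ν → ¬ (X ^ 4 ≈F const ν)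
  -- Once F₁ = 0, F is Y² + F₀, so -F₀ is the witness; it is nonzero because F is irreducible of
  -- degree at least 2.
  X⁴-constant excluded n≡2 s≡2 ν e = excluded (k.- k.P.coeff F 0)
    (λ p → F₀≉0 (k.trans (k.sym (k-involutive _)) (k.trans (k.-‿cong p) k.-0#≈0#)))
    (n≡2 , s≡2 , F≈)
    where
    open RingProperties k.ring using () renaming (-‿involutive to k-involutive)
    f : Poly
    f = X ^ 4 +ₚ map (K.-_) P
    N≡4 : N ≡ 4
    N≡4 = ≡.cong₂ ℕ._*_ s≡2 n≡2
    X⁴-monic : Monic 4 (X ^ 4)
    X⁴-monic = Monic-* 1 3 X (X ^ 3) Monic-X (Monic-* 1 2 X (X ^ 2) Monic-X (Monic-* 1 1 X (X ^ 1) Monic-X (Monic-* 1 0 X (const K.1#) Monic-X Monic-1)))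
    X⁴-monicN : Monic N (X ^ 4)
    X⁴-monicN = ≡.subst (λ t → Monic t (X ^ 4)) (≡.sym N≡4) X⁴-monic
    f-Deg< : Deg< N f
    f-Deg< = Deg<-step f (Deg<-+ (X ^ 4) (map (K.-_) P) (proj₂ X⁴-monicN) (Deg<-neg P (proj₂ P-monic)))
      (K.trans (coeff-- (X ^ 4) P N) (K.x≈y⇒x-y≈0 (K.trans (proj₁ X⁴-monicN) (K.sym (proj₁ P-monic)))))
    f~ν : f ≈F const ν
    f~ν = begin
      X ^ 4 +ₚ map (K.-_) P ≈⟨ Q.+-cong {X ^ 4} {const ν} {map (K.-_) P} {[]} e (Q.-‿cong {P} {[]} P~0) ⟩
      const ν +ₚ [] ≈⟨ Q.+-identityʳ (const ν) ⟩
      const ν ∎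
      where open SetoidReasoning Q.setoid
    -- The coefficient of Xⁿ = X² in X⁴ - F(X²) is -F₁, and in a constant it is 0.
    at-n : coeff f (1 ℕ.* n) K.≈ coeff (const ν) (1 ℕ.* n)
    at-n = reduced-unique f (const ν) f-Deg< (Deg<-mono (const ν) 1≤N (λ { (suc i) _ → K.refl })) f~ν (1 ℕ.* n)
    X⁴-at-n : coeff (X ^ 4) (1 ℕ.* n) K.≈ K.0#
    X⁴-at-n = K.trans (K.sym (R.*-identityˡ (X ^ 4) (1 ℕ.* n)))
      (coeff-*X^-< 4 (const K.1#) (1 ℕ.* n) (≡.subst (λ t → 1 ℕ.* t < 4) (≡.sym n≡2) (s≤s (s≤s (s≤s z≤n)))))
    const-at-n : ∀ {m} → m ≡ 2 → coeff (const ν) (1 ℕ.* m) K.≈ K.0#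
    const-at-n ≡.refl = K.refl
    F₁≈0 : k.P.coeff F 1 k.≈ k.0#
    F₁≈0 = G.ι-injective (begin
      ι (k.P.coeff F 1) ≈⟨ coeff-evalXⁿ F 1 ⟨
      coeff P (1 ℕ.* n) ≈⟨ K-involutive _ ⟨
      K.- (K.- coeff P (1 ℕ.* n)) ≈⟨ K.-‿cong (K.+-identityˡ _) ⟨
      K.- (K.0# K.- coeff P (1 ℕ.* n)) ≈⟨ K.-‿cong (K.+-congʳ X⁴-at-n) ⟨
      K.- (coeff (X ^ 4) (1 ℕ.* n) K.- coeff P (1 ℕ.* n)) ≈⟨ K.-‿cong (coeff-- (X ^ 4) P (1 ℕ.* n)) ⟨
      K.- coeff f (1 ℕ.* n) ≈⟨ K.-‿cong (K.trans at-n (const-at-n n≡2)) ⟩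
      K.- K.0# ≈⟨ K.-0#≈0# ⟩
      K.0# ≈⟨ ι.0#-homo ⟨
      ι k.0# ∎)
      where
      open SetoidReasoning K.setoid
      open RingProperties K.ring using () renaming (-‿involutive to K-involutive)
    F≈ : F k.P.≈ₚ Polynomial.Y²-_ k.rawRing (k.- k.P.coeff F 0)
    F≈ zero                = k.sym (k-involutive _)
    F≈ (suc zero)          = F₁≈0
    F≈ (suc (suc zero))    = ≡.subst (λ t → k.P.coeff F t k.≈ k.1#) s≡2 (proj₁ F-monic)
    F≈ (suc (suc (suc i))) = proj₂ F-monic (3 ℕ.+ i) (≡.subst (_< 3 ℕ.+ i) (≡.sym s≡2) (s≤s (s≤s (s≤s z≤n))))

-- The linear automorphism group of the code.

module _ {c₁ ℓ₁ c₂ ℓ₂} {q n s m : ℕ} (2≤q : 2 ≤ q) (2≤n : 2 ≤ n) (2≤s : 2 ≤ s) (1≤m : 1 ≤ m) (m<n : suc m ≤ n)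
  (k : FiniteField c₁ ℓ₁ q) (K : FiniteField c₂ ℓ₂ (q ℕ.^ n))
  (ι : FiniteField.Carrier k → FiniteField.Carrier K) (ι-hom : IsExtension k K ι)
  (σ : FiniteField.Carrier K → FiniteField.Carrier K) (gen : GeneratesGaloisGroup k K ι σ)
  (F : List (FiniteField.Carrier k)) (F-monic : Polynomial.IsMonicOfDegree (FiniteField.rawRing k) s F)
  (F-irreducible : Polynomial.Irreducible (FiniteField.rawRing k) F)
  (excluded : ∀ ν → ¬ (FiniteField._≈_ k ν (FiniteField.0# k)) → ¬ (n ≡ 2 × s ≡ 2 × Polynomial._≈ₚ_ (FiniteField.rawRing k) F (Polynomial.Y²-_ (FiniteField.rawRing k) ν)))
  where
  private
    n-nonZero : NonZero n
    n-nonZero = ℕ.>-nonZero (ℕₚ.<⇒≤ 2≤n)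
    module I = Instance {n = n} 2≤q {{n-nonZero}} k K ι ι-hom σ gen s 2≤s F F-monic F-irreducible

    2≤M : 2 ≤ s ℕ.* m
    2≤M = ℕₚ.*-mono-≤ 2≤s 1≤m

    -- Here m is the code parameter k: 2 + s m ≤ s + s m = s (m + 1) ≤ s n.
    M+2≤N : 2 ℕ.+ s ℕ.* m ≤ s ℕ.* n
    M+2≤N = ℕₚ.≤-trans (ℕₚ.+-monoˡ-≤ (s ℕ.* m) 2≤s)
      (ℕₚ.≤-trans (ℕₚ.≤-reflexive (≡.sym (ℕₚ.*-suc s m))) (ℕₚ.*-monoʳ-≤ s m<n))

    M≤N : s ℕ.* m ≤ s ℕ.* n
    M≤N = ℕₚ.*-monoʳ-≤ s (ℕₚ.<⇒≤ m<n)

    module A = AutomorphismCount {n = n} {s = s} {{n-nonZero}} 2≤q 2≤n 2≤s k K ι ι-hom σ gen I.skewQuotientRing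
      (I.X⁴-constant excluded) (s ℕ.* m) 2≤M M+2≤N
    open Code k K ι σ n F

    𝒮⇒S : ∀ {f} → 𝒮 (s ℕ.* m) f → ∀ i → s ℕ.* m ≤ i → FiniteField._≈_ K (I.co f i) (FiniteField.0# K)
    𝒮⇒S {f} = I.𝒮⇒co M≤N {f}

  -- `Aut` and `Automorphisms` differ in how membership in the code is expressed: by a list of
  -- coefficients or by vanishing coordinates.
  Aut-cardinality : HasCardinality (Aut (𝒮 (s ℕ.* m))) _≈Aut_
    (n ℕ.* (geometric q s ℕ.* ((q ℕ.^ n ℕ.∸ 1) ℕ.* (q ℕ.^ n ℕ.∸ 1))))
  Aut-cardinality = transfer-cardinality A.≈Auts-isEquivalence
    (On.isEquivalence proj₁ (×-isEquivalence R.isEquivalence R.isEquivalence))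
    A.Automorphisms-cardinality to id id
    (λ { ((g , h) , g-unit , h-unit , (⊆ , ⊇)) →
      ((g , h) , g-unit , h-unit ,
        (λ c Sc → 𝒮⇒S {g R.* c R.* h} (⊆ {g R.* c R.* h} (c , I.co⇒𝒮 c Sc , R.refl {g R.* c R.* h}))) ,
        (λ f Sf → let c , 𝒮c , e = ⊇ {f} (I.co⇒𝒮 f Sf) in c , 𝒮⇒S {c} 𝒮c , e)) ,
      R.refl {g} , R.refl {h} })
    where
    module R = Ring I.quotientRing
    to : A.Automorphisms → Aut (𝒮 (s ℕ.* m))
    to ((g , h) , g-unit , h-unit , fwd , bwd) = (g , h) , g-unit , h-unit ,
      (λ { {f} (c , 𝒮c , e) → I.co⇒𝒮 f (λ i p → FiniteField.trans K (I.co-cong {f} {g R.* c R.* h} e i) (fwd c (𝒮⇒S {c} 𝒮c) i p)) }) ,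
      (λ {f} 𝒮f → let c , Sc , e = bwd f (𝒮⇒S {f} 𝒮f) in c , I.co⇒𝒮 c Sc , e)

-- The division is exact, because the geometric sum times q - 1 is q^s - 1.
automorphism-count : ∀ q n s ⦃ _ : IsPrimePower q ⦄ → 1 ≤ q →
  n ℕ.* (geometric q s ℕ.* ((q ℕ.^ n ℕ.∸ 1) ℕ.* (q ℕ.^ n ℕ.∸ 1))) ≡
  n ℕ.* (((q ℕ.^ s ℕ.∸ 1) ℕ.* (q ℕ.^ n ℕ.∸ 1) ℕ.^ 2) ℕ./ (q ℕ.∸ 1))
automorphism-count q n s 1≤q = ≡.cong (n ℕ.*_) (≡.sym (begin
  ((q ℕ.^ s ℕ.∸ 1) ℕ.* t ℕ.^ 2) ℕ./ (q ℕ.∸ 1) ≡⟨ ≡.cong (ℕ._/ (q ℕ.∸ 1)) (≡.cong₂ ℕ._*_ (≡.sym (geometric-sum q s 1≤q)) (≡.cong (t ℕ.*_) (ℕₚ.*-identityʳ t))) ⟩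
  (geometric q s ℕ.* (q ℕ.∸ 1) ℕ.* (t ℕ.* t)) ℕ./ (q ℕ.∸ 1) ≡⟨ ≡.cong (ℕ._/ (q ℕ.∸ 1)) swap ⟩
  (geometric q s ℕ.* (t ℕ.* t) ℕ.* (q ℕ.∸ 1)) ℕ./ (q ℕ.∸ 1) ≡⟨ DivMod.m*n/n≡m (geometric q s ℕ.* (t ℕ.* t)) (q ℕ.∸ 1) ⟩
  geometric q s ℕ.* (t ℕ.* t) ∎))
  where
  open ≡.≡-Reasoning
  t = q ℕ.^ n ℕ.∸ 1
  g = geometric q s
  swap : g ℕ.* (q ℕ.∸ 1) ℕ.* (t ℕ.* t) ≡ g ℕ.* (t ℕ.* t) ℕ.* (q ℕ.∸ 1)
  swap = ≡.trans (ℕₚ.*-assoc g (q ℕ.∸ 1) _) (≡.trans (≡.cong (g ℕ.*_) (ℕₚ.*-comm (q ℕ.∸ 1) _)) (≡.sym (ℕₚ.*-assoc g _ (q ℕ.∸ 1))))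

open import Data.Nat using (_*_; _∸_; _^_; _/_)

corollary6p7 :
    ∀ {c₁ ℓ₁ c₂ ℓ₂} (q n s k : ℕ) ⦃ _ : IsPrimePower q ⦄ →
    2 ≤ n → 2 ≤ s → 1 ≤ k → k ≤ n ∸ 1 →
    (𝔽q : FiniteField c₁ ℓ₁ q) (𝔽qⁿ : FiniteField c₂ ℓ₂ (q ^ n)) →
    let module 𝔽q = FiniteField 𝔽q
        module 𝔽qⁿ = FiniteField 𝔽qⁿ
        open Polynomial 𝔽q.rawRing
    in
    (ι : 𝔽q.Carrier → 𝔽qⁿ.Carrier) → IsExtension 𝔽q 𝔽qⁿ ι →
    (σ : 𝔽qⁿ.Carrier → 𝔽qⁿ.Carrier) → GeneratesGaloisGroup 𝔽q 𝔽qⁿ ι σ →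
    (F : Poly) → IsMonicOfDegree s F → Irreducible F →
    (∀ ν → ¬ (ν 𝔽q.≈ 𝔽q.0#) → ¬ (n ≡ 2 × s ≡ 2 × F ≈ₚ (Y²- ν))) →
    let open Code 𝔽q 𝔽qⁿ ι σ n F in
    HasCardinality (Aut (𝒮 (s * k))) _≈Aut_
      (n * (((q ^ s ∸ 1) * (q ^ n ∸ 1) ^ 2) / (q ∸ 1)))
corollary6p7 q n s k 2≤n 2≤s 1≤k k≤n-1 𝔽q 𝔽qⁿ ι ι-hom σ gen F F-monic F-irreducible excluded =
  ≡.subst (HasCardinality (Aut (𝒮 (s * k))) _≈Aut_) (automorphism-count q n s (ℕₚ.<⇒≤ 2≤q))
    (Aut-cardinality 2≤q 2≤n 2≤s 1≤k k<n 𝔽q 𝔽qⁿ ι ι-hom σ gen F F-monic F-irreducible excluded)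
  where
  open Code 𝔽q 𝔽qⁿ ι σ n F
  2≤q : 2 ≤ q
  2≤q = ℕₚ.m∸n≢0⇒n<m {q} {1} (ℕₚ.n>0⇒n≢0 (ℕ.>-nonZero⁻¹ (q ∸ 1)))
  k<n : suc k ≤ n
  k<n = ℕₚ.≤-trans (s≤s k≤n-1) (ℕₚ.≤-reflexive (ℕₚ.m+[n∸m]≡n (ℕₚ.<⇒≤ 2≤n)))
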